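{- For each basic sequence $Q$ consider the seven sets $$N(Q),\quad RN(Q),\quad DN(Q),\quad N(Q)\cap RN(Q),\quad RN(Q)\cap DN(Q),\quad N(Q)\cap DN(Q),\quad N(Q)\cap RN(Q)\cap DN(Q),$$ and let $G$ be the directed graph whose vertices are these seven (formal) labels and whose directed edges are exactly: $RN\cap DN\to RN$; $RN\cap DN\to DN$; $N\to RN$; $N\cap DN\to RN\cap DN$; $N\cap DN\to N$; $N\cap RN\cap DN\to N\cap DN$; $N\cap DN\to N\cap RN\cap DN$; $N\to N\cap RN$; $N\cap RN\to N$. Then $G$ represents the complete containment relationship for basic sequences that are infinite in limit and fully divergent: for any two vertices $A$ and $B$ of $G$, the containment $A(Q)\subseteq B(Q)$ holds for every basic sequence $Q$ that is infinite in limit and fully divergent if and only if there is a directed path (possibly of length $0$) in $G$ from $A$ to $B$.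
   Context: A basic sequence is a sequence $Q=(q_n)_{n\ge1}$ of integers $q_n\ge 2$. The $Q$-Cantor series expansion of $x\in\mathbb{R}$ is the unique expansion $x=E_0+\sum_{n\ge1}\frac{E_n}{q_1\cdots q_n}$ with $E_0=\lfloor x\rfloor$, $E_n\in\{0,1,\ldots,q_n-1\}$ for $n\ge 1$, and $E_n\ne q_n-1$ for infinitely many $n$. $Q$ is infinite in limit if $q_n\to\infty$. Put $Q_n^{(k)}=\sum_{j=1}^n \frac1{q_jq_{j+1}\cdots q_{j+k-1}}$; $Q$ is $k$-divergent if $\lim_{n\to\infty}Q_n^{(k)}=\infty$ and fully divergent if it is $k$-divergent for all $k\ge1$. A block of length $k$ is an ordered $k$-tuple of non-negative integers. $N_n^Q(B,x)$ is the number of occurrences of the block $B$ starting at positions $\le n$ in the sequence of digits $E_1,E_2,\ldots$ of the $Q$-Cantor series expansion of $x$. $N(Q)$ ($Q$-normal numbers) is the set of real $x$ such that for every $k\ge1$ and every block $B$ of length $k$, $\lim_{n\to\infty}N_n^Q(B,x)/Q_n^{(k)}=1$. $RN(Q)$ ($Q$-ratio normal numbers) is the set of real $x$ such that for every $k\ge1$ and all blocks $B_1,B_2$ of length $k$, $\lim_{n\to\infty}N_n^Q(B_1,x)/N_n^Q(B_2,x)=1$. $DN(Q)$ ($Q$-distribution normal numbers) is the set of real $x$ such that the sequence $(q_1\cdots q_n x \bmod 1)_{n\ge0}$ is uniformly distributed mod $1$. -}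

module Defs where

open import Level using (0ℓ)
open import Data.Nat.Base as ℕ using (ℕ; zero; suc; _+_; _*_; _≤_; _⊔_; NonZero)
import Data.Nat.Properties as ℕₚ
open import Data.Integer.Base as ℤ using (ℤ; +_)
open import Data.Rational.Base as ℚ using (ℚ; 0ℚ; 1ℚ; ½; ∣_∣)
import Data.Rational.Properties as ℚₚ
open import Data.Fin.Base using (toℕ)
open import Data.Vec.Base using (Vec; tabulate)
import Data.Vec.Properties as Vecₚ
open import Data.List.Base using (length; filter; upTo)
open import Data.Product using (∃; _×_; _,_; proj₁; proj₂)
open import Algebra.Bundles using (AbelianGroup)
import Algebra.Properties.CommutativeSemigroup as CommutativeSemigroupProperties
open import Relation.Nullary using (¬_; Dec; yes; no)
open import Relation.Unary using (Pred; _∩_)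
open import Relation.Binary.PropositionalEquality
  using (_≡_; _≢_; sym; trans; cong; cong₂; subst; module ≡-Reasoning)

------------------------------------------------------------------------
-- Rational preliminaries

fromℤ : ℤ → ℚ
fromℤ m = m ℚ./ 1

fromℕ : ℕ → ℚ
fromℕ n = fromℤ (+ n)

-- Division with the convention p / 0 = 0.  A quotient with limit 1 cannot take
-- the junk value 0 infinitely often, so the assertions "… /₀ … ⟶ 1" below force
-- the denominators to be eventually non-zero; in c /₀ n only n = 0 is affected.
infixl 7 _/₀_
_/₀_ : ℚ → ℚ → ℚ
p /₀ q with q ℚₚ.≟ 0ℚ
... | yes _   = 0ℚ
... | no  q≢0 = (p ℚ.÷ q) {{ℚ.≢-nonZero q≢0}}

-- ∑ n f = f 0 + ⋯ + f (n - 1)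
∑ : ℕ → (ℕ → ℚ) → ℚ
∑ zero    f = 0ℚ
∑ (suc n) f = ∑ n f ℚ.+ f n

------------------------------------------------------------------------
-- Real numbers: Cauchy sequences of rationals.  Equality of reals is never
-- used; all notions below are invariant under Cauchy equivalence.

IsCauchy : (ℕ → ℚ) → Set
IsCauchy s = ∀ ε → 0ℚ ℚ.< ε →
  ∃ λ N → ∀ m n → N ≤ m → N ≤ n → ∣ s m ℚ.- s n ∣ ℚ.< ε

record ℝ : Set where
  constructor mkℝ
  field
    seq    : ℕ → ℚ
    cauchy : IsCauchy seq

open ℝ public

private
  half-pos : ∀ {ε} → 0ℚ ℚ.< ε → 0ℚ ℚ.< ½ ℚ.* ε
  half-pos {ε} ε>0 =
    subst (ℚ._< ½ ℚ.* ε) (ℚₚ.*-zeroʳ ½) (ℚₚ.*-monoʳ-<-pos ½ ε>0)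

  half+half : ∀ ε → ½ ℚ.* ε ℚ.+ ½ ℚ.* ε ≡ ε
  half+half ε = trans (sym (ℚₚ.*-distribʳ-+ ε ½ ½)) (ℚₚ.*-identityˡ ε)

  open CommutativeSemigroupProperties
    (AbelianGroup.commutativeSemigroup ℚₚ.+-0-abelianGroup) using (interchange)

  sub-interchange : ∀ a b c d →
    (a ℚ.- b) ℚ.- (c ℚ.- d) ≡ (a ℚ.- c) ℚ.- (b ℚ.- d)
  sub-interchange a b c d = begin
    (a ℚ.- b) ℚ.- (c ℚ.- d)               ≡⟨ cong ((a ℚ.- b) ℚ.+_) (ℚₚ.neg-distrib-+ c (ℚ.- d)) ⟩
    (a ℚ.- b) ℚ.+ (ℚ.- c ℚ.+ ℚ.- (ℚ.- d)) ≡⟨ interchange a (ℚ.- b) (ℚ.- c) (ℚ.- (ℚ.- d)) ⟩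
    (a ℚ.- c) ℚ.+ (ℚ.- b ℚ.+ ℚ.- (ℚ.- d)) ≡⟨ cong ((a ℚ.- c) ℚ.+_) (ℚₚ.neg-distrib-+ b (ℚ.- d)) ⟨
    (a ℚ.- c) ℚ.- (b ℚ.- d)               ∎
    where open ≡-Reasoning

  mul-sub : ∀ c a b → c ℚ.* a ℚ.- c ℚ.* b ≡ c ℚ.* (a ℚ.- b)
  mul-sub c a b = trans (cong (c ℚ.* a ℚ.+_) (ℚₚ.neg-distribʳ-* c b))
                        (sym (ℚₚ.*-distribˡ-+ c a (ℚ.- b)))

  scale-cauchy : ∀ c {{_ : ℚ.Positive c}} s → IsCauchy s → IsCauchy (λ n → c ℚ.* s n)
  scale-cauchy c {{c⁺}} s hs ε ε>0 = N , λ m n N≤m N≤n → begin-strict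
      ∣ c ℚ.* s m ℚ.- c ℚ.* s n ∣ ≡⟨ cong ∣_∣ (mul-sub c (s m) (s n)) ⟩
      ∣ c ℚ.* (s m ℚ.- s n) ∣     ≡⟨ ℚₚ.∣p*q∣≡∣p∣*∣q∣ c (s m ℚ.- s n) ⟩
      ∣ c ∣ ℚ.* ∣ s m ℚ.- s n ∣   ≡⟨ cong (ℚ._* ∣ s m ℚ.- s n ∣) (ℚₚ.0≤p⇒∣p∣≡p (ℚₚ.<⇒≤ (ℚₚ.positive⁻¹ c))) ⟩
      c ℚ.* ∣ s m ℚ.- s n ∣       <⟨ ℚₚ.*-monoʳ-<-pos c (h m n N≤m N≤n) ⟩
      c ℚ.* (c⁻¹ ℚ.* ε)           ≡⟨ ℚₚ.*-assoc c c⁻¹ ε ⟨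
      (c ℚ.* c⁻¹) ℚ.* ε           ≡⟨ cong (ℚ._* ε) (ℚₚ.*-inverseʳ c {{c≢0}}) ⟩
      1ℚ ℚ.* ε                    ≡⟨ ℚₚ.*-identityˡ ε ⟩
      ε                           ∎
    where
    open ℚₚ.≤-Reasoning
    c≢0 : ℚ.NonZero c
    c≢0 = ℚₚ.pos⇒nonZero c
    c⁻¹ : ℚ
    c⁻¹ = (ℚ.1/ c) {{c≢0}}
    δ>0 : 0ℚ ℚ.< c⁻¹ ℚ.* ε
    δ>0 = subst (ℚ._< c⁻¹ ℚ.* ε) (ℚₚ.*-zeroʳ c⁻¹)
      (ℚₚ.*-monoʳ-<-pos c⁻¹ {{ℚₚ.1/pos⇒pos c}} ε>0)
    N = hs (c⁻¹ ℚ.* ε) δ>0 .proj₁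
    h = hs (c⁻¹ ℚ.* ε) δ>0 .proj₂

fromℚ : ℚ → ℝ
fromℚ q = mkℝ (λ _ → q) λ ε ε>0 →
  0 , λ _ _ _ _ → subst (λ r → ∣ r ∣ ℚ.< ε) (sym (ℚₚ.+-inverseʳ q)) ε>0

infixl 6 _-ᴿ_
_-ᴿ_ : ℝ → ℝ → ℝ
seq    (x -ᴿ y) n = seq x n ℚ.- seq y n
cauchy (x -ᴿ y) ε ε>0 =
  let (N₁ , h₁) = cauchy x (½ ℚ.* ε) (half-pos ε>0)
      (N₂ , h₂) = cauchy y (½ ℚ.* ε) (half-pos ε>0)
  in N₁ ⊔ N₂ , λ m n N≤m N≤n →
    let open ℚₚ.≤-Reasoning
        a = seq x m ; b = seq y m ; c = seq x n ; d = seq y n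
    in begin-strict
      ∣ (a ℚ.- b) ℚ.- (c ℚ.- d) ∣       ≡⟨ cong ∣_∣ (sub-interchange a b c d) ⟩
      ∣ (a ℚ.- c) ℚ.- (b ℚ.- d) ∣       ≤⟨ ℚₚ.∣p-q∣≤∣p∣+∣q∣ (a ℚ.- c) (b ℚ.- d) ⟩
      ∣ a ℚ.- c ∣ ℚ.+ ∣ b ℚ.- d ∣       <⟨ ℚₚ.+-mono-<
                                            (h₁ m n (ℕₚ.m⊔n≤o⇒m≤o N₁ N₂ N≤m) (ℕₚ.m⊔n≤o⇒m≤o N₁ N₂ N≤n))
                                            (h₂ m n (ℕₚ.m⊔n≤o⇒n≤o N₁ N₂ N≤m) (ℕₚ.m⊔n≤o⇒n≤o N₁ N₂ N≤n)) ⟩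
      ½ ℚ.* ε ℚ.+ ½ ℚ.* ε               ≡⟨ half+half ε ⟩
      ε                                 ∎

infixl 7 _·ᴿ_
_·ᴿ_ : ℕ → ℝ → ℝ
seq    (k ·ᴿ x) n = fromℕ k ℚ.* seq x n
cauchy (zero ·ᴿ x) ε ε>0 =
  0 , λ m n _ _ → subst (λ r → ∣ r ∣ ℚ.< ε)
    (sym (cong₂ ℚ._-_ (ℚₚ.*-zeroˡ (seq x m)) (ℚₚ.*-zeroˡ (seq x n)))) ε>0
cauchy (suc k ·ᴿ x) =
  scale-cauchy (fromℕ (suc k)) {{ℚₚ.normalize-pos (suc k) 1}} (seq x) (cauchy x)

infix 4 _<ᴿ_ _≤ᴿ_
_<ᴿ_ : ℝ → ℝ → Set
x <ᴿ y = ∃ λ ε → 0ℚ ℚ.< ε × ∃ λ N → ∀ n → N ≤ n → seq x n ℚ.+ ε ℚ.≤ seq y n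

_≤ᴿ_ : ℝ → ℝ → Set
x ≤ᴿ y = ¬ (y <ᴿ x)

-- m = ⌊x⌋.  The floor is a relation because it is not a computable function
-- on the reals.
IsFloor : ℝ → ℤ → Set
IsFloor x m = fromℚ (fromℤ m) ≤ᴿ x × x <ᴿ fromℚ (fromℤ (ℤ.suc m))

infix 4 _⟶_ _⟶∞
_⟶_ : (ℕ → ℚ) → ℝ → Set
u ⟶ l = ∀ ε → 0ℚ ℚ.< ε → ∃ λ N → ∀ n → N ≤ n →
  (fromℚ (u n) -ᴿ l <ᴿ fromℚ ε) × (l -ᴿ fromℚ (u n) <ᴿ fromℚ ε)

_⟶∞ : (ℕ → ℚ) → Set
u ⟶∞ = ∀ M → ∃ λ N → ∀ n → N ≤ n → M ℚ.< u n

------------------------------------------------------------------------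
-- Uniform distribution modulo 1

-- The fractional part y - ⌊y⌋ lies in [a , b).
_mod1∈[_,_⟩ : ℝ → ℝ → ℝ → Set
y mod1∈[ a , b ⟩ = ∃ λ m → IsFloor y m ×
  (a ≤ᴿ y -ᴿ fromℚ (fromℤ m)) × (y -ᴿ fromℚ (fromℤ m) <ᴿ b)

-- A n is the number of i < n satisfying P i.
record IsCounting (P : ℕ → Set) (A : ℕ → ℕ) : Set where
  field
    start : A 0 ≡ 0
    hit   : ∀ n → P n → A (suc n) ≡ suc (A n)
    miss  : ∀ n → ¬ P n → A (suc n) ≡ A n

-- Classically every P has exactly one counting function, so quantifying over A
-- merely names it; membership of a real in an interval being undecidable, it
-- cannot be given by a formula.
UniformlyDistributedMod1 : (ℕ → ℝ) → Set
UniformlyDistributedMod1 y =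
  ∀ a b → fromℚ 0ℚ ≤ᴿ a → a <ᴿ b → b ≤ᴿ fromℚ 1ℚ →
  ∀ A → IsCounting (λ n → y n mod1∈[ a , b ⟩) A →
  (λ n → fromℕ (A n) /₀ fromℕ n) ⟶ (b -ᴿ a)

------------------------------------------------------------------------
-- Cantor series.  Sequences indexed by n ≥ 1 are stored shifted: q n and E n
-- stand for q₍ₙ₊₁₎ and E₍ₙ₊₁₎, and E₀ is kept separately.

record BasicSequence : Set where
  field
    q   : ℕ → ℕ
    q≥2 : ∀ n → 2 ≤ q n

open BasicSequence public

-- ∏ Q j k = q₍ⱼ₊₁₎ ⋯ q₍ⱼ₊ₖ₎
∏ : BasicSequence → ℕ → ℕ → ℕ
∏ Q j zero    = 1
∏ Q j (suc k) = ∏ Q j k * q Q (j + k)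

∏-nonZero : ∀ {Q j k} → NonZero (∏ Q j k)
∏-nonZero {Q} {j} {zero}  = _
∏-nonZero {Q} {j} {suc k} =
  ℕₚ.m*n≢0 (∏ Q j k) (q Q (j + k))
    {{∏-nonZero {Q} {j} {k}}}
    {{ℕ.>-nonZero (ℕₚ.≤-trans (ℕₚ.n≤1+n 1) (q≥2 Q (j + k)))}}

-- Qsum Q k n is the sum written Qₙ⁽ᵏ⁾.
Qsum : BasicSequence → ℕ → ℕ → ℚ
Qsum Q k n = ∑ n λ j → (+ 1 ℚ./ ∏ Q j k) {{∏-nonZero {Q} {j} {k}}}

InfiniteInLimit : BasicSequence → Set
InfiniteInLimit Q = (λ n → fromℕ (q Q n)) ⟶∞

Divergent : ℕ → BasicSequence → Set
Divergent k Q = Qsum Q k ⟶∞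

FullyDivergent : BasicSequence → Set
FullyDivergent Q = ∀ k → 1 ≤ k → Divergent k Q

record IsExpansion (Q : BasicSequence) (x : ℝ) (E₀ : ℤ) (E : ℕ → ℕ) : Set where
  field
    floor      : IsFloor x E₀
    digit      : ∀ n → E n ℕ.< q Q n
    nontrivial : ∀ m → ∃ λ n → m ≤ n × suc (E n) ≢ q Q n
    converges  :
      (λ N → fromℤ E₀ ℚ.+
             ∑ N λ n → (+ E n ℚ./ ∏ Q 0 (suc n)) {{∏-nonZero {Q} {0} {suc n}}}) ⟶ x

Block : ℕ → Set
Block k = Vec ℕ k

OccursAt : ∀ {k} → Block k → (ℕ → ℕ) → ℕ → Set
OccursAt B E j = tabulate (λ i → E (j + toℕ i)) ≡ B

occursAt? : ∀ {k} (B : Block k) E j → Dec (OccursAt B E j)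
occursAt? B E j = Vecₚ.≡-dec ℕₚ._≟_ (tabulate (λ i → E (j + toℕ i))) B

occurrences : ∀ {k} → Block k → (ℕ → ℕ) → ℕ → ℚ
occurrences B E n = fromℕ (length (filter (occursAt? B E) (upTo n)))

WithDigits : BasicSequence → ((ℕ → ℕ) → Set) → Pred ℝ 0ℓ
WithDigits Q P x = ∃ λ E₀ → ∃ λ E → IsExpansion Q x E₀ E × P E

Normal : BasicSequence → Pred ℝ 0ℓ
Normal Q = WithDigits Q λ E → ∀ k → 1 ≤ k → (B : Block k) →
  (λ n → occurrences B E n /₀ Qsum Q k n) ⟶ fromℚ 1ℚ

RatioNormal : BasicSequence → Pred ℝ 0ℓ
RatioNormal Q = WithDigits Q λ E → ∀ k → 1 ≤ k → (B₁ B₂ : Block k) →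
  (λ n → occurrences B₁ E n /₀ occurrences B₂ E n) ⟶ fromℚ 1ℚ

DistributionNormal : BasicSequence → Pred ℝ 0ℓ
DistributionNormal Q x = UniformlyDistributedMod1 λ n → ∏ Q 0 n ·ᴿ x

------------------------------------------------------------------------
-- The graph

data Vertex : Set where
  N RN DN N∩RN RN∩DN N∩DN N∩RN∩DN : Vertex

⟦_⟧ : Vertex → BasicSequence → Pred ℝ 0ℓ
⟦ N       ⟧ Q = Normal Q
⟦ RN      ⟧ Q = RatioNormal Q
⟦ DN      ⟧ Q = DistributionNormal Q
⟦ N∩RN    ⟧ Q = Normal Q ∩ RatioNormal Q
⟦ RN∩DN   ⟧ Q = RatioNormal Q ∩ DistributionNormal Q
⟦ N∩DN    ⟧ Q = Normal Q ∩ DistributionNormal Q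
⟦ N∩RN∩DN ⟧ Q = Normal Q ∩ RatioNormal Q ∩ DistributionNormal Q

data Edge : Vertex → Vertex → Set where
  RN∩DN→RN     : Edge RN∩DN RN
  RN∩DN→DN     : Edge RN∩DN DN
  N→RN         : Edge N RN
  N∩DN→RN∩DN   : Edge N∩DN RN∩DN
  N∩DN→N       : Edge N∩DN N
  N∩RN∩DN→N∩DN : Edge N∩RN∩DN N∩DN
  N∩DN→N∩RN∩DN : Edge N∩DN N∩RN∩DN
  N→N∩RN       : Edge N N∩RN
  N∩RN→N       : Edge N∩RN N

{-# OPTIONS --safe #-}

-- N ⊆ RN because both numerators are asymptotic to the same Qₙ⁽ᵏ⁾.  The three
-- non-containments come from one digit sequence.  Stage s consists of rows of
-- length R = (s + 2)³.  The i-th word (i < s) of an enumeration of all blocks is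
-- written at the positions ≡ i (s + 1) modulo (2R)ᵏ, where k is its length; every
-- other digit is the column number or s (s + 1), whichever is larger.  A block of length k
-- then occurs with frequency (2R)⁻ᵏ: inside longer words it occurs at most
-- s (s + 1) times per (2R)ᵏ⁺¹ positions, which is negligible.
--   With qₙ = 2R the number is normal, but every digit is less than qₙ / 2, so it
-- is not distribution normal.  With qₙ = R it is ratio normal and distribution
-- normal, but blocks are too rare by the factor 2ᵏ for it to be normal.  Finally,
-- replacing each digit 0 by 1 keeps it distribution normal and destroys ratio
-- normality.
module Submission where

open import Defs
open import Level using (0ℓ)
open import Data.Nat.Base as ℕ using (ℕ; zero; suc; z≤n; s≤s)
import Data.Nat.Properties as ℕₚ
open import Data.Integer.Base as ℤ using (ℤ; +_)
import Data.Integer.Properties as ℤₚ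
open import Data.Rational.Base as ℚ using (ℚ; 0ℚ; 1ℚ; ½)
import Data.Rational.Properties as ℚₚ
import Data.Rational.Unnormalised.Base as ℚᵘ
import Data.Rational.Unnormalised.Properties as ℚᵘₚ
open import Data.Product using (∃; _×_; _,_; proj₁; proj₂)
open import Data.Sum using (_⊎_; inj₁; inj₂)
open import Data.Empty using (⊥-elim)
open import Data.Maybe.Base using (Maybe; just; nothing)
open import Function using (_∘_)
open import Function.Bundles using (_⇔_; mk⇔)
open import Relation.Nullary using (¬_; Dec; yes; no; contradiction)
open import Relation.Unary using (_⊆_)
open import Relation.Binary.Construct.Closure.ReflexiveTransitive using (Star; _◅_) renaming (ε to nil)
open import Relation.Binary.PropositionalEquality
open import Tactic.RingSolver using (solve-∀)
open import Tactic.RingSolver.Core.AlmostCommutativeRing using (AlmostCommutativeRing; fromCommutativeRing)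

module RationalLemmas where
  open import Data.Rational.Base using (_+_; _*_; _-_; -_; _≤_; _<_; ∣_∣)

  ℚ-ring : AlmostCommutativeRing 0ℓ 0ℓ
  ℚ-ring = fromCommutativeRing ℚₚ.+-*-commutativeRing isZero
    where
    isZero : ∀ p → Maybe (0ℚ ≡ p)
    isZero p with 0ℚ ℚₚ.≟ p
    ... | yes 0≡p = just 0≡p
    ... | no  _   = nothing

  -- Inequalities are proved by a ring identity p = q + r with r visibly
  -- non-negative; such identities are called cert below.
  p≡q+r⇒q≤p : ∀ {p q r} → p ≡ q + r → 0ℚ ≤ r → q ≤ p
  p≡q+r⇒q≤p {p} {q} {r} eq 0≤r =
    subst₂ _≤_ (ℚₚ.+-identityʳ q) (sym eq) (ℚₚ.+-monoʳ-≤ q 0≤r)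

  p≡q+r⇒q<p : ∀ {p q r} → p ≡ q + r → 0ℚ < r → q < p
  p≡q+r⇒q<p {p} {q} {r} eq 0<r =
    subst₂ _<_ (ℚₚ.+-identityʳ q) (sym eq) (ℚₚ.+-monoʳ-< q 0<r)

  p≤q⇒0≤q-p : ∀ {p q} → p ≤ q → 0ℚ ≤ q - p
  p≤q⇒0≤q-p {p} {q} p≤q = subst (_≤ q - p) (ℚₚ.+-inverseʳ p) (ℚₚ.+-monoˡ-≤ (- p) p≤q)

  p<q⇒0<q-p : ∀ {p q} → p < q → 0ℚ < q - p
  p<q⇒0<q-p {p} {q} p<q = subst (_< q - p) (ℚₚ.+-inverseʳ p) (ℚₚ.+-monoˡ-< (- p) p<q)

  +-nonNeg : ∀ {p q} → 0ℚ ≤ p → 0ℚ ≤ q → 0ℚ ≤ p + q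
  +-nonNeg = ℚₚ.+-mono-≤

  *-monoˡ-≤ : ∀ {p q} r → 0ℚ ≤ r → p ≤ q → r * p ≤ r * q
  *-monoˡ-≤ r 0≤r = ℚₚ.*-monoˡ-≤-nonNeg r {{ℚ.nonNegative 0≤r}}

  *-monoˡ-< : ∀ {p q} r → 0ℚ < r → p < q → r * p < r * q
  *-monoˡ-< r 0<r = ℚₚ.*-monoʳ-<-pos r {{ℚ.positive 0<r}}

  *-cancelˡ-≤ : ∀ {p q} r → 0ℚ < r → r * p ≤ r * q → p ≤ q
  *-cancelˡ-≤ r 0<r = ℚₚ.*-cancelˡ-≤-pos r {{ℚ.positive 0<r}}

  *-nonNeg : ∀ {p q} → 0ℚ ≤ p → 0ℚ ≤ q → 0ℚ ≤ p * q
  *-nonNeg {p} {q} 0≤p 0≤q = subst (_≤ p * q) (ℚₚ.*-zeroʳ p) (*-monoˡ-≤ p 0≤p 0≤q)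

  *-pos : ∀ {p q} → 0ℚ < p → 0ℚ < q → 0ℚ < p * q
  *-pos {p} {q} 0<p 0<q = subst (_< p * q) (ℚₚ.*-zeroʳ p) (*-monoˡ-< p 0<p 0<q)

  0<1 : 0ℚ < 1ℚ
  0<1 = ℚₚ.positive⁻¹ 1ℚ

  0≤1 : 0ℚ ≤ 1ℚ
  0≤1 = ℚₚ.<⇒≤ 0<1

  ∣p∣≤ : ∀ {p r} → p ≤ r → - p ≤ r → ∣ p ∣ ≤ r
  ∣p∣≤ {p} {r} p≤r -p≤r with ℚₚ.∣p∣≡p∨∣p∣≡-p p
  ... | inj₁ eq = subst (_≤ r) (sym eq) p≤r
  ... | inj₂ eq = subst (_≤ r) (sym eq) -p≤r

  p≤∣p∣ : ∀ p → p ≤ ∣ p ∣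
  p≤∣p∣ p with ℚₚ.≤-total 0ℚ p
  ... | inj₁ 0≤p = ℚₚ.≤-reflexive (sym (ℚₚ.0≤p⇒∣p∣≡p 0≤p))
  ... | inj₂ p≤0 = ℚₚ.≤-trans p≤0 (ℚₚ.0≤∣p∣ p)

  private
    toℚᵘ-/ : ∀ i d .{{_ : ℕ.NonZero d}} → ℚ.toℚᵘ (i ℚ./ d) ℚᵘ.≃ (i ℚᵘ./ d)
    toℚᵘ-/ i (suc d) = ℚₚ.toℚᵘ-fromℚᵘ (ℚᵘ.mkℚᵘ i d)

  fromℕ-+ : ∀ m n → fromℕ (m ℕ.+ n) ≡ fromℕ m + fromℕ n
  fromℕ-+ m n = ℚₚ.toℚᵘ-injective (begin
    ℚ.toℚᵘ (fromℕ (m ℕ.+ n))                  ≈⟨ toℚᵘ-/ (+ (m ℕ.+ n)) 1 ⟩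
    ℚᵘ.mkℚᵘ (+ (m ℕ.+ n)) 0                   ≈⟨ ℚᵘ.*≡* (cong₂ (λ a b → (a ℤ.+ b) ℤ.* + 1)
                                                   (sym (ℤₚ.*-identityʳ (+ m))) (sym (ℤₚ.*-identityʳ (+ n)))) ⟩
    ℚᵘ.mkℚᵘ (+ m) 0 ℚᵘ.+ ℚᵘ.mkℚᵘ (+ n) 0       ≈⟨ ℚᵘₚ.+-cong (toℚᵘ-/ (+ m) 1) (toℚᵘ-/ (+ n) 1) ⟨
    ℚ.toℚᵘ (fromℕ m) ℚᵘ.+ ℚ.toℚᵘ (fromℕ n)    ≈⟨ ℚₚ.toℚᵘ-homo-+ (fromℕ m) (fromℕ n) ⟨
    ℚ.toℚᵘ (fromℕ m + fromℕ n)                ∎)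
    where open ℚᵘₚ.≃-Reasoning

  fromℕ-* : ∀ m n → fromℕ (m ℕ.* n) ≡ fromℕ m * fromℕ n
  fromℕ-* m n = ℚₚ.toℚᵘ-injective (begin
    ℚ.toℚᵘ (fromℕ (m ℕ.* n))                  ≈⟨ toℚᵘ-/ (+ (m ℕ.* n)) 1 ⟩
    ℚᵘ.mkℚᵘ (+ (m ℕ.* n)) 0                   ≈⟨ ℚᵘ.*≡* (cong (ℤ._* + 1) (ℤₚ.pos-* m n)) ⟩
    ℚᵘ.mkℚᵘ (+ m) 0 ℚᵘ.* ℚᵘ.mkℚᵘ (+ n) 0       ≈⟨ ℚᵘₚ.*-cong (toℚᵘ-/ (+ m) 1) (toℚᵘ-/ (+ n) 1) ⟨
    ℚ.toℚᵘ (fromℕ m) ℚᵘ.* ℚ.toℚᵘ (fromℕ n)    ≈⟨ ℚₚ.toℚᵘ-homo-* (fromℕ m) (fromℕ n) ⟨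
    ℚ.toℚᵘ (fromℕ m * fromℕ n)                ∎)
    where open ℚᵘₚ.≃-Reasoning

  fromℤ-mono-≤ : ∀ {i j} → i ℤ.≤ j → fromℤ i ≤ fromℤ j
  fromℤ-mono-≤ {i} {j} i≤j = ℚₚ.toℚᵘ-cancel-≤ (begin
    ℚ.toℚᵘ (fromℤ i) ≃⟨ toℚᵘ-/ i 1 ⟩
    ℚᵘ.mkℚᵘ i 0      ≤⟨ ℚᵘ.*≤* (ℤₚ.*-monoʳ-≤-nonNeg (+ 1) i≤j) ⟩
    ℚᵘ.mkℚᵘ j 0      ≃⟨ toℚᵘ-/ j 1 ⟨
    ℚ.toℚᵘ (fromℤ j) ∎)
    where open ℚᵘₚ.≤-Reasoning

  fromℕ-mono-≤ : ∀ {m n} → m ℕ.≤ n → fromℕ m ≤ fromℕ n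
  fromℕ-mono-≤ m≤n = fromℤ-mono-≤ (ℤ.+≤+ m≤n)

  fromℕ-nonNeg : ∀ n → 0ℚ ≤ fromℕ n
  fromℕ-nonNeg n = fromℕ-mono-≤ {0} {n} z≤n

  fromℕ-suc : ∀ n → fromℕ (suc n) ≡ fromℕ n + 1ℚ
  fromℕ-suc n = trans (cong fromℕ (ℕₚ.+-comm 1 n)) (fromℕ-+ n 1)

  fromℕ-pos : ∀ n → 0ℚ < fromℕ (suc n)
  fromℕ-pos n = ℚₚ.<-≤-trans 0<1 (fromℕ-mono-≤ {1} {suc n} (s≤s z≤n))

  fromℕ-nonZero⇒pos : ∀ n .{{_ : ℕ.NonZero n}} → 0ℚ < fromℕ n
  fromℕ-nonZero⇒pos (suc n) = fromℕ-pos n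

  fromℕ-mono-< : ∀ {m n} → m ℕ.< n → fromℕ m < fromℕ n
  fromℕ-mono-< {m} {n} m<n =
    ℚₚ.<-≤-trans (p≡q+r⇒q<p (fromℕ-suc m) 0<1) (fromℕ-mono-≤ m<n)

  recip : (d : ℕ) → .{{_ : ℕ.NonZero d}} → ℚ
  recip d = + 1 ℚ./ d

  private
    toℚᵘ-/-* : ∀ a d → ((+ a) ℚᵘ./ suc d) ℚᵘ.* ℚᵘ.mkℚᵘ (+ suc d) 0 ℚᵘ.≃ ℚᵘ.mkℚᵘ (+ a) 0
    toℚᵘ-/-* a d = ℚᵘ.*≡* (trans (ℤₚ.*-identityʳ (+ a ℤ.* + suc d))
      (cong (+ a ℤ.*_) (cong +_ (sym (ℕₚ.*-identityʳ (suc d))))))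

  /-*-cancel : ∀ a d .{{_ : ℕ.NonZero d}} → (+ a ℚ./ d) * fromℕ d ≡ fromℕ a
  /-*-cancel a d@(suc d-1) = ℚₚ.toℚᵘ-injective (begin
    ℚ.toℚᵘ ((+ a ℚ./ d) * fromℕ d)             ≈⟨ ℚₚ.toℚᵘ-homo-* (+ a ℚ./ d) (fromℕ d) ⟩
    ℚ.toℚᵘ (+ a ℚ./ d) ℚᵘ.* ℚ.toℚᵘ (fromℕ d)   ≈⟨ ℚᵘₚ.*-cong (toℚᵘ-/ (+ a) d) (toℚᵘ-/ (+ d) 1) ⟩
    ((+ a) ℚᵘ./ d) ℚᵘ.* ℚᵘ.mkℚᵘ (+ d) 0         ≈⟨ toℚᵘ-/-* a d-1 ⟩
    ℚᵘ.mkℚᵘ (+ a) 0                             ≈⟨ toℚᵘ-/ (+ a) 1 ⟨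
    ℚ.toℚᵘ (fromℕ a)                           ∎)
    where open ℚᵘₚ.≃-Reasoning

  recip-*-cancel : ∀ d .{{_ : ℕ.NonZero d}} → recip d * fromℕ d ≡ 1ℚ
  recip-*-cancel d = /-*-cancel 1 d

  recip-pos : ∀ d .{{_ : ℕ.NonZero d}} → 0ℚ < recip d
  recip-pos d = ℚₚ.positive⁻¹ _ {{ℚₚ.normalize-pos 1 d}}

  recip-nonNeg : ∀ d .{{_ : ℕ.NonZero d}} → 0ℚ ≤ recip d
  recip-nonNeg d = ℚₚ.<⇒≤ (recip-pos d)

  *-cancelʳ-fromℕ : ∀ {p q} d .{{_ : ℕ.NonZero d}} → p * fromℕ d ≡ q * fromℕ d → p ≡ q
  *-cancelʳ-fromℕ {p} {q} d eq = begin
    p                          ≡⟨ ℚₚ.*-identityʳ p ⟨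
    p * 1ℚ                     ≡⟨ cong (p *_) e ⟨
    p * (fromℕ d * recip d)    ≡⟨ ℚₚ.*-assoc p (fromℕ d) (recip d) ⟨
    p * fromℕ d * recip d      ≡⟨ cong (_* recip d) eq ⟩
    q * fromℕ d * recip d      ≡⟨ ℚₚ.*-assoc q (fromℕ d) (recip d) ⟩
    q * (fromℕ d * recip d)    ≡⟨ cong (q *_) e ⟩
    q * 1ℚ                     ≡⟨ ℚₚ.*-identityʳ q ⟩
    q                          ∎
    where
    open ≡-Reasoning
    e : fromℕ d * recip d ≡ 1ℚ
    e = trans (ℚₚ.*-comm (fromℕ d) (recip d)) (recip-*-cancel d)

  /-recip : ∀ a d .{{_ : ℕ.NonZero d}} → + a ℚ./ d ≡ fromℕ a * recip d
  /-recip a d = *-cancelʳ-fromℕ d (begin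
    (+ a ℚ./ d) * fromℕ d         ≡⟨ /-*-cancel a d ⟩
    fromℕ a                       ≡⟨ ℚₚ.*-identityʳ (fromℕ a) ⟨
    fromℕ a * 1ℚ                  ≡⟨ cong (fromℕ a *_) (recip-*-cancel d) ⟨
    fromℕ a * (recip d * fromℕ d) ≡⟨ ℚₚ.*-assoc (fromℕ a) (recip d) (fromℕ d) ⟨
    fromℕ a * recip d * fromℕ d   ∎)
    where open ≡-Reasoning

  fromℕ≤-recip : ∀ a b d .{{_ : ℕ.NonZero d}} → a ℕ.* d ℕ.≤ b → fromℕ a ≤ fromℕ b * recip d
  fromℕ≤-recip a b d h = subst (_≤ fromℕ b * recip d) eq
    (subst₂ _≤_ (ℚₚ.*-comm (recip d) _) (ℚₚ.*-comm (recip d) _)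
      (*-monoˡ-≤ (recip d) (recip-nonNeg d) (fromℕ-mono-≤ h)))
    where
    open ≡-Reasoning
    eq : fromℕ (a ℕ.* d) * recip d ≡ fromℕ a
    eq = begin
      fromℕ (a ℕ.* d) * recip d       ≡⟨ cong (_* recip d) (fromℕ-* a d) ⟩
      fromℕ a * fromℕ d * recip d     ≡⟨ ℚₚ.*-assoc (fromℕ a) (fromℕ d) (recip d) ⟩
      fromℕ a * (fromℕ d * recip d)   ≡⟨ cong (fromℕ a *_) (ℚₚ.*-comm (fromℕ d) (recip d)) ⟩
      fromℕ a * (recip d * fromℕ d)   ≡⟨ cong (fromℕ a *_) (recip-*-cancel d) ⟩
      fromℕ a * 1ℚ                    ≡⟨ ℚₚ.*-identityʳ (fromℕ a) ⟩
      fromℕ a                         ∎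

  recip-* : ∀ c d .{{_ : ℕ.NonZero c}} .{{_ : ℕ.NonZero d}} .{{_ : ℕ.NonZero (c ℕ.* d)}} →
    recip (c ℕ.* d) ≡ recip c * recip d
  recip-* c d = *-cancelʳ-fromℕ (c ℕ.* d) (begin
    recip (c ℕ.* d) * fromℕ (c ℕ.* d)            ≡⟨ recip-*-cancel (c ℕ.* d) ⟩
    1ℚ * 1ℚ                                      ≡⟨ cong₂ _*_ (recip-*-cancel c) (recip-*-cancel d) ⟨
    recip c * fromℕ c * (recip d * fromℕ d)      ≡⟨ eq (recip c) (fromℕ c) (recip d) (fromℕ d) ⟩
    recip c * recip d * (fromℕ c * fromℕ d)      ≡⟨ cong (recip c * recip d *_) (fromℕ-* c d) ⟨
    recip c * recip d * fromℕ (c ℕ.* d)          ∎)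
    where
    open ≡-Reasoning
    eq : ∀ a b c d → a * b * (c * d) ≡ a * c * (b * d)
    eq = solve-∀ ℚ-ring

  recip-anti : ∀ {c d} .{{_ : ℕ.NonZero c}} .{{_ : ℕ.NonZero d}} → c ℕ.≤ d → recip d ≤ recip c
  recip-anti {c} {d} c≤d = subst₂ _≤_ e₁ e₂
    (*-monoˡ-≤ (recip c * recip d) (*-nonNeg (recip-nonNeg c) (recip-nonNeg d)) (fromℕ-mono-≤ c≤d))
    where
    open ≡-Reasoning
    eq : ∀ a b c → a * b * c ≡ a * c * b
    eq = solve-∀ ℚ-ring
    e₁ : recip c * recip d * fromℕ c ≡ recip d
    e₁ = trans (eq (recip c) (recip d) (fromℕ c))
      (trans (cong (_* recip d) (recip-*-cancel c)) (ℚₚ.*-identityˡ (recip d)))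
    e₂ : recip c * recip d * fromℕ d ≡ recip c
    e₂ = trans (ℚₚ.*-assoc (recip c) (recip d) (fromℕ d))
      (trans (cong (recip c *_) (recip-*-cancel d)) (ℚₚ.*-identityʳ (recip c)))

  archimedean : ∀ p → ∃ λ n → p < fromℕ n
  archimedean p@(ℚ.mkℚ i d-1 c) = suc ℤ.∣ i ∣ , ℚₚ.≤-<-trans p≤
      (fromℕ-mono-< (ℕₚ.n<1+n ℤ.∣ i ∣))
    where
    open ℚᵘₚ.≤-Reasoning
    i≤∣i∣ : ∀ i → i ℤ.≤ + ℤ.∣ i ∣
    i≤∣i∣ (+ n)       = ℤₚ.≤-refl
    i≤∣i∣ ℤ.-[1+ n ]  = ℤ.-≤+
    p≤ : p ≤ fromℕ ℤ.∣ i ∣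
    p≤ = ℚₚ.toℚᵘ-cancel-≤ (begin
      ℚᵘ.mkℚᵘ i d-1            ≤⟨ ℚᵘ.*≤* (ℤₚ.≤-trans (ℤₚ.≤-reflexive (ℤₚ.*-identityʳ i))
                                    (ℤₚ.≤-trans (i≤∣i∣ i) (ℤₚ.≤-trans (ℤ.+≤+ (ℕₚ.m≤m*n ℤ.∣ i ∣ (suc d-1)))
                                       (ℤₚ.≤-reflexive (ℤₚ.pos-* ℤ.∣ i ∣ (suc d-1)))))) ⟩
      ℚᵘ.mkℚᵘ (+ ℤ.∣ i ∣) 0    ≃⟨ toℚᵘ-/ (+ ℤ.∣ i ∣) 1 ⟨
      ℚ.toℚᵘ (fromℕ ℤ.∣ i ∣)   ∎)

  archimedean⁻¹ : ∀ ε → 0ℚ < ε → ∃ λ n → 1ℚ ≤ fromℕ n * ε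
  archimedean⁻¹ ε 0<ε = n , subst (_≤ fromℕ n * ε) (ℚₚ.*-inverseˡ ε {{nz}})
      (ℚₚ.*-monoʳ-≤-nonNeg ε {{ℚ.nonNegative (ℚₚ.<⇒≤ 0<ε)}} (ℚₚ.<⇒≤ h))
    where
    nz : ℚ.NonZero ε
    nz = ℚ.>-nonZero 0<ε
    n = archimedean ((ℚ.1/ ε) {{nz}}) .proj₁
    h = archimedean ((ℚ.1/ ε) {{nz}}) .proj₂

open RationalLemmas

module SumsAndLimits where
  open import Data.Rational.Base using (_+_; _*_; _-_; -_; _≤_; _<_)

  ∑-cong : ∀ n {f g : ℕ → ℚ} → (∀ i → f i ≡ g i) → ∑ n f ≡ ∑ n g
  ∑-cong zero    f≡g = refl
  ∑-cong (suc n) f≡g = cong₂ _+_ (∑-cong n f≡g) (f≡g n)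

  ∑-mono-≤ : ∀ n {f g : ℕ → ℚ} → (∀ i → i ℕ.< n → f i ≤ g i) → ∑ n f ≤ ∑ n g
  ∑-mono-≤ zero    f≤g = ℚₚ.≤-refl
  ∑-mono-≤ (suc n) f≤g =
    ℚₚ.+-mono-≤ (∑-mono-≤ n λ i i<n → f≤g i (ℕₚ.m<n⇒m<1+n i<n)) (f≤g n ℕₚ.≤-refl)

  ∑-split : ∀ m n (f : ℕ → ℚ) → ∑ (m ℕ.+ n) f ≡ ∑ m f + ∑ n (λ i → f (m ℕ.+ i))
  ∑-split m zero f =
    trans (cong (λ k → ∑ k f) (ℕₚ.+-identityʳ m)) (sym (ℚₚ.+-identityʳ (∑ m f)))
  ∑-split m (suc n) f = begin
    ∑ (m ℕ.+ suc n) f                                          ≡⟨ cong (λ k → ∑ k f) (ℕₚ.+-suc m n) ⟩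
    ∑ (m ℕ.+ n) f + f (m ℕ.+ n)                                ≡⟨ cong (_+ f (m ℕ.+ n)) (∑-split m n f) ⟩
    ∑ m f + ∑ n (λ i → f (m ℕ.+ i)) + f (m ℕ.+ n)              ≡⟨ ℚₚ.+-assoc (∑ m f) _ _ ⟩
    ∑ m f + ∑ (suc n) (λ i → f (m ℕ.+ i))                      ∎
    where open ≡-Reasoning

  ∑-distrib-+ : ∀ n (f g : ℕ → ℚ) → ∑ n (λ i → f i + g i) ≡ ∑ n f + ∑ n g
  ∑-distrib-+ zero    f g = refl
  ∑-distrib-+ (suc n) f g =
    trans (cong (_+ (f n + g n)) (∑-distrib-+ n f g)) (eq (∑ n f) (∑ n g) (f n) (g n))
    where
    eq : ∀ a b c d → a + b + (c + d) ≡ a + c + (b + d)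
    eq = solve-∀ ℚ-ring

  ∑-distrib-minus : ∀ n (f g : ℕ → ℚ) → ∑ n (λ i → f i - g i) ≡ ∑ n f - ∑ n g
  ∑-distrib-minus zero    f g = refl
  ∑-distrib-minus (suc n) f g =
    trans (cong (_+ (f n - g n)) (∑-distrib-minus n f g)) (eq (∑ n f) (∑ n g) (f n) (g n))
    where
    eq : ∀ a b c d → a - b + (c - d) ≡ a + c - (b + d)
    eq = solve-∀ ℚ-ring

  ∑-*ˡ : ∀ n c (f : ℕ → ℚ) → ∑ n (λ i → c * f i) ≡ c * ∑ n f
  ∑-*ˡ zero    c f = sym (ℚₚ.*-zeroʳ c)
  ∑-*ˡ (suc n) c f =
    trans (cong (_+ c * f n) (∑-*ˡ n c f)) (sym (ℚₚ.*-distribˡ-+ c (∑ n f) (f n)))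

  ∑-const : ∀ n c → ∑ n (λ _ → c) ≡ fromℕ n * c
  ∑-const zero    c = sym (ℚₚ.*-zeroˡ c)
  ∑-const (suc n) c = begin
    ∑ n (λ _ → c) + c      ≡⟨ cong (_+ c) (∑-const n c) ⟩
    fromℕ n * c + c        ≡⟨ eq (fromℕ n) c ⟩
    (fromℕ n + 1ℚ) * c     ≡⟨ cong (_* c) (fromℕ-suc n) ⟨
    fromℕ (suc n) * c      ∎
    where
    open ≡-Reasoning
    eq : ∀ a c → a * c + c ≡ (a + 1ℚ) * c
    eq = solve-∀ ℚ-ring

  ∑-nonNeg : ∀ n {f : ℕ → ℚ} → (∀ i → 0ℚ ≤ f i) → 0ℚ ≤ ∑ n f
  ∑-nonNeg zero    0≤f = ℚₚ.≤-refl
  ∑-nonNeg (suc n) 0≤f = +-nonNeg (∑-nonNeg n 0≤f) (0≤f n)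

  ∑-mono-length : ∀ {m n} {f : ℕ → ℚ} → (∀ i → 0ℚ ≤ f i) → m ℕ.≤ n → ∑ m f ≤ ∑ n f
  ∑-mono-length {m} {n} {f} 0≤f m≤n = p≡q+r⇒q≤p
    (trans (cong (λ k → ∑ k f) (sym (ℕₚ.m+[n∸m]≡n m≤n))) (∑-split m (n ℕ.∸ m) f))
    (∑-nonNeg (n ℕ.∸ m) λ i → 0≤f (m ℕ.+ i))

  Eventually : (ℕ → Set) → Set
  Eventually P = ∃ λ K → ∀ n → K ℕ.≤ n → P n

  Eventually-∩ : ∀ {P Q : ℕ → Set} → Eventually P → Eventually Q → Eventually (λ n → P n × Q n)
  Eventually-∩ (K , p) (L , q) = K ℕ.⊔ L , λ n K⊔L≤n →
    p n (ℕₚ.m⊔n≤o⇒m≤o K L K⊔L≤n) , q n (ℕₚ.m⊔n≤o⇒n≤o K L K⊔L≤n)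

  Eventually-map : ∀ {P Q : ℕ → Set} → (∀ n → P n → Q n) → Eventually P → Eventually Q
  Eventually-map f (K , p) = K , λ n K≤n → f n (p n K≤n)

  Eventually-∃ : ∀ {P : ℕ → Set} → Eventually P → ∃ P
  Eventually-∃ (K , p) = K , p K ℕₚ.≤-refl

  half-pos : ∀ {ε} → 0ℚ < ε → 0ℚ < ½ * ε
  half-pos = *-pos (ℚₚ.positive⁻¹ ½)

  half+half : ∀ ε → ½ * ε + ½ * ε ≡ ε
  half+half ε = trans (sym (ℚₚ.*-distribʳ-+ ε ½ ½)) (ℚₚ.*-identityˡ ε)

  ⟶-fromℚ⁺ : ∀ u c →
    (∀ ε → 0ℚ < ε → Eventually λ n → (u n - c ≤ ½ * ε) × (c - u n ≤ ½ * ε)) → u ⟶ fromℚ c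
  ⟶-fromℚ⁺ u c h ε 0<ε = Eventually-map
    (λ n (h₁ , h₂) → (½ * ε , half-pos 0<ε , 0 , λ _ _ → add h₁) , (½ * ε , half-pos 0<ε , 0 , λ _ _ → add h₂))
    (h ε 0<ε)
    where
    add : ∀ {p} → p ≤ ½ * ε → p + ½ * ε ≤ ε
    add {p} p≤ = subst (p + ½ * ε ≤_) (half+half ε) (ℚₚ.+-monoˡ-≤ (½ * ε) p≤)

  ⟶-fromℚ⁻ : ∀ u c → u ⟶ fromℚ c →
    ∀ ε → 0ℚ < ε → Eventually λ n → (u n - c ≤ ε) × (c - u n ≤ ε)
  ⟶-fromℚ⁻ u c u⟶c ε 0<ε = Eventually-map
    (λ n (h₁ , h₂) → drop h₁ , drop h₂) (u⟶c ε 0<ε)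
    where
    drop : ∀ {p} → (∃ λ δ → 0ℚ < δ × ∃ λ K → ∀ n → K ℕ.≤ n → p + δ ≤ ε) → p ≤ ε
    drop {p} (δ , 0<δ , K , h) = ℚₚ.≤-trans (p≡q+r⇒q≤p refl (ℚₚ.<⇒≤ 0<δ)) (h K ℕₚ.≤-refl)

  /₀-*-cancel : ∀ p {q} → 0ℚ < q → (p /₀ q) * q ≡ p
  /₀-*-cancel p {q} 0<q with q ℚₚ.≟ 0ℚ
  ... | yes q≡0 = contradiction (sym q≡0) (ℚₚ.<⇒≢ 0<q)
  ... | no  q≢0 = trans (ℚₚ.*-assoc p _ q)
    (trans (cong (p *_) (ℚₚ.*-inverseˡ q {{ℚ.≢-nonZero q≢0}})) (ℚₚ.*-identityʳ p))

  -- f ≲ g: lim sup f / g ≤ 1, without division.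
  infix 4 _≲_
  _≲_ : (ℕ → ℚ) → (ℕ → ℚ) → Set
  f ≲ g = ∀ m → Eventually λ n → fromℕ m * f n ≤ fromℕ (suc m) * g n

  ≲-trans : ∀ {f g h} → (∀ n → 0ℚ ≤ h n) → f ≲ g → g ≲ h → f ≲ h
  ≲-trans {f} {g} {h} 0≤h f≲g g≲h m = Eventually-map step (Eventually-∩ (f≲g k) (g≲h k))
    where
    k = suc (m ℕ.+ m)
    M = fromℕ m
    K = fromℕ k
    eqK : K ≡ M + M + 1ℚ
    eqK = trans (fromℕ-suc (m ℕ.+ m)) (cong (_+ 1ℚ) (fromℕ-+ m m))
    eqS : fromℕ (suc k) ≡ M + M + 1ℚ + 1ℚ
    eqS = trans (fromℕ-suc k) (cong (_+ 1ℚ) eqK)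
    cert : ∀ M F G H → (M + M + 1ℚ) * (M + M + 1ℚ) * ((M + 1ℚ) * H) ≡
      (M + M + 1ℚ) * (M + M + 1ℚ) * (M * F) +
      ((M + 1ℚ) * H
        + M * ((M + M + 1ℚ) * ((M + M + 1ℚ + 1ℚ) * G - (M + M + 1ℚ) * F)
        + (M + M + 1ℚ + 1ℚ) * ((M + M + 1ℚ + 1ℚ) * H - (M + M + 1ℚ) * G)))
    cert = solve-∀ ℚ-ring
    0≤K : 0ℚ ≤ M + M + 1ℚ
    0≤K = subst (0ℚ ≤_) eqK (fromℕ-nonNeg k)
    0<K : 0ℚ < M + M + 1ℚ
    0<K = subst (0ℚ <_) eqK (fromℕ-pos (m ℕ.+ m))
    0≤S : 0ℚ ≤ M + M + 1ℚ + 1ℚ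
    0≤S = +-nonNeg 0≤K 0≤1
    step : ∀ n → (K * f n ≤ fromℕ (suc k) * g n) × (K * g n ≤ fromℕ (suc k) * h n) →
      M * f n ≤ fromℕ (suc m) * h n
    step n (a , b) = subst (λ c → M * f n ≤ c * h n) (sym (fromℕ-suc m))
      (*-cancelˡ-≤ _ (*-pos 0<K 0<K) (p≡q+r⇒q≤p (cert M (f n) (g n) (h n))
        (+-nonNeg (*-nonNeg (+-nonNeg (fromℕ-nonNeg m) 0≤1) (0≤h n))
          (*-nonNeg (fromℕ-nonNeg m) (+-nonNeg
            (*-nonNeg 0≤K (p≤q⇒0≤q-p (subst₂ (λ x y → x * f n ≤ y * g n) eqK eqS a)))
            (*-nonNeg 0≤S (p≤q⇒0≤q-p (subst₂ (λ x y → x * g n ≤ y * h n) eqK eqS b))))))))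

  ⟶1⇒≲ : ∀ {f g} → Eventually (λ n → 0ℚ < g n) →
    (λ n → f n /₀ g n) ⟶ fromℚ 1ℚ → (f ≲ g) × (g ≲ f)
  ⟶1⇒≲ {f} {g} 0<g lim =
    (λ m → Eventually-map (upper m) (near m)) , (λ m → Eventually-map (lower m) (near m))
    where
    Near : ℕ → ℕ → Set
    Near m n = 0ℚ < g n × (f n /₀ g n - 1ℚ ≤ recip (suc m)) × (1ℚ - f n /₀ g n ≤ recip (suc m))
    near : ∀ m → Eventually (Near m)
    near m = Eventually-∩ 0<g (⟶-fromℚ⁻ (λ n → f n /₀ g n) 1ℚ lim (recip (suc m)) (recip-pos (suc m)))
    inverse : ∀ m → recip (suc m) * (fromℕ m + 1ℚ) ≡ 1ℚ
    inverse m = trans (cong (recip (suc m) *_) (sym (fromℕ-suc m))) (recip-*-cancel (suc m))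
    cert₁ : ∀ M e r G → (M + 1ℚ) * G + (e * (M + 1ℚ) - 1ℚ) * G ≡
      M * (r * G) + (G * (M * (e - (r - 1ℚ))) + e * G)
    cert₁ = solve-∀ ℚ-ring
    cert₂ : ∀ M e r G → (M + 1ℚ) * (r * G) + (e * (M + 1ℚ) - 1ℚ) * G ≡
      M * G + G * ((M + 1ℚ) * (e - (1ℚ - r)))
    cert₂ = solve-∀ ℚ-ring
    cancel : ∀ m p G → p + (recip (suc m) * (fromℕ m + 1ℚ) - 1ℚ) * G ≡ p
    cancel m p G = begin
      p + (recip (suc m) * (fromℕ m + 1ℚ) - 1ℚ) * G ≡⟨ cong (λ c → p + (c - 1ℚ) * G) (inverse m) ⟩
      p + (1ℚ - 1ℚ) * G                             ≡⟨ eq p G ⟩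
      p                                             ∎
      where
      open ≡-Reasoning
      eq : ∀ p G → p + (1ℚ - 1ℚ) * G ≡ p
      eq = solve-∀ ℚ-ring
    upper : ∀ m n → Near m n → fromℕ m * f n ≤ fromℕ (suc m) * g n
    upper m n (0<gn , h₁ , h₂) = subst₂ (λ a b → M * a ≤ b * g n)
      (/₀-*-cancel (f n) 0<gn) (sym (fromℕ-suc m))
      (p≡q+r⇒q≤p (trans (sym (cancel m _ (g n))) (cert₁ M e r (g n)))
        (+-nonNeg (*-nonNeg 0≤gn (*-nonNeg (fromℕ-nonNeg m) (p≤q⇒0≤q-p h₁)))
          (*-nonNeg (recip-nonNeg (suc m)) 0≤gn)))
      where
      M = fromℕ m
      e = recip (suc m)
      r = f n /₀ g n
      0≤gn = ℚₚ.<⇒≤ 0<gn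
    lower : ∀ m n → Near m n → fromℕ m * g n ≤ fromℕ (suc m) * f n
    lower m n (0<gn , h₁ , h₂) = subst₂ (λ a b → M * g n ≤ b * a)
      (/₀-*-cancel (f n) 0<gn) (sym (fromℕ-suc m))
      (p≡q+r⇒q≤p (trans (sym (cancel m _ (g n))) (cert₂ M e r (g n)))
        (*-nonNeg (ℚₚ.<⇒≤ 0<gn) (*-nonNeg (+-nonNeg (fromℕ-nonNeg m) 0≤1) (p≤q⇒0≤q-p h₂))))
      where
      M = fromℕ m
      e = recip (suc m)
      r = f n /₀ g n

  ≲⇒⟶1 : ∀ {f g} → Eventually (λ n → 0ℚ < g n) → f ≲ g → g ≲ f →
    (λ n → f n /₀ g n) ⟶ fromℚ 1ℚ
  ≲⇒⟶1 {f} {g} 0<g f≲g g≲f = ⟶-fromℚ⁺ (λ n → f n /₀ g n) 1ℚ λ ε 0<ε → Eventually-map (step ε 0<ε)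
      (Eventually-∩ 0<g (Eventually-∩ (f≲g 1) (Eventually-∩
        (f≲g (4 ℕ.* archimedean⁻¹ ε 0<ε .proj₁)) (g≲f (4 ℕ.* archimedean⁻¹ ε 0<ε .proj₁)))))
    where
    four = 1ℚ + 1ℚ + 1ℚ + 1ℚ
    cert₁ : ∀ k ε r G → four * k * G * ½ * ε ≡ four * k * G * (r - 1ℚ)
      + (((four * k + 1ℚ) * G - four * k * (r * G)) + G * (½ * four * (k * ε - 1ℚ) + 1ℚ))
    cert₁ = solve-∀ ℚ-ring
    cert₂ : ∀ k ε r G → four * k * G * ½ * ε ≡ four * k * G * (1ℚ - r)
      + (((four * k + 1ℚ) * (r * G) - four * k * G) + (½ * four * G * (k * ε - 1ℚ) + ((1ℚ + 1ℚ) * G - 1ℚ * (r * G))))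
    cert₂ = solve-∀ ℚ-ring
    step : ∀ ε (0<ε : 0ℚ < ε) → let k = archimedean⁻¹ ε 0<ε .proj₁ in ∀ n →
      0ℚ < g n × (fromℕ 1 * f n ≤ fromℕ 2 * g n)
        × (fromℕ (4 ℕ.* k) * f n ≤ fromℕ (suc (4 ℕ.* k)) * g n)
        × (fromℕ (4 ℕ.* k) * g n ≤ fromℕ (suc (4 ℕ.* k)) * f n) →
      (f n /₀ g n - 1ℚ ≤ ½ * ε) × (1ℚ - f n /₀ g n ≤ ½ * ε)
    step ε 0<ε n (0<gn , h₀ , h₁ , h₂) =
        scaled (r - 1ℚ) (cert₁ k ε r G) (+-nonNeg (p≤q⇒0≤q-p (subst₂ _≤_ (cong₂ _*_ e4 (sym fr)) (cong (_* G) e4s) h₁))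
          (*-nonNeg 0≤gn (+-nonNeg (*-nonNeg (ℚₚ.nonNegative⁻¹ (½ * four)) (p≤q⇒0≤q-p 1≤kε)) 0≤1)))
      , scaled (1ℚ - r) (cert₂ k ε r G) (+-nonNeg (p≤q⇒0≤q-p (subst₂ _≤_ (cong (_* G) e4) (cong₂ _*_ e4s (sym fr)) h₂))
          (+-nonNeg (*-nonNeg (*-nonNeg (ℚₚ.nonNegative⁻¹ (½ * four)) 0≤gn) (p≤q⇒0≤q-p 1≤kε))
            (p≤q⇒0≤q-p (subst (λ x → 1ℚ * x ≤ (1ℚ + 1ℚ) * G) (sym fr) h₀))))
      where
      open ≡-Reasoning
      k' = archimedean⁻¹ ε 0<ε .proj₁
      k = fromℕ k'
      1≤kε = archimedean⁻¹ ε 0<ε .proj₂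
      G = g n
      r = f n /₀ g n
      0≤gn = ℚₚ.<⇒≤ 0<gn
      fr : r * G ≡ f n
      fr = /₀-*-cancel (f n) 0<gn
      e4 : fromℕ (4 ℕ.* k') ≡ four * k
      e4 = fromℕ-* 4 k'
      e4s : fromℕ (suc (4 ℕ.* k')) ≡ four * k + 1ℚ
      e4s = trans (fromℕ-suc (4 ℕ.* k')) (cong (_+ 1ℚ) e4)
      k≢0 : k' ≢ 0
      k≢0 eq = ℚₚ.<-irrefl refl (ℚₚ.<-≤-trans 0<1
        (subst (1ℚ ≤_) (trans (cong (λ j → fromℕ j * ε) eq) (ℚₚ.*-zeroˡ ε)) 1≤kε))
      0<k : 0ℚ < k
      0<k = fromℕ-nonZero⇒pos k' {{ℕ.≢-nonZero k≢0}}
      scaled : ∀ p {z} → four * k * G * ½ * ε ≡ four * k * G * p + z → 0ℚ ≤ z → p ≤ ½ * ε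
      scaled p eq 0≤z = *-cancelˡ-≤ (four * k * G) (*-pos (*-pos (ℚₚ.positive⁻¹ four) 0<k) 0<gn)
        (subst (four * k * G * p ≤_) (ℚₚ.*-assoc (four * k * G) ½ ε) (p≡q+r⇒q≤p eq 0≤z))

  Negligible : (ℕ → ℚ) → (ℕ → ℚ) → Set
  Negligible d h = ∀ m → ∃ λ C → Eventually λ n → fromℕ m * d n ≤ fromℕ 3 * h n + C

  negligible⇒≲ : ∀ {f g} → g ⟶∞ → Negligible (λ n → f n - g n) g → f ≲ g
  negligible⇒≲ {f} {g} g⟶∞ negl m with negl (4 ℕ.* m)
  ... | C , ev = Eventually-map step (Eventually-∩ ev (g⟶∞ C))
    where
    four = 1ℚ + 1ℚ + 1ℚ + 1ℚ
    three = 1ℚ + 1ℚ + 1ℚ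
    cert : ∀ M F G C → four * ((M + 1ℚ) * G) ≡
      four * (M * F) + (three * G + C - four * M * (F - G) + (G - C))
    cert = solve-∀ ℚ-ring
    step : ∀ n → (fromℕ (4 ℕ.* m) * (f n - g n) ≤ fromℕ 3 * g n + C) × C < g n →
      fromℕ m * f n ≤ fromℕ (suc m) * g n
    step n (h₁ , h₂) = subst (λ c → fromℕ m * f n ≤ c * g n) (sym (fromℕ-suc m))
      (*-cancelˡ-≤ four (ℚₚ.positive⁻¹ four) (p≡q+r⇒q≤p (cert (fromℕ m) (f n) (g n) C)
        (+-nonNeg (p≤q⇒0≤q-p (subst (λ c → c * (f n - g n) ≤ fromℕ 3 * g n + C) (fromℕ-* 4 m) h₁))
          (p≤q⇒0≤q-p (ℚₚ.<⇒≤ h₂)))))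

  negligible⇒≳ : ∀ {f g} → g ⟶∞ → Negligible (λ n → g n - f n) g → g ≲ f
  negligible⇒≳ {f} {g} g⟶∞ negl m with negl (4 ℕ.* suc m)
  ... | C , ev = Eventually-map step (Eventually-∩ ev (g⟶∞ C))
    where
    four = 1ℚ + 1ℚ + 1ℚ + 1ℚ
    three = 1ℚ + 1ℚ + 1ℚ
    cert : ∀ M F G C → four * ((M + 1ℚ) * F) ≡
      four * (M * G) + (three * G + C - four * (M + 1ℚ) * (G - F) + (G - C))
    cert = solve-∀ ℚ-ring
    step : ∀ n → (fromℕ (4 ℕ.* suc m) * (g n - f n) ≤ fromℕ 3 * g n + C) × C < g n →
      fromℕ m * g n ≤ fromℕ (suc m) * f n
    step n (h₁ , h₂) = subst (λ c → fromℕ m * g n ≤ c * f n) (sym (fromℕ-suc m))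
      (*-cancelˡ-≤ four (ℚₚ.positive⁻¹ four) (p≡q+r⇒q≤p (cert (fromℕ m) (f n) (g n) C)
        (+-nonNeg (p≤q⇒0≤q-p (subst (λ c → c * (g n - f n) ≤ fromℕ 3 * g n + C)
            (trans (fromℕ-* 4 (suc m)) (cong (four *_) (fromℕ-suc m))) h₁))
          (p≤q⇒0≤q-p (ℚₚ.<⇒≤ h₂)))))

  ⟶∞⇒pos : ∀ {g} → g ⟶∞ → Eventually λ n → 0ℚ < g n
  ⟶∞⇒pos g⟶∞ = g⟶∞ 0ℚ

open SumsAndLimits

module CantorSeries where
  open import Data.Rational.Base using (_+_; _*_; _-_; -_; _≤_; _<_)

  q-nonZero : ∀ Q n → ℕ.NonZero (q Q n)
  q-nonZero Q n = ℕ.>-nonZero (ℕₚ.≤-trans (ℕₚ.n≤1+n 1) (q≥2 Q n))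

  1/q : BasicSequence → ℕ → ℚ
  1/q Q n = recip (q Q n) {{q-nonZero Q n}}

  1/∏ : BasicSequence → ℕ → ℕ → ℚ
  1/∏ Q j k = recip (∏ Q j k) {{∏-nonZero {Q} {j} {k}}}

  1/∏-pos : ∀ Q j k → 0ℚ < 1/∏ Q j k
  1/∏-pos Q j k = recip-pos (∏ Q j k) {{∏-nonZero {Q} {j} {k}}}

  1/∏-suc : ∀ Q j k → 1/∏ Q j (suc k) ≡ 1/∏ Q j k * 1/q Q (j ℕ.+ k)
  1/∏-suc Q j k = recip-* (∏ Q j k) (q Q (j ℕ.+ k))
    {{∏-nonZero {Q} {j} {k}}} {{q-nonZero Q (j ℕ.+ k)}} {{∏-nonZero {Q} {j} {suc k}}}

  1/q-cancel : ∀ Q n → 1/q Q n * fromℕ (q Q n) ≡ 1ℚ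
  1/q-cancel Q n = recip-*-cancel (q Q n) {{q-nonZero Q n}}

  n<∏ : ∀ Q n → n ℕ.< ∏ Q 0 n
  n<∏ Q zero    = s≤s z≤n
  n<∏ Q (suc n) = begin
    2 ℕ.+ n                  ≤⟨ ℕₚ.+-monoʳ-≤ 2 (ℕₚ.m≤n*m n 2) ⟩
    2 ℕ.+ 2 ℕ.* n            ≡⟨ ℕₚ.*-suc 2 n ⟨
    2 ℕ.* suc n              ≡⟨ ℕₚ.*-comm 2 (suc n) ⟩
    suc n ℕ.* 2              ≤⟨ ℕₚ.*-mono-≤ (n<∏ Q n) (q≥2 Q n) ⟩
    ∏ Q 0 n ℕ.* q Q n        ∎
    where open ℕₚ.≤-Reasoning

  1/∏-small : ∀ Q ε → 0ℚ < ε → ∃ λ k → 1/∏ Q 0 k < ε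
  1/∏-small Q ε 0<ε = k , ℚₚ.≤-<-trans
      (recip-anti {{_}} {{∏-nonZero {Q} {0} {k}}} (n<∏ Q k)) 1/k<ε
    where
    open ≡-Reasoning
    k = archimedean⁻¹ ε 0<ε .proj₁
    c = fromℕ (suc k)
    h : 1ℚ < c * ε
    h = ℚₚ.≤-<-trans (archimedean⁻¹ ε 0<ε .proj₂) (subst (_< c * ε) (ℚₚ.*-comm ε (fromℕ k))
      (subst (ε * fromℕ k <_) (ℚₚ.*-comm ε c) (*-monoˡ-< ε 0<ε (fromℕ-mono-< (ℕₚ.n<1+n k)))))
    1/k<ε : recip (suc k) < ε
    1/k<ε = subst₂ _<_ (ℚₚ.*-identityʳ (recip (suc k)))
      (trans (sym (ℚₚ.*-assoc (recip (suc k)) c ε))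
        (trans (cong (_* ε) (recip-*-cancel (suc k))) (ℚₚ.*-identityˡ ε)))
      (*-monoˡ-< (recip (suc k)) (recip-pos (suc k)) h)

  partialSum : BasicSequence → (ℕ → ℕ) → ℕ → ℚ
  partialSum Q E n = ∑ n λ i → (+ E i ℚ./ ∏ Q 0 (suc i)) {{∏-nonZero {Q} {0} {suc i}}}

  digitTerm : ∀ Q (E : ℕ → ℕ) i →
    (+ E i ℚ./ ∏ Q 0 (suc i)) {{∏-nonZero {Q} {0} {suc i}}} ≡ fromℕ (E i) * 1/∏ Q 0 (suc i)
  digitTerm Q E i = /-recip (E i) (∏ Q 0 (suc i)) {{∏-nonZero {Q} {0} {suc i}}}

  upperSum : BasicSequence → (ℕ → ℕ) → ℕ → ℚ
  upperSum Q E n = partialSum Q E n + 1/∏ Q 0 n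

  NonTrivial : BasicSequence → (ℕ → ℕ) → Set
  NonTrivial Q E = ∀ m → ∃ λ n → m ℕ.≤ n × suc (E n) ≢ q Q n

  -- The value lies in the nested intervals [partialSum n , upperSum n].
  module Digits (Q : BasicSequence) (E : ℕ → ℕ) (E<q : ∀ n → E n ℕ.< q Q n) where

    partialSum-suc : ∀ n → partialSum Q E (suc n) ≡ partialSum Q E n + fromℕ (E n) * 1/∏ Q 0 (suc n)
    partialSum-suc n = cong (λ t → partialSum Q E n + t) (digitTerm Q E n)

    partialSum-mono : ∀ {m n} → m ℕ.≤ n → partialSum Q E m ≤ partialSum Q E n
    partialSum-mono = ∑-mono-length λ i → subst (0ℚ ≤_) (sym (digitTerm Q E i))
      (*-nonNeg (fromℕ-nonNeg (E i)) (ℚₚ.<⇒≤ (1/∏-pos Q 0 (suc i))))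

    upperSum-step : ∀ n j → j ℕ.+ suc (E n) ℕ.≤ q Q n →
      upperSum Q E (suc n) + fromℕ j * 1/∏ Q 0 (suc n) ≤ upperSum Q E n
    upperSum-step n j h = subst₂ _≤_
      (cong (λ s → s + e + fromℕ j * e) (sym (partialSum-suc n)))
      (cong (λ t → partialSum Q E n + t) scaled)
      (p≡q+r⇒q≤p (cert (partialSum Q E n) (fromℕ (E n)) (fromℕ j) (fromℕ (q Q n)) e)
        (*-nonNeg (ℚₚ.<⇒≤ (1/∏-pos Q 0 (suc n))) (p≤q⇒0≤q-p
          (subst (_≤ fromℕ (q Q n)) (trans (fromℕ-+ j (suc (E n))) (cong (_+_ (fromℕ j)) (fromℕ-suc (E n)))) (fromℕ-mono-≤ h)))))
      where
      e = 1/∏ Q 0 (suc n)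
      scaled : e * fromℕ (q Q n) ≡ 1/∏ Q 0 n
      scaled = trans (cong (_* fromℕ (q Q n)) (1/∏-suc Q 0 n))
        (trans (ℚₚ.*-assoc (1/∏ Q 0 n) (1/q Q n) (fromℕ (q Q n)))
          (trans (cong (1/∏ Q 0 n *_) (1/q-cancel Q n)) (ℚₚ.*-identityʳ (1/∏ Q 0 n))))
      cert : ∀ s d j q e → s + e * q ≡ s + d * e + e + j * e + e * (q - (j + (d + 1ℚ)))
      cert = solve-∀ ℚ-ring

    upperSum-anti : ∀ {m n} → m ℕ.≤ n → upperSum Q E n ≤ upperSum Q E m
    upperSum-anti {m} m≤n = go (ℕₚ.≤⇒≤′ m≤n)
      where
      step : ∀ n → upperSum Q E (suc n) ≤ upperSum Q E n
      step n = subst (_≤ upperSum Q E n)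
        (trans (cong (λ t → upperSum Q E (suc n) + t) (ℚₚ.*-zeroˡ (1/∏ Q 0 (suc n)))) (ℚₚ.+-identityʳ _))
        (upperSum-step n 0 (E<q n))
      go : ∀ {n} → m ℕ.≤′ n → upperSum Q E n ≤ upperSum Q E m
      go ℕ.≤′-refl           = ℚₚ.≤-refl
      go (ℕ.≤′-step {n} m≤n) = ℚₚ.≤-trans (step n) (go m≤n)

    upperSum-drop : ∀ n → suc (E n) ≢ q Q n → upperSum Q E (suc n) + 1/∏ Q 0 (suc n) ≤ upperSum Q E n
    upperSum-drop n h = subst (λ t → upperSum Q E (suc n) + t ≤ upperSum Q E n)
      (ℚₚ.*-identityˡ (1/∏ Q 0 (suc n)))
      (upperSum-step n 1 (ℕₚ.≤∧≢⇒< (E<q n) h))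

    partialSum≤upperSum : ∀ n → partialSum Q E n ≤ upperSum Q E n
    partialSum≤upperSum n = p≡q+r⇒q≤p refl (ℚₚ.<⇒≤ (1/∏-pos Q 0 n))

    partialSum-gap : ∀ k {m n} → k ℕ.≤ m → k ℕ.≤ n →
      partialSum Q E m - partialSum Q E n ≤ 1/∏ Q 0 k
    partialSum-gap k {m} {n} k≤m k≤n = p≡q+r⇒q≤p
      (cert (partialSum Q E k) (partialSum Q E m) (partialSum Q E n) (1/∏ Q 0 k))
      (+-nonNeg (p≤q⇒0≤q-p (ℚₚ.≤-trans (partialSum≤upperSum m) (upperSum-anti k≤m)))
        (p≤q⇒0≤q-p (partialSum-mono k≤n)))
      where
      cert : ∀ a b c e → e ≡ b - c + (a + e - b + (c - a))
      cert = solve-∀ ℚ-ring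

    value : ℝ
    seq    value = partialSum Q E
    cauchy value ε 0<ε = k , λ m n k≤m k≤n → ℚₚ.≤-<-trans
        (∣p∣≤ (partialSum-gap k k≤m k≤n)
          (subst (_≤ 1/∏ Q 0 k) (flip- (partialSum Q E n) (partialSum Q E m)) (partialSum-gap k k≤n k≤m)))
        small
      where
      k = 1/∏-small Q ε 0<ε .proj₁
      small = 1/∏-small Q ε 0<ε .proj₂
      flip- : ∀ a b → a - b ≡ - (b - a)
      flip- = solve-∀ ℚ-ring

    value-expansion : NonTrivial Q E → IsExpansion Q value (+ 0) E
    value-expansion nontriv = record
      { floor      = 0≤value , value<1
      ; digit      = E<q
      ; nontrivial = nontriv
      ; converges  = λ ε 0<ε →
          let (k , small) = 1/∏-small Q (½ * ε) (half-pos 0<ε)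
              close : ∀ {m n} → k ℕ.≤ m → k ℕ.≤ n → partialSum Q E m - partialSum Q E n + ½ * ε ≤ ε
              close {m} {n} k≤m k≤n = subst (partialSum Q E m - partialSum Q E n + ½ * ε ≤_) (half+half ε)
                (ℚₚ.+-monoˡ-≤ (½ * ε) (ℚₚ.≤-trans (partialSum-gap k k≤m k≤n) (ℚₚ.<⇒≤ small)))
          in k , λ n k≤n →
            (½ * ε , half-pos 0<ε , k , λ i k≤i →
              subst (λ t → t - partialSum Q E i + ½ * ε ≤ ε) (sym (ℚₚ.+-identityˡ (partialSum Q E n))) (close k≤n k≤i))
          , (½ * ε , half-pos 0<ε , k , λ i k≤i →
              subst (λ t → partialSum Q E i - t + ½ * ε ≤ ε) (sym (ℚₚ.+-identityˡ (partialSum Q E n))) (close k≤i k≤n))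
      }
      where
      0≤value : fromℚ (fromℤ (+ 0)) ≤ᴿ value
      0≤value (ε , 0<ε , k , h) = ℚₚ.<-irrefl refl
        (ℚₚ.<-≤-trans (ℚₚ.+-mono-≤-< (partialSum-mono {0} {k} z≤n) 0<ε) (h k ℕₚ.≤-refl))
      value<1 : value <ᴿ fromℚ (fromℤ (ℤ.suc (+ 0)))
      value<1 = let (p , _ , E+1≢q) = nontriv 0 in
        1/∏ Q 0 (suc p) , 1/∏-pos Q 0 (suc p) , suc p , λ n p<n → ℚₚ.≤-trans
          (ℚₚ.+-monoˡ-≤ (1/∏ Q 0 (suc p)) (ℚₚ.≤-trans (partialSum≤upperSum n) (upperSum-anti p<n)))
          (ℚₚ.≤-trans (upperSum-drop p E+1≢q) (upperSum-anti {0} {p} z≤n))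

    -- The integer part of q₁ ⋯ qₙ x.
    intPart : ℕ → ℕ
    intPart zero    = 0
    intPart (suc n) = intPart n ℕ.* q Q n ℕ.+ E n

    ∏*1/∏-suc : ∀ n → fromℕ (∏ Q 0 n) * 1/∏ Q 0 (suc n) ≡ 1/q Q n
    ∏*1/∏-suc n = begin
      fromℕ (∏ Q 0 n) * 1/∏ Q 0 (suc n)            ≡⟨ cong (fromℕ (∏ Q 0 n) *_) (1/∏-suc Q 0 n) ⟩
      fromℕ (∏ Q 0 n) * (1/∏ Q 0 n * 1/q Q n)      ≡⟨ eq (fromℕ (∏ Q 0 n)) (1/∏ Q 0 n) (1/q Q n) ⟩
      1/∏ Q 0 n * fromℕ (∏ Q 0 n) * 1/q Q n        ≡⟨ cong (_* 1/q Q n) (recip-*-cancel (∏ Q 0 n) {{∏-nonZero {Q} {0} {n}}}) ⟩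
      1ℚ * 1/q Q n                                 ≡⟨ ℚₚ.*-identityˡ (1/q Q n) ⟩
      1/q Q n                                      ∎
      where
      open ≡-Reasoning
      eq : ∀ a b c → a * (b * c) ≡ b * a * c
      eq = solve-∀ ℚ-ring

    ∏*partialSum-suc : ∀ n → fromℕ (∏ Q 0 n) * partialSum Q E (suc n) ≡
      fromℕ (∏ Q 0 n) * partialSum Q E n + fromℕ (E n) * 1/q Q n
    ∏*partialSum-suc n = begin
      P * partialSum Q E (suc n)                             ≡⟨ cong (P *_) (partialSum-suc n) ⟩
      P * (partialSum Q E n + fromℕ (E n) * 1/∏ Q 0 (suc n)) ≡⟨ eq P (partialSum Q E n) (fromℕ (E n)) (1/∏ Q 0 (suc n)) ⟩
      P * partialSum Q E n + fromℕ (E n) * (P * 1/∏ Q 0 (suc n)) ≡⟨ cong (λ t → P * partialSum Q E n + fromℕ (E n) * t) (∏*1/∏-suc n) ⟩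
      P * partialSum Q E n + fromℕ (E n) * 1/q Q n           ∎
      where
      open ≡-Reasoning
      P = fromℕ (∏ Q 0 n)
      eq : ∀ p s d e → p * (s + d * e) ≡ p * s + d * (p * e)
      eq = solve-∀ ℚ-ring

    ∏*partialSum : ∀ n → fromℕ (∏ Q 0 n) * partialSum Q E n ≡ fromℕ (intPart n)
    ∏*partialSum zero    = refl
    ∏*partialSum (suc n) = begin
      fromℕ (∏ Q 0 n ℕ.* q Q n) * s'                      ≡⟨ cong (_* s') (fromℕ-* (∏ Q 0 n) (q Q n)) ⟩
      P * b * s'                                          ≡⟨ eq₁ P b s' ⟩
      b * (P * s')                                        ≡⟨ cong (b *_) (∏*partialSum-suc n) ⟩
      b * (P * partialSum Q E n + d * 1/q Q n)            ≡⟨ cong (λ t → b * (t + d * 1/q Q n)) (∏*partialSum n) ⟩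
      b * (fromℕ (intPart n) + d * 1/q Q n)               ≡⟨ eq₂ b (fromℕ (intPart n)) d (1/q Q n) ⟩
      fromℕ (intPart n) * b + d * (1/q Q n * b)           ≡⟨ cong (λ t → fromℕ (intPart n) * b + d * t) (1/q-cancel Q n) ⟩
      fromℕ (intPart n) * b + d * 1ℚ                      ≡⟨ cong₂ _+_ (sym (fromℕ-* (intPart n) (q Q n))) (ℚₚ.*-identityʳ d) ⟩
      fromℕ (intPart n ℕ.* q Q n) + d                     ≡⟨ fromℕ-+ (intPart n ℕ.* q Q n) (E n) ⟨
      fromℕ (intPart (suc n))                             ∎
      where
      open ≡-Reasoning
      P = fromℕ (∏ Q 0 n)
      b = fromℕ (q Q n)
      d = fromℕ (E n)
      s' = partialSum Q E (suc n)
      eq₁ : ∀ p b s → p * b * s ≡ b * (p * s)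
      eq₁ = solve-∀ ℚ-ring
      eq₂ : ∀ b z d e → b * (z + d * e) ≡ z * b + d * (e * b)
      eq₂ = solve-∀ ℚ-ring

    shift-lower : ∀ n i → n ℕ.< i →
      fromℕ (intPart n) + fromℕ (E n) * 1/q Q n ≤ fromℕ (∏ Q 0 n) * partialSum Q E i
    shift-lower n i n<i = subst (_≤ fromℕ (∏ Q 0 n) * partialSum Q E i)
      (trans (∏*partialSum-suc n) (cong (_+ fromℕ (E n) * 1/q Q n) (∏*partialSum n)))
      (*-monoˡ-≤ (fromℕ (∏ Q 0 n)) (fromℕ-nonNeg (∏ Q 0 n)) (partialSum-mono n<i))

    shift-upper : ∀ n i → n ℕ.< i →
      fromℕ (∏ Q 0 n) * partialSum Q E i ≤ fromℕ (intPart n) + fromℕ (suc (E n)) * 1/q Q n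
    shift-upper n i n<i = subst (fromℕ (∏ Q 0 n) * partialSum Q E i ≤_) e
      (*-monoˡ-≤ (fromℕ (∏ Q 0 n)) (fromℕ-nonNeg (∏ Q 0 n))
        (ℚₚ.≤-trans (partialSum≤upperSum i) (upperSum-anti n<i)))
      where
      open ≡-Reasoning
      P = fromℕ (∏ Q 0 n)
      eq : ∀ z d e → z + d * e + e ≡ z + (d + 1ℚ) * e
      eq = solve-∀ ℚ-ring
      e : P * (partialSum Q E (suc n) + 1/∏ Q 0 (suc n)) ≡ fromℕ (intPart n) + fromℕ (suc (E n)) * 1/q Q n
      e = begin
        P * (partialSum Q E (suc n) + 1/∏ Q 0 (suc n))        ≡⟨ ℚₚ.*-distribˡ-+ P _ _ ⟩
        P * partialSum Q E (suc n) + P * 1/∏ Q 0 (suc n)      ≡⟨ cong₂ _+_ (∏*partialSum-suc n) (∏*1/∏-suc n) ⟩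
        P * partialSum Q E n + fromℕ (E n) * 1/q Q n + 1/q Q n ≡⟨ cong (λ t → t + fromℕ (E n) * 1/q Q n + 1/q Q n) (∏*partialSum n) ⟩
        fromℕ (intPart n) + fromℕ (E n) * 1/q Q n + 1/q Q n   ≡⟨ eq (fromℕ (intPart n)) (fromℕ (E n)) (1/q Q n) ⟩
        fromℕ (intPart n) + (fromℕ (E n) + 1ℚ) * 1/q Q n      ≡⟨ cong (λ t → fromℕ (intPart n) + t * 1/q Q n) (fromℕ-suc (E n)) ⟨
        fromℕ (intPart n) + fromℕ (suc (E n)) * 1/q Q n       ∎

  floor-≤ : ∀ x m m′ → IsFloor x m → IsFloor x m′ → m′ ℤ.≤ m
  floor-≤ x m m′ (_ , ε , 0<ε , k , x<m+1) (m′≤x , _) = ℤₚ.≮⇒≥ λ m<m′ →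
    m′≤x (ε , 0<ε , k , λ n k≤n → ℚₚ.≤-trans (x<m+1 n k≤n) (fromℤ-mono-≤ (ℤₚ.i<j⇒suc[i]≤j m<m′)))

  floor-unique : ∀ x m m′ → IsFloor x m → IsFloor x m′ → m ≡ m′
  floor-unique x m m′ f f′ = ℤₚ.≤-antisym (floor-≤ x m′ m f′ f) (floor-≤ x m m′ f f′)

  module _ {Q : BasicSequence} {x : ℝ} where
    open IsExpansion

    private
      no-smaller-digit : ∀ {E₀ E E₀′ E′} → IsExpansion Q x E₀ E → IsExpansion Q x E₀′ E′ →
        ∀ n → (∀ i → i ℕ.< n → E i ≡ E′ i) → ¬ (E n ℕ.< E′ n)
      no-smaller-digit {E₀} {E} {E₀′} {E′} e e′ n same E<E′ =
        ℚₚ.<-irrefl refl (ℚₚ.<-≤-trans too-close apart)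
        where
        module D  = Digits Q E (digit e)
        module D′ = Digits Q E′ (digit e′)
        S  = partialSum Q E
        S′ = partialSum Q E′
        p = nontrivial e (suc n) .proj₁
        n<p = nontrivial e (suc n) .proj₂ .proj₁
        δ = 1/∏ Q 0 (suc p)
        0<δ = 1/∏-pos Q 0 (suc p)
        same-prefix : ∀ j → j ℕ.≤ n → S j ≡ S′ j
        same-prefix zero    _   = refl
        same-prefix (suc j) j<n = cong₂ _+_ (same-prefix j (ℕₚ.<⇒≤ j<n))
          (cong (λ d → (+ d ℚ./ ∏ Q 0 (suc j)) {{∏-nonZero {Q} {0} {suc j}}}) (same j j<n))
        step : upperSum Q E (suc n) ≤ S′ (suc n)
        step = subst₂ _≤_ (cong (_+ 1/∏ Q 0 (suc n)) (sym (D.partialSum-suc n))) (sym (D′.partialSum-suc n))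
          (subst (λ s → S n + fromℕ (E n) * ρ + ρ ≤ s + fromℕ (E′ n) * ρ) (same-prefix n ℕₚ.≤-refl)
            (p≡q+r⇒q≤p (cert (S n) (fromℕ (E n)) (fromℕ (E′ n)) ρ)
              (*-nonNeg (ℚₚ.<⇒≤ (1/∏-pos Q 0 (suc n)))
                (p≤q⇒0≤q-p (subst (_≤ fromℕ (E′ n)) (fromℕ-suc (E n)) (fromℕ-mono-≤ E<E′))))))
          where
          ρ = 1/∏ Q 0 (suc n)
          cert : ∀ s d d′ ρ → s + d′ * ρ ≡ s + d * ρ + ρ + ρ * (d′ - (d + 1ℚ))
          cert = solve-∀ ℚ-ring
        gap : ∀ i → suc p ℕ.≤ i → S i + δ ≤ S′ i
        gap i p<i = begin
          S i + δ                        ≤⟨ ℚₚ.+-monoˡ-≤ δ (ℚₚ.≤-trans (D.partialSum≤upperSum i) (D.upperSum-anti p<i)) ⟩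
          upperSum Q E (suc p) + δ       ≤⟨ D.upperSum-drop p (nontrivial e (suc n) .proj₂ .proj₂) ⟩
          upperSum Q E p                 ≤⟨ D.upperSum-anti n<p ⟩
          upperSum Q E (suc n)           ≤⟨ step ⟩
          S′ (suc n)                     ≤⟨ D′.partialSum-mono (ℕₚ.≤-trans n<p (ℕₚ.<⇒≤ p<i)) ⟩
          S′ i                           ∎
          where open ℚₚ.≤-Reasoning
        c = fromℤ E₀
        c′ = fromℤ E₀′
        both = Eventually-∩ (converges e (½ * δ) (half-pos 0<δ)) (converges e′ (½ * δ) (half-pos 0<δ))
        i = suc p ℕ.⊔ both .proj₁
        at = both .proj₂ i (ℕₚ.m≤n⊔m (suc p) (both .proj₁))
        low = at .proj₁ .proj₂
        upp = at .proj₂ .proj₁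
        k = low .proj₂ .proj₂ .proj₁ ℕ.⊔ upp .proj₂ .proj₂ .proj₁
        apart : δ ≤ S′ i - S i
        apart = p≡q+r⇒q≤p (cert (S i) (S′ i) δ) (p≤q⇒0≤q-p (gap i (ℕₚ.m≤m⊔n (suc p) (both .proj₁))))
          where
          cert : ∀ s s′ d → s′ - s ≡ d + (s′ - (s + d))
          cert = solve-∀ ℚ-ring
        too-close : S′ i - S i < δ
        too-close = subst (_< δ) same-floor (p≡q+r⇒q<p
          (trans (sym (half+half δ)) (cert (c′ + S′ i) (c + S i) (seq x k) (low .proj₁) (upp .proj₁) (½ * δ)))
          (ℚₚ.+-mono-<-≤ (low .proj₂ .proj₁) (+-nonNeg (ℚₚ.<⇒≤ (upp .proj₂ .proj₁)) (+-nonNeg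
            (p≤q⇒0≤q-p (low .proj₂ .proj₂ .proj₂ k (ℕₚ.m≤m⊔n _ _)))
            (p≤q⇒0≤q-p (upp .proj₂ .proj₂ .proj₂ k (ℕₚ.m≤n⊔m (low .proj₂ .proj₂ .proj₁) _)))))))
          where
          shift : ∀ c s s′ → (c + s′) - (c + s) ≡ s′ - s
          shift = solve-∀ ℚ-ring
          same-floor : (c′ + S′ i) - (c + S i) ≡ S′ i - S i
          same-floor = trans
            (cong (λ m → (fromℤ m + S′ i) - (c + S i)) (floor-unique x E₀′ E₀ (floor e′) (floor e)))
            (shift c (S i) (S′ i))
          cert : ∀ s′ s y l u h → h + h ≡ s′ - s + (l + (u + (h - (y - s + l) + (h - (s′ - y + u)))))
          cert = solve-∀ ℚ-ring

    digits-unique : ∀ {E₀ E E₀′ E′} → IsExpansion Q x E₀ E → IsExpansion Q x E₀′ E′ → ∀ n → E n ≡ E′ n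
    digits-unique {E₀} {E} {E₀′} {E′} e e′ n = go (suc n) n ℕₚ.≤-refl
      where
      go : ∀ n i → i ℕ.< n → E i ≡ E′ i
      go (suc n) i i<1+n with ℕₚ.m≤n⇒m<n∨m≡n (ℕₚ.≤-pred i<1+n)
      ... | inj₁ i<n  = go n i i<n
      ... | inj₂ refl = ℕₚ.≤-antisym
        (ℕₚ.≮⇒≥ (no-smaller-digit e′ e i (λ j j<i → sym (go n j j<i))))
        (ℕₚ.≮⇒≥ (no-smaller-digit e e′ i (go n)))

open CantorSeries

module DistributionCriterion where
  open import Data.Rational.Base using (_+_; _*_; _-_; -_; _≤_; _<_)
  open import Relation.Nullary.Decidable using (_×-dec_; decidable-stable)

  indicator : {P : Set} → Dec P → ℚ
  indicator (yes _) = 1ℚ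
  indicator (no  _) = 0ℚ

  indicator-nonNeg : ∀ {P : Set} (P? : Dec P) → 0ℚ ≤ indicator P?
  indicator-nonNeg (yes _) = 0≤1
  indicator-nonNeg (no  _) = ℚₚ.≤-refl

  indicator≤1 : ∀ {P : Set} (P? : Dec P) → indicator P? ≤ 1ℚ
  indicator≤1 (yes _) = ℚₚ.≤-refl
  indicator≤1 (no  _) = 0≤1

  indicator-true : ∀ {P : Set} (P? : Dec P) → P → indicator P? ≡ 1ℚ
  indicator-true (yes _) _ = refl
  indicator-true (no ¬p) p = contradiction p ¬p

  indicator-false : ∀ {P : Set} (P? : Dec P) → ¬ P → indicator P? ≡ 0ℚ
  indicator-false (yes p) ¬p = contradiction p ¬p
  indicator-false (no  _) _  = refl

  indicator-mono : ∀ {P R : Set} (P? : Dec P) (R? : Dec R) → (P → R) → indicator P? ≤ indicator R?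
  indicator-mono (yes p) R? P⇒R = ℚₚ.≤-reflexive (sym (indicator-true R? (P⇒R p)))
  indicator-mono (no  _) R? P⇒R = indicator-nonNeg R?

  indicator-⊎ : ∀ {P R S : Set} (P? : Dec P) (R? : Dec R) (S? : Dec S) → (P → R ⊎ S) →
    indicator P? ≤ indicator R? + indicator S?
  indicator-⊎ (no  _) R? S? _ = +-nonNeg (indicator-nonNeg R?) (indicator-nonNeg S?)
  indicator-⊎ (yes p) R? S? h with h p
  ... | inj₁ r = p≡q+r⇒q≤p (cong (_+ indicator S?) (indicator-true R? r)) (indicator-nonNeg S?)
  ... | inj₂ s = p≡q+r⇒q≤p (trans (ℚₚ.+-comm (indicator R?) _) (cong (_+ indicator R?) (indicator-true S? s)))
    (indicator-nonNeg R?)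

  count : {P : ℕ → Set} → (∀ n → Dec (P n)) → ℕ → ℚ
  count P? n = ∑ n λ i → indicator (P? i)

  -- The interval [Eₙ / qₙ , (Eₙ + 1) / qₙ], in which the fractional part of
  -- q₁ ⋯ qₙ x is found, is contained in [u , v].
  Fits : BasicSequence → (ℕ → ℕ) → ℚ → ℚ → ℕ → Set
  Fits Q E u v n = u ≤ fromℕ (E n) * 1/q Q n × fromℕ (suc (E n)) * 1/q Q n ≤ v

  fits? : ∀ Q E u v n → Dec (Fits Q E u v n)
  fits? Q E u v n =
    (u ℚₚ.≤? fromℕ (E n) * 1/q Q n) ×-dec (fromℕ (suc (E n)) * 1/q Q n ℚₚ.≤? v)

  Equidistributed : BasicSequence → (ℕ → ℕ) → Set
  Equidistributed Q E = ∀ u v → 0ℚ ≤ u → v ≤ 1ℚ →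
    Negligible (λ n → fromℕ n * (v - u) - count (fits? Q E u v) n) fromℕ

  fromℕ⟶∞ : fromℕ ⟶∞
  fromℕ⟶∞ M = archimedean M .proj₁ ,
    λ n K≤n → ℚₚ.<-≤-trans (archimedean M .proj₂) (fromℕ-mono-≤ K≤n)

  negligible⇒≤ : ∀ {d} → Negligible d fromℕ → ∀ η → 0ℚ < η → Eventually λ n → d n ≤ fromℕ n * η
  negligible⇒≤ {d} negl η 0<η = Eventually-map step (Eventually-∩ (negl (4 ℕ.* k) .proj₂) (fromℕ⟶∞ C))
    where
    k = archimedean⁻¹ η 0<η .proj₁
    1≤kη = archimedean⁻¹ η 0<η .proj₂
    C = negl (4 ℕ.* k) .proj₁
    K = fromℕ k
    four = 1ℚ + 1ℚ + 1ℚ + 1ℚ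
    three = 1ℚ + 1ℚ + 1ℚ
    k≢0 : k ≢ 0
    k≢0 eq = ℚₚ.<-irrefl refl (ℚₚ.<-≤-trans 0<1
      (subst (1ℚ ≤_) (trans (cong (λ j → fromℕ j * η) eq) (ℚₚ.*-zeroˡ η)) 1≤kη))
    cert : ∀ K d n η C → four * K * (n * η) ≡
      four * K * d + (three * n + C - four * K * d + ((n - C) + four * n * (K * η - 1ℚ)))
    cert = solve-∀ ℚ-ring
    step : ∀ n → (fromℕ (4 ℕ.* k) * d n ≤ fromℕ 3 * fromℕ n + C) × C < fromℕ n → d n ≤ fromℕ n * η
    step n (h₁ , h₂) = *-cancelˡ-≤ (four * K)
      (*-pos (ℚₚ.positive⁻¹ four) (fromℕ-nonZero⇒pos k {{ℕ.≢-nonZero k≢0}}))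
      (p≡q+r⇒q≤p (cert K (d n) (fromℕ n) η C) (+-nonNeg
        (p≤q⇒0≤q-p (subst (λ c → c * d n ≤ fromℕ 3 * fromℕ n + C) (fromℕ-* 4 k) h₁))
        (+-nonNeg (p≤q⇒0≤q-p (ℚₚ.<⇒≤ h₂))
          (*-nonNeg (*-nonNeg (ℚₚ.nonNegative⁻¹ four) (fromℕ-nonNeg n)) (p≤q⇒0≤q-p 1≤kη)))))

  module _ (Q : BasicSequence) (E : ℕ → ℕ) (E<q : ∀ n → E n ℕ.< q Q n) where
    open Digits Q E E<q

    private
      y : ℕ → ℝ
      y n = ∏ Q 0 n ·ᴿ value

      ⌊y⌋ : ℕ → ℚ
      ⌊y⌋ n = fromℕ (intPart n)

      low high : ℕ → ℚ
      low  n = fromℕ (E n) * 1/q Q n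
      high n = fromℕ (suc (E n)) * 1/q Q n

      0≤low : ∀ n → 0ℚ ≤ low n
      0≤low n = *-nonNeg (fromℕ-nonNeg (E n)) (recip-nonNeg (q Q n) {{q-nonZero Q n}})

    intPart-floor : ∀ n → high n < 1ℚ → IsFloor (y n) (+ intPart n)
    intPart-floor n high<1 =
        (λ (ε , 0<ε , k , h) → let i = k ℕ.⊔ suc n in
          ℚₚ.<-irrefl refl (ℚₚ.<-≤-trans
            (p≡q+r⇒q<p (cert₁ (⌊y⌋ n) (seq (y n) i) (low n) ε)
              (ℚₚ.+-mono-<-≤ 0<ε (+-nonNeg (0≤low n) (p≤q⇒0≤q-p (shift-lower n i (ℕₚ.m≤n⊔m k (suc n)))))))
            (h i (ℕₚ.m≤m⊔n k (suc n)))))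
      , (1ℚ - high n , p<q⇒0<q-p high<1 , suc n , λ i n<i →
          subst (seq (y n) i + (1ℚ - high n) ≤_) (sym (fromℕ-suc′ (intPart n)))
            (p≡q+r⇒q≤p (cert₂ (⌊y⌋ n) (seq (y n) i) (high n)) (p≤q⇒0≤q-p (shift-upper n i n<i))))
      where
      fromℕ-suc′ : ∀ m → fromℤ (ℤ.suc (+ m)) ≡ fromℕ m + 1ℚ
      fromℕ-suc′ = fromℕ-suc
      cert₁ : ∀ z y l ε → y + ε ≡ z + (ε + (l + (y - (z + l))))
      cert₁ = solve-∀ ℚ-ring
      cert₂ : ∀ z y h → z + 1ℚ ≡ y + (1ℚ - h) + (z + h - y)
      cert₂ = solve-∀ ℚ-ring

    fits⇒hit : ∀ {a b u v δ} → Eventually (λ i → seq a i ≤ u) → 0ℚ < δ →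
      Eventually (λ i → v + δ ≤ seq b i) → v < 1ℚ →
      ∀ n → Fits Q E u v n → y n mod1∈[ a , b ⟩
    fits⇒hit {a} {b} {u} {v} {δ} (ka , a≤u) 0<δ (kb , v+δ≤b) v<1 n (u≤low , high≤v) =
        + intPart n
      , intPart-floor n (ℚₚ.≤-<-trans high≤v v<1)
      , (λ (ε , 0<ε , k , h) →
          let i = k ℕ.⊔ (ka ℕ.⊔ suc n)
              ka≤i = ℕₚ.≤-trans (ℕₚ.m≤m⊔n ka (suc n)) (ℕₚ.m≤n⊔m k (ka ℕ.⊔ suc n))
              n<i  = ℕₚ.≤-trans (ℕₚ.m≤n⊔m ka (suc n)) (ℕₚ.m≤n⊔m k (ka ℕ.⊔ suc n))
          in ℚₚ.<-irrefl refl (ℚₚ.<-≤-trans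
            (p≡q+r⇒q<p (cert₁ (⌊y⌋ n) (seq (y n) i) (seq a i) u (low n) ε)
              (ℚₚ.+-mono-<-≤ 0<ε (+-nonNeg (p≤q⇒0≤q-p (a≤u i ka≤i))
                (+-nonNeg (p≤q⇒0≤q-p u≤low) (p≤q⇒0≤q-p (shift-lower n i n<i))))))
            (h i (ℕₚ.m≤m⊔n k (ka ℕ.⊔ suc n)))))
      , (δ , 0<δ , kb ℕ.⊔ suc n , λ i k≤i →
          p≡q+r⇒q≤p (cert₂ (⌊y⌋ n) (seq (y n) i) (seq b i) v (high n) δ)
            (+-nonNeg (p≤q⇒0≤q-p (v+δ≤b i (ℕₚ.m⊔n≤o⇒m≤o kb (suc n) k≤i)))
              (+-nonNeg (p≤q⇒0≤q-p high≤v)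
                (p≤q⇒0≤q-p (shift-upper n i (ℕₚ.m⊔n≤o⇒n≤o kb (suc n) k≤i))))))
      where
      cert₁ : ∀ z y a u l ε → y - z + ε ≡ a + (ε + (u - a + (l - u + (y - (z + l)))))
      cert₁ = solve-∀ ℚ-ring
      cert₂ : ∀ z y b v h δ → b ≡ y - z + δ + (b - (v + δ) + (v - h + (z + h - y)))
      cert₂ = solve-∀ ℚ-ring

    fits-left⇒miss : ∀ {a b u v δ} → 0ℚ < δ → Eventually (λ i → v + δ ≤ seq a i) → v < 1ℚ →
      ∀ n → Fits Q E u v n → ¬ (y n mod1∈[ a , b ⟩)
    fits-left⇒miss {a} {b} {u} {v} {δ} 0<δ (ka , v+δ≤a) v<1 n (_ , high≤v) (m , floor , a≤y-m , _) =
      a≤y-m (δ , 0<δ , ka ℕ.⊔ suc n , λ i k≤i →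
        subst (λ z → seq (y n) i - fromℤ z + δ ≤ seq a i)
          (floor-unique (y n) (+ intPart n) m (intPart-floor n (ℚₚ.≤-<-trans high≤v v<1)) floor)
          (p≡q+r⇒q≤p (cert (⌊y⌋ n) (seq (y n) i) (seq a i) v (high n) δ)
            (+-nonNeg (p≤q⇒0≤q-p (v+δ≤a i (ℕₚ.m⊔n≤o⇒m≤o ka (suc n) k≤i)))
              (+-nonNeg (p≤q⇒0≤q-p high≤v)
                (p≤q⇒0≤q-p (shift-upper n i (ℕₚ.m⊔n≤o⇒n≤o ka (suc n) k≤i)))))))
      where
      cert : ∀ z y b v h δ → b ≡ y - z + δ + (b - (v + δ) + (v - h + (z + h - y)))
      cert = solve-∀ ℚ-ring

    fits-right⇒miss : ∀ {a b u v} → Eventually (λ i → seq b i ≤ u) → v < 1ℚ →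
      ∀ n → Fits Q E u v n → ¬ (y n mod1∈[ a , b ⟩)
    fits-right⇒miss {a} {b} {u} {v} (kb , b≤u) v<1 n (u≤low , high≤v) (m , floor , _ , ε , 0<ε , k , h) =
      ℚₚ.<-irrefl refl (ℚₚ.<-≤-trans
        (p≡q+r⇒q<p (cert (⌊y⌋ n) (seq (y n) i) (seq b i) u (low n) ε)
          (ℚₚ.+-mono-<-≤ 0<ε (+-nonNeg (p≤q⇒0≤q-p (b≤u i kb≤i))
            (+-nonNeg (p≤q⇒0≤q-p u≤low) (p≤q⇒0≤q-p (shift-lower n i n<i))))))
        (subst (λ z → seq (y n) i - fromℤ z + ε ≤ seq b i)
          (floor-unique (y n) m (+ intPart n) floor (intPart-floor n (ℚₚ.≤-<-trans high≤v v<1)))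
          (h i (ℕₚ.m≤m⊔n k (kb ℕ.⊔ suc n)))))
      where
      i = k ℕ.⊔ (kb ℕ.⊔ suc n)
      kb≤i = ℕₚ.≤-trans (ℕₚ.m≤m⊔n kb (suc n)) (ℕₚ.m≤n⊔m k (kb ℕ.⊔ suc n))
      n<i  = ℕₚ.≤-trans (ℕₚ.m≤n⊔m kb (suc n)) (ℕₚ.m≤n⊔m k (kb ℕ.⊔ suc n))
      cert : ∀ z y a u l ε → y - z + ε ≡ a + (ε + (u - a + (l - u + (y - (z + l)))))
      cert = solve-∀ ℚ-ring

    all-fit⇒¬distributionNormal : ∀ {v} → v < 1ℚ → (∀ n → Fits Q E 0ℚ v n) →
      ¬ DistributionNormal Q value
    all-fit⇒¬distributionNormal {v} v<1 fits dn = ℚₚ.<-irrefl refl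
      (ℚₚ.<-≤-trans (ℚₚ.+-monoʳ-< (1ℚ - w) (at .proj₁ .proj₂ .proj₁)) below)
      where
      δ = ½ * (½ * (1ℚ - v))
      0<δ = half-pos (half-pos (p<q⇒0<q-p v<1))
      w = v + δ
      gap : 1ℚ - w ≡ δ + (δ + δ)
      gap = e v
        where
        e : ∀ v → 1ℚ - (v + ½ * (½ * (1ℚ - v))) ≡ ½ * (½ * (1ℚ - v)) + (½ * (½ * (1ℚ - v)) + ½ * (½ * (1ℚ - v)))
        e = solve-∀ ℚ-ring
      0<1-w : 0ℚ < 1ℚ - w
      0<1-w = subst (0ℚ <_) (sym gap) (ℚₚ.+-mono-< 0<δ (ℚₚ.+-mono-< 0<δ 0<δ))
      w≤1 : w ≤ 1ℚ
      w≤1 = p≡q+r⇒q≤p (e w) (ℚₚ.<⇒≤ 0<1-w)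
        where
        e : ∀ w → 1ℚ ≡ w + (1ℚ - w)
        e = solve-∀ ℚ-ring
      0<v : 0ℚ < v
      0<v = ℚₚ.<-≤-trans (*-pos (fromℕ-pos (E 0)) (recip-pos (q Q 0) {{q-nonZero Q 0}})) (fits 0 .proj₂)
      0<w : 0ℚ < w
      0<w = ℚₚ.+-mono-< 0<v 0<δ
      counting : IsCounting (λ n → y n mod1∈[ fromℚ 0ℚ , fromℚ w ⟩) (λ n → n)
      counting = record
        { start = refl
        ; hit   = λ _ _ → refl
        ; miss  = λ n ¬hit → ⊥-elim (¬hit (fits⇒hit {fromℚ 0ℚ} {fromℚ w} {0ℚ} {v} {δ}
            (0 , λ _ _ → ℚₚ.≤-refl) 0<δ (0 , λ _ _ → ℚₚ.≤-refl) v<1 n (fits n)))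
        }
      limit = dn (fromℚ 0ℚ) (fromℚ w) (λ (ε , 0<ε , k , h) → ℚₚ.<-irrefl refl (ℚₚ.<-≤-trans 0<ε
          (subst (_≤ 0ℚ) (ℚₚ.+-identityˡ ε) (h k ℕₚ.≤-refl))))
        (w , 0<w , 0 , λ _ _ → ℚₚ.≤-reflexive (ℚₚ.+-identityˡ w))
        (λ (ε , 0<ε , k , h) → ℚₚ.<-irrefl refl (ℚₚ.<-≤-trans
          (ℚₚ.+-mono-≤-< ℚₚ.≤-refl 0<ε) (ℚₚ.≤-trans (h k ℕₚ.≤-refl) (ℚₚ.≤-trans w≤1 (ℚₚ.≤-reflexive (sym (ℚₚ.+-identityʳ 1ℚ)))))))
        (λ n → n) counting (1ℚ - w) 0<1-w
      k = suc (limit .proj₁)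
      at = limit .proj₂ k (ℕₚ.n≤1+n _)
      j = at .proj₁ .proj₂ .proj₂ .proj₁
      ratio≡1 : fromℕ k /₀ fromℕ k ≡ 1ℚ
      ratio≡1 = *-cancelʳ-fromℕ k (trans (/₀-*-cancel (fromℕ k) (fromℕ-pos (limit .proj₁))) (sym (ℚₚ.*-identityˡ (fromℕ k))))
      below : 1ℚ - w + at .proj₁ .proj₁ ≤ 1ℚ - w + 0ℚ
      below = subst₂ _≤_ (trans (cong (λ r → r - (w - 0ℚ) + at .proj₁ .proj₁) ratio≡1)
          (cong (λ t → 1ℚ - t + at .proj₁ .proj₁) (ℚₚ.+-identityʳ w)))
        (sym (ℚₚ.+-identityʳ (1ℚ - w)))
        (at .proj₁ .proj₂ .proj₂ .proj₂ j ℕₚ.≤-refl)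

    private
      module Counting {P : ℕ → Set} {A : ℕ → ℕ} (counting : IsCounting P A) where
        open IsCounting counting

        A-step : ∀ n → A n ℕ.≤ A (suc n) × A (suc n) ℕ.≤ suc (A n)
        A-step n = decidable-stable ((A n ℕₚ.≤? A (suc n)) ×-dec (A (suc n) ℕₚ.≤? suc (A n)))
          λ ¬step → ¬step (let e = miss n (λ p → ¬step (ℕₚ.≤-trans (ℕₚ.n≤1+n (A n)) (ℕₚ.≤-reflexive (sym (hit n p)))
                                                       , ℕₚ.≤-reflexive (hit n p)))
                           in ℕₚ.≤-reflexive (sym e) , ℕₚ.≤-trans (ℕₚ.≤-reflexive e) (ℕₚ.n≤1+n (A n)))

        hits≤A : ∀ {H : ℕ → Set} (H? : ∀ n → Dec (H n)) → (∀ n → H n → P n) →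
          ∀ n → count H? n ≤ fromℕ (A n)
        hits≤A H? H⇒P zero = fromℕ-nonNeg (A 0)
        hits≤A H? H⇒P (suc n) with H? n
        ... | yes h = subst (count H? n + 1ℚ ≤_) (sym (trans (cong fromℕ (hit n (H⇒P n h))) (fromℕ-suc (A n))))
          (ℚₚ.+-monoˡ-≤ 1ℚ (hits≤A H? H⇒P n))
        ... | no  _ = ℚₚ.≤-trans (ℚₚ.≤-reflexive (ℚₚ.+-identityʳ (count H? n)))
          (ℚₚ.≤-trans (hits≤A H? H⇒P n) (fromℕ-mono-≤ (A-step n .proj₁)))

        A+misses≤n : ∀ {L : ℕ → Set} {R : ℕ → Set} (L? : ∀ n → Dec (L n)) (R? : ∀ n → Dec (R n)) →
          (∀ n → L n → ¬ P n) → (∀ n → R n → ¬ P n) → (∀ n → L n → ¬ R n) →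
          ∀ n → fromℕ (A n) + (count L? n + count R? n) ≤ fromℕ n
        A+misses≤n L? R? L⇒¬P R⇒¬P disjoint zero =
          ℚₚ.≤-reflexive (trans (ℚₚ.+-identityʳ (fromℕ (A 0))) (cong fromℕ start))
        A+misses≤n L? R? L⇒¬P R⇒¬P disjoint (suc n) with A+misses≤n L? R? L⇒¬P R⇒¬P disjoint n | L? n | R? n
        ... | ih | yes l | yes r = ⊥-elim (disjoint n l r)
        ... | ih | yes l | no  _ = subst₂ _≤_
          (trans (cert (fromℕ (A n)) (count L? n) (count R? n)) (cong (λ t → fromℕ t + (count L? n + 1ℚ + (count R? n + 0ℚ))) (sym (miss n (L⇒¬P n l)))))
          (sym (fromℕ-suc n)) (ℚₚ.+-monoˡ-≤ 1ℚ ih)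
          where
          cert : ∀ a l r → a + (l + r) + 1ℚ ≡ a + ((l + 1ℚ) + (r + 0ℚ))
          cert = solve-∀ ℚ-ring
        ... | ih | no  _ | yes r = subst₂ _≤_
          (trans (cert (fromℕ (A n)) (count L? n) (count R? n)) (cong (λ t → fromℕ t + (count L? n + 0ℚ + (count R? n + 1ℚ))) (sym (miss n (R⇒¬P n r)))))
          (sym (fromℕ-suc n)) (ℚₚ.+-monoˡ-≤ 1ℚ ih)
          where
          cert : ∀ a l r → a + (l + r) + 1ℚ ≡ a + ((l + 0ℚ) + (r + 1ℚ))
          cert = solve-∀ ℚ-ring
        ... | ih | no  _ | no  _ = ℚₚ.≤-trans (ℚₚ.+-monoˡ-≤ (count L? n + 0ℚ + (count R? n + 0ℚ)) (fromℕ-mono-≤ (A-step n .proj₂)))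
          (subst₂ _≤_ (trans (cert (fromℕ (A n)) (count L? n) (count R? n)) (cong (λ t → t + (count L? n + 0ℚ + (count R? n + 0ℚ))) (sym (fromℕ-suc (A n)))))
            (sym (fromℕ-suc n)) (ℚₚ.+-monoˡ-≤ 1ℚ ih))
          where
          cert : ∀ a l r → a + (l + r) + 1ℚ ≡ a + 1ℚ + ((l + 0ℚ) + (r + 0ℚ))
          cert = solve-∀ ℚ-ring

    -- The three intervals below are separated from ā and b̄ by margins of a few η,
    -- which absorb |a - ā|, |b - b̄| ≤ η and keep them inside [0 , 1).
    equidistributed⇒distributionNormal : Equidistributed Q E → DistributionNormal Q value
    equidistributed⇒distributionNormal equi a b 0≤a (e₀ , 0<e₀ , k₀ , a<b) b≤1 A counting ε 0<ε =
      Eventually-map conclude (Eventually-∩ (1 , λ n 1≤n → 1≤n) (Eventually-∩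
        (many 0ℚ (ā - 5η) ℚₚ.≤-refl vL≤1) (Eventually-∩
        (many (ā + 2η) (b̄ - 3η) (ℚₚ.<⇒≤ 0<uH) (ℚₚ.<⇒≤ vH<1))
        (many (b̄ + 4η) (1ℚ - η) 0≤uR (ℚₚ.<⇒≤ vR<1)))))
      where
      open Counting counting
      η = ½ * (½ * (½ * (½ * ε)))
      0<η : 0ℚ < η
      0<η = half-pos (half-pos (half-pos (half-pos 0<ε)))
      0≤η = ℚₚ.<⇒≤ 0<η
      2η = η + η
      3η = 2η + η
      4η = 3η + η
      5η = 4η + η
      ka = cauchy a η 0<η .proj₁
      kb = cauchy b η 0<η .proj₁
      K = ka ℕ.⊔ kb
      ā = seq a K
      b̄ = seq b K
      ka≤K = ℕₚ.m≤m⊔n ka kb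
      kb≤K = ℕₚ.m≤n⊔m ka kb
      a-near : ∀ m n → ka ℕ.≤ m → ka ℕ.≤ n → 0ℚ ≤ η - (seq a m - seq a n)
      a-near m n ka≤m ka≤n = p≤q⇒0≤q-p (ℚₚ.≤-trans (p≤∣p∣ _) (ℚₚ.<⇒≤ (cauchy a η 0<η .proj₂ m n ka≤m ka≤n)))
      b-near : ∀ m n → kb ℕ.≤ m → kb ℕ.≤ n → 0ℚ ≤ η - (seq b m - seq b n)
      b-near m n kb≤m kb≤n = p≤q⇒0≤q-p (ℚₚ.≤-trans (p≤∣p∣ _) (ℚₚ.<⇒≤ (cauchy b η 0<η .proj₂ m n kb≤m kb≤n)))
      0<uH : 0ℚ < ā + 2η
      0<uH = ℚₚ.≰⇒> λ uH≤0 → 0≤a (η , 0<η , ka , λ i ka≤i →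
        p≡q+r⇒q≤p (cert (seq a i) ā η) (+-nonNeg (p≤q⇒0≤q-p uH≤0) (a-near i K ka≤i ka≤K)))
        where
        cert : ∀ a ā η → 0ℚ ≡ a + η + (0ℚ - (ā + (η + η)) + (η - (a - ā)))
        cert = solve-∀ ℚ-ring
      vH<1 : b̄ - 3η < 1ℚ
      vH<1 = ℚₚ.≰⇒> λ 1≤vH → b≤1 (2η , ℚₚ.+-mono-< 0<η 0<η , kb , λ i kb≤i →
        p≡q+r⇒q≤p (cert (seq b i) b̄ η) (+-nonNeg (p≤q⇒0≤q-p 1≤vH) (b-near K i kb≤K kb≤i)))
        where
        cert : ∀ b b̄ η → b ≡ 1ℚ + (η + η) + (b̄ - (η + η + η) - 1ℚ + (η - (b̄ - b)))
        cert = solve-∀ ℚ-ring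
      ā≤b̄+2η : ā ≤ b̄ + 2η
      ā≤b̄+2η = p≡q+r⇒q≤p (cert (seq a i) (seq b i) ā b̄ η e₀) (+-nonNeg (ℚₚ.<⇒≤ 0<e₀)
          (+-nonNeg (p≤q⇒0≤q-p (a<b i (ℕₚ.m≤m⊔n k₀ K))) (+-nonNeg
            (a-near K i ka≤K (ℕₚ.≤-trans ka≤K K≤i)) (b-near i K (ℕₚ.≤-trans kb≤K K≤i) kb≤K))))
        where
        i = k₀ ℕ.⊔ K
        K≤i = ℕₚ.m≤n⊔m k₀ K
        cert : ∀ a b ā b̄ η e → b̄ + (η + η) ≡ ā + (e + (b - (a + e) + (η - (ā - a) + (η - (b - b̄)))))
        cert = solve-∀ ℚ-ring
      vL<1 : ā - 5η < 1ℚ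
      vL<1 = ℚₚ.≤-<-trans (p≡q+r⇒q≤p (cert ā b̄ η) (p≤q⇒0≤q-p ā≤b̄+2η)) vH<1
        where
        cert : ∀ ā b̄ η → b̄ - (η + η + η) ≡ ā - (η + η + η + η + η) + (b̄ + (η + η) - ā)
        cert = solve-∀ ℚ-ring
      vL≤1 = ℚₚ.<⇒≤ vL<1
      vR<1 : 1ℚ - η < 1ℚ
      vR<1 = p≡q+r⇒q<p (cert η) 0<η
        where
        cert : ∀ η → 1ℚ ≡ 1ℚ - η + η
        cert = solve-∀ ℚ-ring
      0≤uR : 0ℚ ≤ b̄ + 4η
      0≤uR = ℚₚ.≤-trans (ℚₚ.<⇒≤ 0<uH) (p≡q+r⇒q≤p (cert ā b̄ η) (p≤q⇒0≤q-p ā≤b̄+2η))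
        where
        cert : ∀ ā b̄ η → b̄ + (η + η + η + η) ≡ ā + (η + η) + (b̄ + (η + η) - ā)
        cert = solve-∀ ℚ-ring
      many : ∀ u v → 0ℚ ≤ u → v ≤ 1ℚ →
        Eventually λ n → fromℕ n * (v - u) - count (fits? Q E u v) n ≤ fromℕ n * η
      many u v 0≤u v≤1 = negligible⇒≤ (equi u v 0≤u v≤1) η 0<η
      L? = fits? Q E 0ℚ (ā - 5η)
      H? = fits? Q E (ā + 2η) (b̄ - 3η)
      R? = fits? Q E (b̄ + 4η) (1ℚ - η)
      H⇒hit : ∀ n → Fits Q E (ā + 2η) (b̄ - 3η) n → y n mod1∈[ a , b ⟩
      H⇒hit = fits⇒hit {a} {b} {ā + 2η} {b̄ - 3η} {η}
        (ka , λ i ka≤i → p≡q+r⇒q≤p (cert₁ (seq a i) ā η) (+-nonNeg 0≤η (a-near i K ka≤i ka≤K)))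
        0<η
        (kb , λ i kb≤i → p≡q+r⇒q≤p (cert₂ (seq b i) b̄ η) (+-nonNeg 0≤η (b-near K i kb≤K kb≤i)))
        vH<1
        where
        cert₁ : ∀ a ā η → ā + (η + η) ≡ a + (η + (η - (a - ā)))
        cert₁ = solve-∀ ℚ-ring
        cert₂ : ∀ b b̄ η → b ≡ b̄ - (η + η + η) + η + (η + (η - (b̄ - b)))
        cert₂ = solve-∀ ℚ-ring
      L⇒miss : ∀ n → Fits Q E 0ℚ (ā - 5η) n → ¬ (y n mod1∈[ a , b ⟩)
      L⇒miss = fits-left⇒miss {a} {b} {0ℚ} {ā - 5η} {η} 0<η
        (ka , λ i ka≤i → p≡q+r⇒q≤p (cert (seq a i) ā η)
          (+-nonNeg 0≤η (+-nonNeg 0≤η (+-nonNeg 0≤η (a-near K i ka≤K ka≤i)))))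
        vL<1
        where
        cert : ∀ a ā η → a ≡ ā - (η + η + η + η + η) + η + (η + (η + (η + (η - (ā - a)))))
        cert = solve-∀ ℚ-ring
      R⇒miss : ∀ n → Fits Q E (b̄ + 4η) (1ℚ - η) n → ¬ (y n mod1∈[ a , b ⟩)
      R⇒miss = fits-right⇒miss {a} {b} {b̄ + 4η} {1ℚ - η}
        (kb , λ i kb≤i → p≡q+r⇒q≤p (cert (seq b i) b̄ η)
          (+-nonNeg 0≤η (+-nonNeg 0≤η (+-nonNeg 0≤η (b-near i K kb≤i kb≤K)))))
        vR<1
        where
        cert : ∀ b b̄ η → b̄ + (η + η + η + η) ≡ b + (η + (η + (η + (η - (b - b̄)))))
        cert = solve-∀ ℚ-ring
      disjoint : ∀ n → Fits Q E 0ℚ (ā - 5η) n → ¬ Fits Q E (b̄ + 4η) (1ℚ - η) n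
      disjoint n (_ , high≤) (≤low , _) = ℚₚ.<-irrefl refl (ℚₚ.<-≤-trans
        (p≡q+r⇒q<p (cert ā b̄ η (fromℕ (E n)) (1/q Q n))
          (ℚₚ.+-mono-<-≤ 0<η (+-nonNeg (ℚₚ.<⇒≤ (recip-pos (q Q n) {{q-nonZero Q n}}))
            (+-nonNeg (*-nonNeg (ℚₚ.nonNegative⁻¹ six) 0≤η) (+-nonNeg (p≤q⇒0≤q-p ≤low)
              (p≤q⇒0≤q-p (subst (λ t → t * 1/q Q n ≤ ā - 5η) (fromℕ-suc (E n)) high≤)))))))
        ā≤b̄+2η)
        where
        six = 1ℚ + 1ℚ + 1ℚ + 1ℚ + 1ℚ + 1ℚ
        cert : ∀ ā b̄ η d e → ā ≡ b̄ + (η + η) + (η + (e + ((1ℚ + 1ℚ + 1ℚ + 1ℚ + 1ℚ + 1ℚ) * η +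
          (d * e - (b̄ + (η + η + η + η)) + (ā - (η + η + η + η + η) - (d + 1ℚ) * e)))))
        cert = solve-∀ ℚ-ring
      conclude : ∀ n → 1 ℕ.≤ n
        × (fromℕ n * (ā - 5η - 0ℚ) - count L? n ≤ fromℕ n * η)
        × (fromℕ n * (b̄ - 3η - (ā + 2η)) - count H? n ≤ fromℕ n * η)
        × (fromℕ n * (1ℚ - η - (b̄ + 4η)) - count R? n ≤ fromℕ n * η) →
        (fromℚ (fromℕ (A n) /₀ fromℕ n) -ᴿ (b -ᴿ a) <ᴿ fromℚ ε)
          × ((b -ᴿ a) -ᴿ fromℚ (fromℕ (A n) /₀ fromℕ n) <ᴿ fromℚ ε)
      conclude n (1≤n , left , hits , right) =
          (η , 0<η , K , λ i K≤i → p≡q+r⇒q≤p (trans ε≡ (cert₃ (seq a i) (seq b i) ā b̄ η r))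
            (+-nonNeg 0≤η (+-nonNeg (p≤q⇒0≤q-p upper) (+-nonNeg
              (a-near i K (ℕₚ.≤-trans ka≤K K≤i) ka≤K) (b-near K i kb≤K (ℕₚ.≤-trans kb≤K K≤i))))))
        , (η , 0<η , K , λ i K≤i → p≡q+r⇒q≤p (trans ε≡ (cert₄ (seq a i) (seq b i) ā b̄ η r))
            (+-nonNeg (*-nonNeg (ℚₚ.nonNegative⁻¹ seven) 0≤η) (+-nonNeg (p≤q⇒0≤q-p lower) (+-nonNeg
              (a-near K i ka≤K (ℕₚ.≤-trans ka≤K K≤i)) (b-near i K (ℕₚ.≤-trans kb≤K K≤i) kb≤K)))))
        where
        r = fromℕ (A n) /₀ fromℕ n
        0<n : 0ℚ < fromℕ n
        0<n = ℚₚ.<-≤-trans 0<1 (fromℕ-mono-≤ 1≤n)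
        rn : r * fromℕ n ≡ fromℕ (A n)
        rn = /₀-*-cancel (fromℕ (A n)) 0<n
        ε≡ : ε ≡ (1ℚ + 1ℚ) * ((1ℚ + 1ℚ) * ((1ℚ + 1ℚ) * (1ℚ + 1ℚ))) * η
        ε≡ = e ε
          where
          e : ∀ ε → ε ≡ (1ℚ + 1ℚ) * ((1ℚ + 1ℚ) * ((1ℚ + 1ℚ) * (1ℚ + 1ℚ))) * (½ * (½ * (½ * (½ * ε))))
          e = solve-∀ ℚ-ring
        seven = 1ℚ + 1ℚ + 1ℚ + 1ℚ + 1ℚ + 1ℚ + 1ℚ
        cert₁ : ∀ n ā b̄ η r h → n * r ≡ n * (b̄ - ā - (η + η + η + η + η + η)) +
          (r * n - h + (n * η - (n * (b̄ - (η + η + η) - (ā + (η + η))) - h)))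
        cert₁ = solve-∀ ℚ-ring
        lower : b̄ - ā - (5η + η) ≤ r
        lower = *-cancelˡ-≤ (fromℕ n) 0<n (p≡q+r⇒q≤p (cert₁ (fromℕ n) ā b̄ η r (count H? n))
          (+-nonNeg (p≤q⇒0≤q-p (subst (count H? n ≤_) (sym rn) (hits≤A H? H⇒hit n))) (p≤q⇒0≤q-p hits)))
        cert₂ : ∀ n ā b̄ η r l h → n * (b̄ - ā + (1ℚ + 1ℚ) * (η + η + η + η + η + η)) ≡ n * r +
          (n - (r * n + (l + h)) + (n * η - (n * (ā - (η + η + η + η + η) - 0ℚ) - l)
            + (n * η - (n * (1ℚ - η - (b̄ + (η + η + η + η))) - h))))
        cert₂ = solve-∀ ℚ-ring
        upper : r ≤ b̄ - ā + (1ℚ + 1ℚ) * (5η + η)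
        upper = *-cancelˡ-≤ (fromℕ n) 0<n (p≡q+r⇒q≤p (cert₂ (fromℕ n) ā b̄ η r (count L? n) (count R? n))
          (+-nonNeg (p≤q⇒0≤q-p (subst (λ t → t + (count L? n + count R? n) ≤ fromℕ n) (sym rn)
              (A+misses≤n L? R? L⇒miss R⇒miss disjoint n)))
            (+-nonNeg (p≤q⇒0≤q-p left) (p≤q⇒0≤q-p right))))
        cert₃ : ∀ a b ā b̄ η r → (1ℚ + 1ℚ) * ((1ℚ + 1ℚ) * ((1ℚ + 1ℚ) * (1ℚ + 1ℚ))) * η ≡
          r - (b - a) + η + (η + ((b̄ - ā + (1ℚ + 1ℚ) * (η + η + η + η + η + η)) - r
            + (η - (a - ā) + (η - (b̄ - b)))))
        cert₃ = solve-∀ ℚ-ring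
        cert₄ : ∀ a b ā b̄ η r → (1ℚ + 1ℚ) * ((1ℚ + 1ℚ) * ((1ℚ + 1ℚ) * (1ℚ + 1ℚ))) * η ≡
          b - a - r + η + ((1ℚ + 1ℚ + 1ℚ + 1ℚ + 1ℚ + 1ℚ + 1ℚ) * η + (r - (b̄ - ā - (η + η + η + η + η + η))
            + (η - (ā - a) + (η - (b - b̄)))))
        cert₄ = solve-∀ ℚ-ring

open DistributionCriterion

module Words where
  open import Data.Nat.Base using (_+_; _≤_; _<_)
  open import Data.List.Base using (List; []; _∷_; length)
  import Data.List.Properties as Listₚ
  open import Data.Nat.Binary.Base as ℕᵇ using (ℕᵇ; 2[1+_]; 1+[2_])
  import Data.Nat.Binary.Properties as ℕᵇₚ
  open import Data.Vec.Base using (Vec; lookup; tabulate; toList; []; _∷_)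
  import Data.Vec.Properties as Vecₚ
  open import Data.Fin.Base as Fin using (Fin; toℕ; fromℕ<)
  import Data.Fin.Properties as Finₚ

  nth : List ℕ → ℕ → ℕ
  nth []       _       = 0
  nth (x ∷ xs) zero    = x
  nth (x ∷ xs) (suc t) = nth xs t

  nth-ext : ∀ xs ys → length xs ≡ length ys → (∀ t → t < length xs → nth xs t ≡ nth ys t) → xs ≡ ys
  nth-ext []       []       _  _ = refl
  nth-ext (x ∷ xs) (y ∷ ys) eq h = cong₂ _∷_ (h 0 (s≤s z≤n))
    (nth-ext xs ys (ℕₚ.suc-injective eq) λ t t<k → h (suc t) (s≤s t<k))

  -- A binary numeral is read as a non-empty word: the letters are the lengths of
  -- the (possibly empty) runs of the digit 1+[2_] delimited by the digits 2[1+_].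
  parse : ℕᵇ → ℕ × List ℕ
  parse ℕᵇ.zero  = 0 , []
  parse 2[1+ x ] = 0 , (let (a , as) = parse x in a ∷ as)
  parse 1+[2 x ] = let (a , as) = parse x in suc a , as

  unparse : ℕ → List ℕ → ℕᵇ
  unparse zero    []       = ℕᵇ.zero
  unparse zero    (b ∷ bs) = 2[1+ unparse b bs ]
  unparse (suc a) as       = 1+[2 unparse a as ]

  parse-unparse : ∀ a as → parse (unparse a as) ≡ (a , as)
  parse-unparse zero    []       = refl
  parse-unparse zero    (b ∷ bs) = cong (λ (a , as) → 0 , a ∷ as) (parse-unparse b bs)
  parse-unparse (suc a) as       = cong (λ (a , as) → suc a , as) (parse-unparse a as)

  unparse-parse : ∀ x → (let (a , as) = parse x in unparse a as) ≡ x
  unparse-parse ℕᵇ.zero  = refl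
  unparse-parse 2[1+ x ] = cong 2[1+_] (unparse-parse x)
  unparse-parse 1+[2 x ] = cong 1+[2_] (unparse-parse x)

  parse-length : ∀ x → length (parse x .proj₂) ≤ ℕᵇ.toℕ x
  parse-length ℕᵇ.zero  = z≤n
  parse-length 2[1+ x ] = ℕₚ.≤-trans (s≤s (parse-length x)) (ℕₚ.m≤n*m (suc (ℕᵇ.toℕ x)) 2)
  parse-length 1+[2 x ] =
    ℕₚ.≤-trans (parse-length x) (ℕₚ.≤-trans (ℕₚ.m≤n*m (ℕᵇ.toℕ x) 2) (ℕₚ.n≤1+n _))

  parse-nth : ∀ x t → (let (a , as) = parse x in nth (a ∷ as) t) ≤ ℕᵇ.toℕ x
  parse-nth ℕᵇ.zero  zero    = z≤n
  parse-nth ℕᵇ.zero  (suc t) = z≤n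
  parse-nth 2[1+ x ] zero    = z≤n
  parse-nth 2[1+ x ] (suc t) = ℕₚ.≤-trans (parse-nth x t)
    (ℕₚ.≤-trans (ℕₚ.n≤1+n _) (ℕₚ.m≤n*m (suc (ℕᵇ.toℕ x)) 2))
  parse-nth 1+[2 x ] zero    = s≤s (ℕₚ.≤-trans (parse-nth x 0) (ℕₚ.m≤n*m (ℕᵇ.toℕ x) 2))
  parse-nth 1+[2 x ] (suc t) = ℕₚ.≤-trans (parse-nth x (suc t))
    (ℕₚ.≤-trans (ℕₚ.m≤n*m (ℕᵇ.toℕ x) 2) (ℕₚ.n≤1+n _))

  word : ℕ → List ℕ
  word i = let (a , as) = parse (ℕᵇ.fromℕ i) in a ∷ as

  index : ℕ → List ℕ → ℕ
  index a as = ℕᵇ.toℕ (unparse a as)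

  word-index : ∀ a as → word (index a as) ≡ a ∷ as
  word-index a as = cong (λ (a , as) → a ∷ as)
    (trans (cong parse (ℕᵇₚ.fromℕ-toℕ (unparse a as))) (parse-unparse a as))

  word-injective : ∀ i j → word i ≡ word j → i ≡ j
  word-injective i j eq = begin
    i                                                    ≡⟨ round i ⟨
    (let (a , as) = parse (ℕᵇ.fromℕ i) in index a as)    ≡⟨ cong₂ index (Listₚ.∷-injectiveˡ eq) (Listₚ.∷-injectiveʳ eq) ⟩
    (let (a , as) = parse (ℕᵇ.fromℕ j) in index a as)    ≡⟨ round j ⟩
    j                                                    ∎
    where
    open ≡-Reasoning
    round : ∀ i → (let (a , as) = parse (ℕᵇ.fromℕ i) in index a as) ≡ i
    round i = trans (cong ℕᵇ.toℕ (unparse-parse (ℕᵇ.fromℕ i))) (ℕᵇₚ.toℕ-fromℕ i)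

  word-length : ∀ i → length (word i) ≤ suc i
  word-length i = s≤s (subst (length (parse (ℕᵇ.fromℕ i) .proj₂) ≤_) (ℕᵇₚ.toℕ-fromℕ i) (parse-length (ℕᵇ.fromℕ i)))

  word-nth : ∀ i t → nth (word i) t ≤ i
  word-nth i t = subst (nth (word i) t ≤_) (ℕᵇₚ.toℕ-fromℕ i) (parse-nth (ℕᵇ.fromℕ i) t)

  nth-toList : ∀ {k} (B : Vec ℕ k) i → nth (toList B) (toℕ i) ≡ lookup B i
  nth-toList (x ∷ B) Fin.zero    = refl
  nth-toList (x ∷ B) (Fin.suc i) = nth-toList B i

  occursAt⇒nth : ∀ {k} (B : Block k) E j → OccursAt B E j → ∀ t → t < k → E (j + t) ≡ nth (toList B) t
  occursAt⇒nth B E j occ t t<k = begin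
    E (j + t)                                   ≡⟨ cong (λ u → E (j + u)) (Finₚ.toℕ-fromℕ< t<k) ⟨
    E (j + toℕ i)                               ≡⟨ Vecₚ.lookup∘tabulate (λ i → E (j + toℕ i)) i ⟨
    lookup (tabulate (λ i → E (j + toℕ i))) i   ≡⟨ cong (λ v → lookup v i) occ ⟩
    lookup B i                                  ≡⟨ nth-toList B i ⟨
    nth (toList B) (toℕ i)                      ≡⟨ cong (nth (toList B)) (Finₚ.toℕ-fromℕ< t<k) ⟩
    nth (toList B) t                            ∎
    where
    open ≡-Reasoning
    i = fromℕ< t<k

  nth⇒occursAt : ∀ {k} (B : Block k) E j → (∀ t → t < k → E (j + t) ≡ nth (toList B) t) → OccursAt B E j
  nth⇒occursAt B E j h = trans
    (Vecₚ.tabulate-cong λ i → trans (h (toℕ i) (Finₚ.toℕ<n i)) (nth-toList B i))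
    (Vecₚ.tabulate∘lookup B)

open Words

module Stages where
  open import Data.Rational.Base using (_+_; _*_; _-_; -_; _≤_; _<_)
  open import Data.Nat.DivMod using (_/_; _%_; m≡m%n+[m/n]*n; m%n<n; m<n⇒m%n≡m; [m+n]%n≡m%n)

  abstract
    -- The cube makes the proportion cutoff s / base s of reserved columns tend to 0.
    base : ℕ → ℕ
    base s = (2 ℕ.+ s) ℕ.* ((2 ℕ.+ s) ℕ.* (2 ℕ.+ s))

    base-def : ∀ s → base s ≡ (2 ℕ.+ s) ℕ.* ((2 ℕ.+ s) ℕ.* (2 ℕ.+ s))
    base-def s = refl

    period : ℕ → ℕ → ℕ
    period s k = (2 ℕ.* base s) ℕ.^ k

    period-zero : ∀ s → period s 0 ≡ 1
    period-zero s = refl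

    period-suc : ∀ s k → period s (suc k) ≡ 2 ℕ.* base s ℕ.* period s k
    period-suc s k = refl

    period-+ : ∀ s k l → period s (k ℕ.+ l) ≡ period s k ℕ.* period s l
    period-+ s k l = ℕₚ.^-distribˡ-+-* (2 ℕ.* base s) k l

    period-nonZero : ∀ s k → ℕ.NonZero (period s k)
    period-nonZero s k = ℕₚ.m^n≢0 (2 ℕ.* base s) k

  stageLength : ℕ → ℕ
  stageLength s = period s (2 ℕ.+ s)

  stageStart : ℕ → ℕ
  stageStart zero    = 0
  stageStart (suc s) = stageStart s ℕ.+ stageLength s

  next : ℕ × ℕ → ℕ × ℕ
  next (s , j) with suc j ℕₚ.<? stageLength s
  ... | yes _ = s , suc j
  ... | no  _ = suc s , 0

  abstract
    locate : ℕ → ℕ × ℕ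
    locate zero    = 0 , 0
    locate (suc n) = next (locate n)

    locate-zero : locate 0 ≡ (0 , 0)
    locate-zero = refl

    locate-suc : ∀ n → locate (suc n) ≡ next (locate n)
    locate-suc n = refl

  stage offset : ℕ → ℕ
  stage  n = locate n .proj₁
  offset n = locate n .proj₂

  stageLength-pos : ∀ s → 0 ℕ.< stageLength s
  stageLength-pos s = ℕ.>-nonZero⁻¹ (stageLength s) {{period-nonZero s (2 ℕ.+ s)}}

  locate-start : ∀ s j → j ℕ.< stageLength s → locate (stageStart s ℕ.+ j) ≡ (s , j)
  locate-start zero    zero    _   = locate-zero
  locate-start (suc s) zero    _   = begin
    locate (stageStart s ℕ.+ stageLength s ℕ.+ 0) ≡⟨ cong locate (ℕₚ.+-identityʳ (stageStart s ℕ.+ stageLength s)) ⟩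
    locate (stageStart s ℕ.+ stageLength s)       ≡⟨ cong (λ l → locate (stageStart s ℕ.+ l)) L≡ ⟨
    locate (stageStart s ℕ.+ suc l)               ≡⟨ cong locate (ℕₚ.+-suc (stageStart s) l) ⟩
    locate (suc (stageStart s ℕ.+ l))             ≡⟨ locate-suc (stageStart s ℕ.+ l) ⟩
    next (locate (stageStart s ℕ.+ l))            ≡⟨ cong next (locate-start s l (ℕₚ.≤-reflexive L≡)) ⟩
    next (s , l)                                  ≡⟨ last ⟩
    suc s , 0                                     ∎
    where
    open ≡-Reasoning
    l = ℕ.pred (stageLength s)
    L≡ : suc l ≡ stageLength s
    L≡ = ℕₚ.suc-pred (stageLength s) {{ℕ.>-nonZero (stageLength-pos s)}}
    last : next (s , l) ≡ (suc s , 0)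
    last with suc l ℕₚ.<? stageLength s
    ... | yes l<L = contradiction l<L (ℕₚ.<-irrefl L≡)
    ... | no  _   = refl
  locate-start s (suc j) j<L = begin
    locate (stageStart s ℕ.+ suc j)    ≡⟨ cong locate (ℕₚ.+-suc (stageStart s) j) ⟩
    locate (suc (stageStart s ℕ.+ j))  ≡⟨ locate-suc (stageStart s ℕ.+ j) ⟩
    next (locate (stageStart s ℕ.+ j)) ≡⟨ cong next (locate-start s j (ℕₚ.<⇒≤ j<L)) ⟩
    next (s , j)                       ≡⟨ inside ⟩
    s , suc j                          ∎
    where
    open ≡-Reasoning
    inside : next (s , j) ≡ (s , suc j)
    inside with suc j ℕₚ.<? stageLength s
    ... | yes _   = refl
    ... | no  j≮L = contradiction j<L j≮L

  start+offset : ∀ n → n ≡ stageStart (stage n) ℕ.+ offset n × offset n ℕ.< stageLength (stage n)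
  start+offset = go
    where
    At : ℕ → ℕ × ℕ → Set
    At n (s , j) = n ≡ stageStart s ℕ.+ j × j ℕ.< stageLength s
    step : ∀ n sj → At n sj → At (suc n) (next sj)
    step n (s , j) (n≡ , j<L) with suc j ℕₚ.<? stageLength s
    ... | yes 1+j<L = trans (cong suc n≡) (sym (ℕₚ.+-suc (stageStart s) j)) , 1+j<L
    ... | no  1+j≮L =
        trans (cong suc n≡) (trans (sym (ℕₚ.+-suc (stageStart s) j))
          (trans (cong (stageStart s ℕ.+_) (ℕₚ.≤-antisym j<L (ℕₚ.≮⇒≥ 1+j≮L)))
            (sym (ℕₚ.+-identityʳ (stageStart s ℕ.+ stageLength s)))))
      , stageLength-pos (suc s)
    go : ∀ n → At n (locate n)
    go zero    = subst (At 0) (sym locate-zero) (refl , stageLength-pos 0)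
    go (suc n) = subst (At (suc n)) (sym (locate-suc n)) (step n (locate n) (go n))

  start-mono : ∀ {s t} → s ℕ.≤ t → stageStart s ℕ.≤ stageStart t
  start-mono {s} s≤t = go (ℕₚ.≤⇒≤′ s≤t)
    where
    go : ∀ {t} → s ℕ.≤′ t → stageStart s ℕ.≤ stageStart t
    go ℕ.≤′-refl           = ℕₚ.≤-refl
    go (ℕ.≤′-step {t} s≤t) = ℕₚ.≤-trans (go s≤t) (ℕₚ.m≤m+n (stageStart t) (stageLength t))

  start≤⇒≤stage : ∀ {s n} → stageStart s ℕ.≤ n → s ℕ.≤ stage n
  start≤⇒≤stage {s} {n} s≤n = ℕₚ.≮⇒≥ λ t<s → ℕₚ.<-irrefl refl (begin-strict
      n                                             ≡⟨ start+offset n .proj₁ ⟩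
      stageStart (stage n) ℕ.+ offset n                  <⟨ ℕₚ.+-monoʳ-< (stageStart (stage n)) (start+offset n .proj₂) ⟩
      stageStart (suc (stage n))                         ≤⟨ start-mono t<s ⟩
      stageStart s                                       ≤⟨ s≤n ⟩
      n                                             ∎)
    where open ℕₚ.≤-Reasoning

  stage-start : ∀ s j → j ℕ.< stageLength s → stage (stageStart s ℕ.+ j) ≡ s
  stage-start s j j<L = cong proj₁ (locate-start s j j<L)

  ∑-cong-< : ∀ n {f g : ℕ → ℚ} → (∀ i → i ℕ.< n → f i ≡ g i) → ∑ n f ≡ ∑ n g
  ∑-cong-< n h = ℚₚ.≤-antisym (∑-mono-≤ n λ i i<n → ℚₚ.≤-reflexive (h i i<n))
    (∑-mono-≤ n λ i i<n → ℚₚ.≤-reflexive (sym (h i i<n)))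

  stagewise : (ℕ → ℚ) → ℕ → ℚ
  stagewise h n = ∑ n λ i → h (stage i)

  stagewise-start : ∀ h s j → j ℕ.≤ stageLength s →
    stagewise h (stageStart s ℕ.+ j) ≡ stagewise h (stageStart s) + fromℕ j * h s
  stagewise-start h s j j≤L = trans (∑-split (stageStart s) j (λ i → h (stage i)))
    (cong (λ t → stagewise h (stageStart s) + t) (trans
      (∑-cong-< j λ i i<j → cong h (stage-start s i (ℕₚ.<-≤-trans i<j j≤L))) (∑-const j (h s))))

  -- An error that is o(h) inside each stage, up to a constant cₛ per stage, is
  -- o(h) altogether: cₛ is paid for by the total weight of the previous stage.
  module StageLemma (m : ℕ) (s₀ : ℕ) (d : ℕ → ℚ) (δ : ℕ → ℕ → ℚ) (h c : ℕ → ℚ)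
    (0≤h    : ∀ s → 0ℚ ≤ h s)
    (d≤δ    : ∀ s → s₀ ℕ.≤ s → ∀ j → j ℕ.< stageLength s → d (stageStart s ℕ.+ j) ≤ δ s j)
    (inside : ∀ s → s₀ ℕ.≤ s → ∀ j → j ℕ.≤ stageLength s → fromℕ m * ∑ j (δ s) ≤ fromℕ j * h s + c s)
    (c-this : ∀ s → s₀ ℕ.≤ s → c s ≤ fromℕ (stageLength s) * h s)
    (c-next : ∀ s → s₀ ℕ.≤ s → c (suc s) ≤ fromℕ (stageLength s) * h s)
    where

    private
      M = fromℕ m
      H = stagewise h
      D = λ n → ∑ n d
      C = M * D (stageStart s₀)
      two = 1ℚ + 1ℚ

      0≤H : ∀ n → 0ℚ ≤ H n
      0≤H n = ∑-nonNeg n λ i → 0≤h (stage i)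

      extend : ∀ s → s₀ ℕ.≤ s → ∀ j → j ℕ.≤ stageLength s →
        M * D (stageStart s ℕ.+ j) ≤ M * D (stageStart s) + (fromℕ j * h s + c s)
      extend s s₀≤s j j≤L = begin
        M * D (stageStart s ℕ.+ j)                                        ≡⟨ cong (M *_) (∑-split (stageStart s) j d) ⟩
        M * (D (stageStart s) + ∑ j (λ i → d (stageStart s ℕ.+ i)))            ≡⟨ ℚₚ.*-distribˡ-+ M _ _ ⟩
        M * D (stageStart s) + M * ∑ j (λ i → d (stageStart s ℕ.+ i))          ≤⟨ ℚₚ.+-monoʳ-≤ (M * D (stageStart s)) (*-monoˡ-≤ M (fromℕ-nonNeg m)
                                                                         (∑-mono-≤ j λ i i<j → d≤δ s s₀≤s i (ℕₚ.<-≤-trans i<j j≤L))) ⟩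
        M * D (stageStart s) + M * ∑ j (δ s)                              ≤⟨ ℚₚ.+-monoʳ-≤ (M * D (stageStart s)) (inside s s₀≤s j j≤L) ⟩
        M * D (stageStart s) + (fromℕ j * h s + c s)                      ∎
        where open ℚₚ.≤-Reasoning

      at-start : ∀ {s} → s₀ ℕ.≤′ s → M * D (stageStart s) ≤ two * H (stageStart s) + C
      at-start ℕ.≤′-refl = p≡q+r⇒q≤p (ℚₚ.+-comm (two * H (stageStart s₀)) C)
        (*-nonNeg (ℚₚ.nonNegative⁻¹ two) (0≤H (stageStart s₀)))
      at-start (ℕ.≤′-step {s} s₀≤′s) = ℚₚ.≤-trans (extend s s₀≤s L ℕₚ.≤-refl)
        (subst (λ t → M * D (stageStart s) + (fromℕ L * h s + c s) ≤ two * t + C) (sym (stagewise-start h s L ℕₚ.≤-refl))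
          (p≡q+r⇒q≤p (cert (M * D (stageStart s)) (fromℕ L * h s) (c s) (H (stageStart s)) C)
            (+-nonNeg (p≤q⇒0≤q-p (at-start s₀≤′s)) (p≤q⇒0≤q-p (c-this s s₀≤s)))))
        where
        L = stageLength s
        s₀≤s = ℕₚ.≤′⇒≤ s₀≤′s
        cert : ∀ D w c H C → (1ℚ + 1ℚ) * (H + w) + C ≡ D + (w + c) + ((1ℚ + 1ℚ) * H + C - D + (w - c))
        cert = solve-∀ ℚ-ring

      after : ∀ s → suc s₀ ℕ.≤ s → ∀ j → j ℕ.< stageLength s →
        M * D (stageStart s ℕ.+ j) ≤ fromℕ 3 * H (stageStart s ℕ.+ j) + C
      after (suc s) (s≤s s₀≤s) j j<L = ℚₚ.≤-trans (extend (suc s) (ℕₚ.m≤n⇒m≤1+n s₀≤s) j (ℕₚ.<⇒≤ j<L))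
        (subst (λ t → M * D (stageStart (suc s)) + (fromℕ j * h (suc s) + c (suc s)) ≤ fromℕ 3 * t + C)
          (sym (stagewise-start h (suc s) j (ℕₚ.<⇒≤ j<L)))
          (p≡q+r⇒q≤p (cert (M * D (stageStart (suc s))) (fromℕ j * h (suc s)) (c (suc s)) (H (stageStart (suc s))) C)
            (+-nonNeg (p≤q⇒0≤q-p (at-start (ℕₚ.≤⇒≤′ (ℕₚ.m≤n⇒m≤1+n s₀≤s))))
              (+-nonNeg (p≤q⇒0≤q-p c≤H)
                (*-nonNeg (ℚₚ.nonNegative⁻¹ two) (*-nonNeg (fromℕ-nonNeg j) (0≤h (suc s))))))))
        where
        c≤H : c (suc s) ≤ H (stageStart (suc s))
        c≤H = ℚₚ.≤-trans (c-next s s₀≤s) (p≡q+r⇒q≤p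
          (trans (stagewise-start h s (stageLength s) ℕₚ.≤-refl) (ℚₚ.+-comm (H (stageStart s)) _)) (0≤H (stageStart s)))
        cert : ∀ D w c H C → (1ℚ + 1ℚ + 1ℚ) * (H + w) + C ≡
          D + (w + c) + ((1ℚ + 1ℚ) * H + C - D + (H - c + (1ℚ + 1ℚ) * w))
        cert = solve-∀ ℚ-ring

    conclusion : ∃ λ C → Eventually λ n → fromℕ m * ∑ n d ≤ fromℕ 3 * stagewise h n + C
    conclusion = C , stageStart (suc s₀) , λ n K≤n →
      subst (λ n → M * D n ≤ fromℕ 3 * H n + C) (sym (start+offset n .proj₁))
        (after (stage n) (start≤⇒≤stage K≤n) (offset n) (start+offset n .proj₂))

  module Periodic (p : ℕ) .{{_ : ℕ.NonZero p}} (φ : ℕ → ℚ) (0≤φ : ∀ i → 0ℚ ≤ φ i) where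

    private
      T = ∑ p φ
      f = λ j → φ (j % p)

      ∑-first : ∀ r → r ℕ.≤ p → ∑ r f ≡ ∑ r φ
      ∑-first r r≤p = ∑-cong-< r λ i i<r → cong φ (m<n⇒m%n≡m (ℕₚ.<-≤-trans i<r r≤p))

      ∑-periods : ∀ k r → r ℕ.≤ p → ∑ (k ℕ.* p ℕ.+ r) f ≡ fromℕ k * T + ∑ r φ
      ∑-periods zero r r≤p = trans (∑-first r r≤p)
        (trans (sym (ℚₚ.+-identityˡ (∑ r φ))) (cong (_+ ∑ r φ) (sym (ℚₚ.*-zeroˡ T))))
      ∑-periods (suc k) r r≤p = begin
        ∑ (p ℕ.+ k ℕ.* p ℕ.+ r) f                      ≡⟨ cong (λ j → ∑ j f) (ℕₚ.+-assoc p (k ℕ.* p) r) ⟩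
        ∑ (p ℕ.+ (k ℕ.* p ℕ.+ r)) f                    ≡⟨ ∑-split p (k ℕ.* p ℕ.+ r) f ⟩
        ∑ p f + ∑ (k ℕ.* p ℕ.+ r) (λ i → f (p ℕ.+ i))  ≡⟨ cong₂ _+_ (∑-first p ℕₚ.≤-refl) (∑-cong (k ℕ.* p ℕ.+ r)
                                                           λ i → cong φ (trans (cong (_% p) (ℕₚ.+-comm p i)) ([m+n]%n≡m%n i p))) ⟩
        T + ∑ (k ℕ.* p ℕ.+ r) f                        ≡⟨ cong (λ t → T + t) (∑-periods k r r≤p) ⟩
        T + (fromℕ k * T + ∑ r φ)                      ≡⟨ eq T (fromℕ k) (∑ r φ) ⟩
        (fromℕ k + 1ℚ) * T + ∑ r φ                     ≡⟨ cong (λ t → t * T + ∑ r φ) (fromℕ-suc k) ⟨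
        fromℕ (suc k) * T + ∑ r φ                      ∎
        where
        open ≡-Reasoning
        eq : ∀ T k r → T + (k * T + r) ≡ (k + 1ℚ) * T + r
        eq = solve-∀ ℚ-ring

      module _ (j : ℕ) where
        k = j / p
        r = j % p
        x = fromℕ j * recip p

        j≡ : j ≡ k ℕ.* p ℕ.+ r
        j≡ = trans (m≡m%n+[m/n]*n j p) (ℕₚ.+-comm r (k ℕ.* p))

        sum≡ : ∑ j f ≡ fromℕ k * T + ∑ r φ
        sum≡ = trans (cong (λ j → ∑ j f) j≡) (∑-periods k r (ℕₚ.<⇒≤ (m%n<n j p)))

        0≤T : 0ℚ ≤ T
        0≤T = ∑-nonNeg p 0≤φ

        k≤x : fromℕ k ≤ x
        k≤x = fromℕ≤-recip k j p (subst (k ℕ.* p ℕ.≤_) (sym j≡) (ℕₚ.m≤m+n (k ℕ.* p) r))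

        x≤1+k : x ≤ fromℕ k + 1ℚ
        x≤1+k = subst₂ _≤_ (ℚₚ.*-comm (recip p) (fromℕ j)) scaled (*-monoˡ-≤ (recip p) (recip-nonNeg p)
          (fromℕ-mono-≤ (begin
            j                 ≡⟨ j≡ ⟩
            k ℕ.* p ℕ.+ r     ≤⟨ ℕₚ.+-monoʳ-≤ (k ℕ.* p) (ℕₚ.<⇒≤ (m%n<n j p)) ⟩
            k ℕ.* p ℕ.+ p     ≡⟨ ℕₚ.+-comm (k ℕ.* p) p ⟩
            suc k ℕ.* p       ∎)))
          where
          open ℕₚ.≤-Reasoning
          eq : ∀ e k p → e * (k * p) ≡ k * (e * p)
          eq = solve-∀ ℚ-ring
          scaled : recip p * fromℕ (suc k ℕ.* p) ≡ fromℕ k + 1ℚ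
          scaled = trans (cong (recip p *_) (fromℕ-* (suc k) p)) (trans (eq (recip p) (fromℕ (suc k)) (fromℕ p))
            (trans (cong (fromℕ (suc k) *_) (recip-*-cancel p)) (trans (ℚₚ.*-identityʳ _) (fromℕ-suc k))))

    lower : ∀ j → ∑ p φ * (fromℕ j * recip p) - ∑ p φ ≤ ∑ j (λ i → φ (i % p))
    lower j = subst (T * x j - T ≤_) (sym (sum≡ j))
      (p≡q+r⇒q≤p (cert T (x j) (fromℕ (k j)) (∑ (r j) φ))
        (+-nonNeg (*-nonNeg (0≤T j) (p≤q⇒0≤q-p (x≤1+k j))) (∑-nonNeg (r j) 0≤φ)))
      where
      cert : ∀ T x k r → k * T + r ≡ T * x - T + (T * (k + 1ℚ - x) + r)
      cert = solve-∀ ℚ-ring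

    upper : ∀ j → ∑ j (λ i → φ (i % p)) ≤ ∑ p φ * (fromℕ j * recip p) + ∑ p φ
    upper j = subst (_≤ T * x j + T) (sym (sum≡ j))
      (p≡q+r⇒q≤p (cert T (x j) (fromℕ (k j)) (∑ (r j) φ))
        (+-nonNeg (*-nonNeg (0≤T j) (p≤q⇒0≤q-p (k≤x j)))
          (p≤q⇒0≤q-p (∑-mono-length 0≤φ (ℕₚ.<⇒≤ (m%n<n j p))))))
      where
      cert : ∀ T x k r → T * x + T ≡ k * T + r + (T * (x - k) + (T - r))
      cert = solve-∀ ℚ-ring

open Stages

module DigitSequence where
  open import Data.Nat.Base using (_+_; _*_; _≤_; _<_; _⊔_)
  open import Data.Nat.DivMod
  open import Data.Nat.Divisibility using (_∣_; divides-refl; m∣m*n; n∣m*n; n∣m⇒m%n≡0; ∣m⇒∣m*n)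
  import Data.Nat.Tactic.RingSolver as ℕ-Solver
  open import Data.List.Base using (List; length)
  open import Data.Vec.Base using (_∷_; toList)
  import Data.Vec.Properties as Vecₚ
  open import Relation.Nullary.Decidable using (_×-dec_)

  [i*g+t]/g : ∀ i {t g} .{{_ : ℕ.NonZero g}} → t < g → (i * g + t) / g ≡ i
  [i*g+t]/g i {t} {g} t<g = trans (+-distrib-/-∣ˡ t (divides-refl i))
    (trans (cong₂ _+_ (m*n/n≡m i g) (m<n⇒m/n≡0 t<g)) (ℕₚ.+-identityʳ i))

  [i*g+t]%g : ∀ i {t g} .{{_ : ℕ.NonZero g}} → t < g → (i * g + t) % g ≡ t
  [i*g+t]%g i {t} {g} t<g = trans (cong (_% g) (ℕₚ.+-comm (i * g) t))
    (trans ([m+kn]%n≡m%n t i g) (m<n⇒m%n≡m t<g))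

  suc-% : ∀ j p .{{_ : ℕ.NonZero p}} → suc (j % p) < p → suc j % p ≡ suc (j % p)
  suc-% j p h = trans (cong (λ n → suc n % p) (m≡m%n+[m/n]*n j p))
    (trans ([m+kn]%n≡m%n (suc (j % p)) (j / p) p) (m<n⇒m%n≡m h))

  instance
    base-nonZero : ∀ {s} → ℕ.NonZero (base s)
    base-nonZero {s} = subst ℕ.NonZero (sym (base-def s)) _

    period-NonZero : ∀ {s k} → ℕ.NonZero (period s k)
    period-NonZero {s} {k} = period-nonZero s k

  -- Columns below the cutoff form s slots of width s + 1; slot i is reserved
  -- for the word number i, and the other columns are filled uniformly.
  cutoff : ℕ → ℕ
  cutoff s = s * suc s

  cutoff<base : ∀ s → cutoff s < base s
  cutoff<base s = subst (cutoff s <_) (sym (base-def s))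
    (subst (cutoff s <_) (eq s) (s≤s (ℕₚ.m≤m+n (cutoff s) _)))
    where
    eq : ∀ s → suc (s * suc s + (7 + 11 * s + 5 * (s * s) + s * (s * s))) ≡ (2 + s) * ((2 + s) * (2 + s))
    eq = ℕ-Solver.solve-∀

  s<base : ∀ s → s < base s
  s<base s = ℕₚ.≤-<-trans (ℕₚ.m≤m*n s (suc s)) (cutoff<base s)

  base∣period-suc : ∀ s k → base s ∣ period s (suc k)
  base∣period-suc s k = subst (base s ∣_) (sym (period-suc s k))
    (∣m⇒∣m*n (period s k) (n∣m*n 2))

  base≤period-suc : ∀ s k → base s ≤ period s (suc k)
  base≤period-suc s k = subst (base s ≤_) (sym (period-suc s k))
    (ℕₚ.≤-trans (ℕₚ.m≤n*m (base s) 2) (ℕₚ.m≤m*n (2 * base s) (period s k)))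

  base∣stageLength : ∀ s → base s ∣ stageLength s
  base∣stageLength s = base∣period-suc s (suc s)

  -- Position j of stage s carries letter t of word i.
  Emits : ℕ → ℕ → ℕ → ℕ → Set
  Emits s j i t = i < s × t < length (word i) × j % period s (length (word i)) ≡ i * suc s + t

  emits? : ∀ s j i t → Dec (Emits s j i t)
  emits? s j i t = (i ℕₚ.<? s) ×-dec (t ℕₚ.<? length (word i)) ×-dec
    (j % period s (length (word i)) ℕₚ.≟ i * suc s + t)

  letterOr : ∀ {s j i t} → Dec (Emits s j i t) → ℕ → ℕ
  letterOr {i = i} {t} (yes _) _ = nth (word i) t
  letterOr             (no  _) f = f

  digitFrom : ℕ → ℕ → ℕ → ℕ → ℕ
  digitFrom s j i t = letterOr (emits? s j i t) (cutoff s ⊔ j % base s)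

  digit : ℕ → ℕ → ℕ
  digit s j = digitFrom s j (j % base s / suc s) (j % base s % suc s)

  emits-t<s : ∀ {s j i t} → Emits s j i t → t < s
  emits-t<s {i = i} (i<s , t<l , _) = ℕₚ.<-≤-trans t<l (ℕₚ.≤-trans (word-length i) i<s)

  emits-column<cutoff : ∀ {s j i t} → Emits s j i t → i * suc s + t < cutoff s
  emits-column<cutoff {s} {j} {i} {t} e@(i<s , _) = begin-strict
    i * suc s + t     <⟨ ℕₚ.+-monoʳ-< (i * suc s) (ℕₚ.m<n⇒m<1+n (emits-t<s {s} {j} {i} e)) ⟩
    i * suc s + suc s ≡⟨ ℕₚ.+-comm (i * suc s) (suc s) ⟩
    suc i * suc s     ≤⟨ ℕₚ.*-monoˡ-≤ (suc s) i<s ⟩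
    s * suc s         ∎
    where open ℕₚ.≤-Reasoning

  emits-column : ∀ {s j i t} → Emits s j i t → j % base s ≡ i * suc s + t
  emits-column {s} {j} {i} {t} e@(_ , t<l , eq) = go (length (word i)) t<l eq
    where
    go : ∀ l → t < l → j % period s l ≡ i * suc s + t → j % base s ≡ i * suc s + t
    go (suc l) _ eq = begin
      j % base s                      ≡⟨ m∣n⇒o%n%m≡o%m (base s) (period s (suc l)) j (base∣period-suc s l) ⟨
      j % period s (suc l) % base s   ≡⟨ cong (_% base s) eq ⟩
      (i * suc s + t) % base s        ≡⟨ m<n⇒m%n≡m (ℕₚ.<-trans (emits-column<cutoff {s} {j} e) (cutoff<base s)) ⟩
      i * suc s + t                   ∎
      where open ≡-Reasoning

  emits⇒digit : ∀ {s j i t} → Emits s j i t → digit s j ≡ nth (word i) t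
  emits⇒digit {s} {j} {i} {t} e = trans
    (cong₂ (digitFrom s j)
      (trans (cong (_/ suc s) (emits-column {s} {j} e)) ([i*g+t]/g i t<g))
      (trans (cong (_% suc s) (emits-column {s} {j} e)) ([i*g+t]%g i t<g)))
    pick
    where
    t<g = ℕₚ.m<n⇒m<1+n (emits-t<s {s} {j} {i} e)
    pick : digitFrom s j i t ≡ nth (word i) t
    pick with emits? s j i t
    ... | yes _  = refl
    ... | no  ¬e = contradiction e ¬e

  digit<cutoff⇒emits : ∀ s j → digit s j < cutoff s → ∃ λ i → ∃ λ t → Emits s j i t
  digit<cutoff⇒emits s j h with emits? s j (j % base s / suc s) (j % base s % suc s)
  ... | yes e = _ , _ , e
  ... | no  _ = contradiction h (ℕₚ.≤⇒≯ (ℕₚ.m≤m⊔n (cutoff s) (j % base s)))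

  filler : ∀ s j → cutoff s ≤ j % base s → digit s j ≡ j % base s
  filler s j h with emits? s j (j % base s / suc s) (j % base s % suc s)
  ... | yes e = contradiction h (ℕₚ.<⇒≱ (subst (_< cutoff s) (sym (emits-column {s} {j} e)) (emits-column<cutoff {s} {j} e)))
  ... | no  _ = ℕₚ.m≤n⇒m⊔n≡n h

  digit<base : ∀ s j → digit s j < base s
  digit<base s j with emits? s j (j % base s / suc s) (j % base s % suc s)
  ... | yes (i<s , _) = ℕₚ.≤-<-trans (word-nth (j % base s / suc s) (j % base s % suc s)) (ℕₚ.<-trans i<s (s<base s))
  ... | no  _         = ℕₚ.⊔-lub (cutoff<base s) (m%n<n j (base s))

  emits-step : ∀ {s j i t i′ t′} → Emits s j i t → Emits s (suc j) i′ t′ → i′ ≡ i × t′ ≡ suc t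
  emits-step {s} {j} {i} {t} {i′} {t′} e e′ =
      trans (sym ([i*g+t]/g i′ t′<g)) (trans (cong (_/ suc s) same) ([i*g+t]/g i (s≤s t<s)))
    , trans (sym ([i*g+t]%g i′ t′<g)) (trans (cong (_% suc s) same) ([i*g+t]%g i (s≤s t<s)))
    where
    t<s = emits-t<s {s} {j} {i} e
    t′<g = ℕₚ.m<n⇒m<1+n (emits-t<s {s} {suc j} {i′} e′)
    same : i′ * suc s + t′ ≡ i * suc s + suc t
    same = begin
      i′ * suc s + t′    ≡⟨ emits-column {s} {suc j} e′ ⟨
      suc j % base s     ≡⟨ suc-% j (base s) (ℕₚ.≤-<-trans
                              (subst (_< cutoff s) (sym (emits-column {s} {j} e)) (emits-column<cutoff {s} {j} e)) (cutoff<base s)) ⟩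
      suc (j % base s)   ≡⟨ cong suc (emits-column {s} {j} e) ⟩
      suc (i * suc s + t) ≡⟨ ℕₚ.+-suc (i * suc s) t ⟨
      i * suc s + suc t  ∎
      where open ≡-Reasoning

  emits-inside : ∀ {s j i t} → Emits s j i t → j < stageLength s → suc j < stageLength s
  emits-inside {s} {j} {i} {t} e j<L = ℕₚ.≤∧≢⇒< j<L λ eq → ℕₚ.1+n≢0 (begin
    suc (j % base s)          ≡⟨ suc-% j (base s) (ℕₚ.≤-<-trans
                                   (subst (_< cutoff s) (sym (emits-column {s} {j} e)) (emits-column<cutoff {s} {j} e)) (cutoff<base s)) ⟨
    suc j % base s            ≡⟨ cong (_% base s) eq ⟩
    stageLength s % base s    ≡⟨ n∣m⇒m%n≡0 (stageLength s) (base s) (base∣stageLength s) ⟩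
    0                         ∎)
    where open ≡-Reasoning

  emits-next : ∀ {s j i t} → Emits s j i t → suc t < length (word i) → Emits s (suc j) i (suc t)
  emits-next {s} {j} {i} {t} e@(i<s , t<l , eq) 1+t<l = i<s , 1+t<l ,
    trans (suc-% j p (subst (λ c → suc c < p) (sym eq) small))
      (trans (cong suc eq) (sym (ℕₚ.+-suc (i * suc s) t)))
    where
    p = period s (length (word i))
    base≤p : ∀ l → t < l → base s ≤ period s l
    base≤p (suc l) _ = base≤period-suc s l
    small : suc (i * suc s + t) < p
    small = ℕₚ.≤-<-trans (emits-column<cutoff {s} {j} e) (ℕₚ.<-≤-trans (cutoff<base s) (base≤p _ t<l))

  digitAt : ℕ → ℕ
  digitAt n = digit (stage n) (offset n)

  digitAt-start : ∀ s j → j < stageLength s → digitAt (stageStart s + j) ≡ digit s j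
  digitAt-start s j j<L = cong (λ (s , j) → digit s j) (locate-start s j j<L)

  digitAt-start-+ : ∀ s j u → j + u < stageLength s → digitAt (stageStart s + j + u) ≡ digit s (j + u)
  digitAt-start-+ s j u h = trans (cong digitAt (ℕₚ.+-assoc (stageStart s) j u)) (digitAt-start s (j + u) h)

  module Occurrences {k : ℕ} (B : Block (suc k)) where

    private
      letters : List ℕ
      letters = toList B

      indexOf : ∀ {k} (B : Block (suc k)) → ∃ λ b → word b ≡ toList B
      indexOf (a ∷ as) = index a (toList as) , word-index a (toList as)

      b : ℕ
      b = indexOf B .proj₁

      word-b : word b ≡ letters
      word-b = indexOf B .proj₂

      length-b : length (word b) ≡ suc k
      length-b = trans (cong length word-b) (Vecₚ.length-toList B)

    blockIndex : ℕ
    blockIndex = b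

    emitted⇒occurs : ∀ s j → j < stageLength s → b < s → j % period s (suc k) ≡ b * suc s →
      OccursAt B digitAt (stageStart s + j)
    emitted⇒occurs s j j<L b<s eq = nth⇒occursAt B digitAt (stageStart s + j) λ t t≤k →
        let (h , e) = emission t (subst (t <_) (sym length-b) t≤k) in
        trans (digitAt-start-+ s j t h)
          (trans (emits⇒digit {s} {j + t} e) (cong (λ w → nth w t) word-b))
      where
      emission : ∀ u → u < length (word b) → j + u < stageLength s × Emits s (j + u) b u
      emission zero    0<l = subst (λ j → j < stageLength s × Emits s j b 0) (sym (ℕₚ.+-identityʳ j))
        (j<L , b<s , 0<l , trans (cong (λ l → j % period s l) length-b) (trans eq (sym (ℕₚ.+-identityʳ (b * suc s)))))
      emission (suc u) u<l = let (h , e) = emission u (ℕₚ.<⇒≤ u<l) in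
        subst (λ j → j < stageLength s × Emits s j b (suc u)) (sym (ℕₚ.+-suc j u))
          (emits-inside {s} {j + u} {b} e h , emits-next {s} {j + u} {b} e u<l)

    occurs⇒ : ∀ s j → j < stageLength s → b < s → OccursAt B digitAt (stageStart s + j) →
      j % period s (suc k) ≡ b * suc s ⊎ j % period s (2 + k) < cutoff s
    occurs⇒ s j j<L b<s occ = conclude (digit<cutoff⇒emits s j (subst (_< cutoff s)
        (cong (digit s) (ℕₚ.+-identityʳ j)) (small 0 (s≤s z≤n) (subst (_< stageLength s) (sym (ℕₚ.+-identityʳ j)) j<L))))
      where
      letter : ∀ t → t < suc k → j + t < stageLength s → digit s (j + t) ≡ nth letters t
      letter t t≤k h = trans (sym (digitAt-start-+ s j t h))
        (occursAt⇒nth B digitAt (stageStart s + j) occ t t≤k)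
      small : ∀ t → t < suc k → j + t < stageLength s → digit s (j + t) < cutoff s
      small t t≤k h = subst (_< cutoff s) (sym (letter t t≤k h)) (ℕₚ.≤-<-trans
        (subst (λ w → nth w t ≤ b) word-b (word-nth b t)) (ℕₚ.<-≤-trans b<s (ℕₚ.m≤m*n s (suc s))))
      conclude : (∃ λ i → ∃ λ t → Emits s j i t) →
        j % period s (suc k) ≡ b * suc s ⊎ j % period s (2 + k) < cutoff s
      conclude (i , t , e) = decide (ℕₚ.m≤n⇒m<n∨m≡n k<l)
        where
        run : ∀ u → u < suc k → j + u < stageLength s × Emits s (j + u) i (t + u)
        run zero    _   = subst₂ (λ j t → j < stageLength s × Emits s j i t)
          (sym (ℕₚ.+-identityʳ j)) (sym (ℕₚ.+-identityʳ t)) (j<L , e)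
        run (suc u) u<k = subst₂ (λ j t → j < stageLength s × Emits s j i t)
            (sym (ℕₚ.+-suc j u)) (sym (ℕₚ.+-suc t u)) (h′ , e″)
          where
          prev = run u (ℕₚ.<⇒≤ u<k)
          h′ : suc (j + u) < stageLength s
          h′ = emits-inside {s} {j + u} {i} (prev .proj₂) (prev .proj₁)
          found = digit<cutoff⇒emits s (suc (j + u)) (subst (λ n → digit s n < cutoff s) (ℕₚ.+-suc j u)
            (small (suc u) u<k (subst (_< stageLength s) (sym (ℕₚ.+-suc j u)) h′)))
          same = emits-step {s} {j + u} {i} {t + u} (prev .proj₂) (found .proj₂ .proj₂)
          e″ : Emits s (suc (j + u)) i (suc (t + u))
          e″ = subst₂ (Emits s (suc (j + u))) (same .proj₁) (same .proj₂) (found .proj₂ .proj₂)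
        k<l : suc k ≤ length (word i)
        k<l = ℕₚ.≤-<-trans (ℕₚ.m≤n+m k t) (run k ℕₚ.≤-refl .proj₂ .proj₂ .proj₁)
        decide : suc k < length (word i) ⊎ suc k ≡ length (word i) →
          j % period s (suc k) ≡ b * suc s ⊎ j % period s (2 + k) < cutoff s
        decide (inj₁ k+1<l) = inj₂ (subst (_< cutoff s) (sym reduce) (emits-column<cutoff {s} {j} e))
          where
          p = period s (length (word i))
          divisor : period s (2 + k) ∣ p
          divisor = subst (λ l → period s (2 + k) ∣ period s l) (ℕₚ.m+[n∸m]≡n k+1<l)
            (subst (period s (2 + k) ∣_) (sym (period-+ s (2 + k) (length (word i) ℕ.∸ (2 + k))))
              (m∣m*n (period s (length (word i) ℕ.∸ (2 + k)))))
          small-column : i * suc s + t < period s (2 + k)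
          small-column = ℕₚ.<-≤-trans (ℕₚ.<-trans (emits-column<cutoff {s} {j} e) (cutoff<base s)) (base≤period-suc s (suc k))
          reduce : j % period s (2 + k) ≡ i * suc s + t
          reduce = trans (sym (m∣n⇒o%n%m≡o%m (period s (2 + k)) p j divisor))
            (trans (cong (_% period s (2 + k)) (e .proj₂ .proj₂)) (m<n⇒m%n≡m small-column))
        decide (inj₂ k+1≡l) = inj₁ (begin
            j % period s (suc k)             ≡⟨ cong (λ l → j % period s l) k+1≡l ⟩
            j % period s (length (word i))   ≡⟨ e .proj₂ .proj₂ ⟩
            i * suc s + t                    ≡⟨ cong₂ (λ i t → i * suc s + t) i≡b t≡0 ⟩
            b * suc s + 0                    ≡⟨ ℕₚ.+-identityʳ (b * suc s) ⟩
            b * suc s                        ∎)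
          where
          open ≡-Reasoning
          t≡0 : t ≡ 0
          t≡0 = ℕₚ.n≤0⇒n≡0 (ℕₚ.+-cancelʳ-≤ (suc k) t 0
            (subst₂ _≤_ (sym (ℕₚ.+-suc t k)) (sym k+1≡l) (run k ℕₚ.≤-refl .proj₂ .proj₂ .proj₁)))
          i≡b : i ≡ b
          i≡b = word-injective i b (nth-ext (word i) (word b) (trans (sym k+1≡l) (sym length-b))
            λ u u<l → let (h , e′) = run u (subst (u <_) (sym k+1≡l) u<l) in begin
              nth (word i) u         ≡⟨ cong (λ t → nth (word i) (t + u)) t≡0 ⟨
              nth (word i) (t + u)   ≡⟨ emits⇒digit {s} {j + u} e′ ⟨
              digit s (j + u)        ≡⟨ letter u (subst (u <_) (sym k+1≡l) u<l) h ⟩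
              nth letters u          ≡⟨ cong (λ w → nth w u) word-b ⟨
              nth (word b) u         ∎)

open DigitSequence

module Counting where
  open import Data.Rational.Base using (_+_; _*_; _-_; -_; _≤_; _<_)
  open import Data.Nat.DivMod using (_%_)
  import Data.Nat.Tactic.RingSolver as ℕ-Solver
  open import Data.List.Base using (List; []; _∷_; _++_; length; filter; upTo)
  import Data.List.Properties as Listₚ

  occurrences≡count : ∀ {k} (B : Block k) E n → occurrences B E n ≡ count (occursAt? B E) n
  occurrences≡count B E zero    = refl
  occurrences≡count B E (suc n) = begin
    fromℕ (length (filter P? (upTo (suc n))))                        ≡⟨ cong (λ l → fromℕ (length (filter P? l))) (Listₚ.upTo-∷ʳ n) ⟨
    fromℕ (length (filter P? (upTo n ++ n ∷ [])))     ≡⟨ cong (fromℕ ∘ length) (Listₚ.filter-++ P? (upTo n) (n ∷ [])) ⟩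
    fromℕ (length (filter P? (upTo n) ++ filter P? (n ∷ []))) ≡⟨ cong fromℕ (Listₚ.length-++ (filter P? (upTo n))) ⟩
    fromℕ (length (filter P? (upTo n)) ℕ.+ length (filter P? (n ∷ []))) ≡⟨ fromℕ-+ (length (filter P? (upTo n))) _ ⟩
    occurrences B E n + fromℕ (length (filter P? (n ∷ [])))          ≡⟨ cong₂ _+_ (occurrences≡count B E n) last ⟩
    count P? (suc n)                                                 ∎
    where
    open ≡-Reasoning
    P? = occursAt? B E
    last : fromℕ (length (filter P? (n ∷ []))) ≡ indicator (P? n)
    last with P? n
    ... | yes _ = refl
    ... | no  _ = refl

  base-≥ : ∀ s a {r} → a ℕ.+ r ≡ (2 ℕ.+ s) ℕ.* ((2 ℕ.+ s) ℕ.* (2 ℕ.+ s)) → a ℕ.≤ base s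
  base-≥ s a {r} eq = subst (a ℕ.≤_) (trans eq (sym (base-def s))) (ℕₚ.m≤m+n a r)

  s≤base : ∀ s → s ℕ.≤ base s
  s≤base s = ℕₚ.<⇒≤ (s<base s)

  2≤base : ∀ s → 2 ℕ.≤ base s
  2≤base s = base-≥ s 2 (eq s)
    where
    eq : ∀ s → 2 ℕ.+ (6 ℕ.+ 12 ℕ.* s ℕ.+ 6 ℕ.* (s ℕ.* s) ℕ.+ s ℕ.* (s ℕ.* s)) ≡ (2 ℕ.+ s) ℕ.* ((2 ℕ.+ s) ℕ.* (2 ℕ.+ s))
    eq = ℕ-Solver.solve-∀

  square≤base : ∀ s → s ℕ.* s ℕ.≤ base s
  square≤base s = base-≥ s (s ℕ.* s) (eq s)
    where
    eq : ∀ s → s ℕ.* s ℕ.+ (8 ℕ.+ 12 ℕ.* s ℕ.+ 5 ℕ.* (s ℕ.* s) ℕ.+ s ℕ.* (s ℕ.* s)) ≡ (2 ℕ.+ s) ℕ.* ((2 ℕ.+ s) ℕ.* (2 ℕ.+ s))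
    eq = ℕ-Solver.solve-∀

  s*[cutoff+2]≤base : ∀ s → s ℕ.* (cutoff s ℕ.+ 2) ℕ.≤ base s
  s*[cutoff+2]≤base s = base-≥ s (s ℕ.* (cutoff s ℕ.+ 2)) (eq s)
    where
    eq : ∀ s → s ℕ.* (s ℕ.* suc s ℕ.+ 2) ℕ.+ (8 ℕ.+ 10 ℕ.* s ℕ.+ 5 ℕ.* (s ℕ.* s)) ≡ (2 ℕ.+ s) ℕ.* ((2 ℕ.+ s) ℕ.* (2 ℕ.+ s))
    eq = ℕ-Solver.solve-∀

  s*[1+cutoff-suc]≤base : ∀ s → s ℕ.* suc (cutoff (suc s)) ℕ.≤ base s
  s*[1+cutoff-suc]≤base s = base-≥ s (s ℕ.* suc (cutoff (suc s))) (eq s)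
    where
    eq : ∀ s → s ℕ.* suc (suc s ℕ.* suc (suc s)) ℕ.+ (8 ℕ.+ 9 ℕ.* s ℕ.+ 3 ℕ.* (s ℕ.* s)) ≡ (2 ℕ.+ s) ℕ.* ((2 ℕ.+ s) ℕ.* (2 ℕ.+ s))
    eq = ℕ-Solver.solve-∀

  base-suc≤ : ∀ s → base (suc s) ℕ.≤ 4 ℕ.* base s
  base-suc≤ s = subst₂ ℕ._≤_ (sym (base-def (suc s))) (cong (4 ℕ.*_) (sym (base-def s)))
    (subst ((3 ℕ.+ s) ℕ.* ((3 ℕ.+ s) ℕ.* (3 ℕ.+ s)) ℕ.≤_) (eq s) (ℕₚ.m≤m+n _ _))
    where
    eq : ∀ s → (3 ℕ.+ s) ℕ.* ((3 ℕ.+ s) ℕ.* (3 ℕ.+ s)) ℕ.+ (5 ℕ.+ 21 ℕ.* s ℕ.+ 15 ℕ.* (s ℕ.* s) ℕ.+ 3 ℕ.* (s ℕ.* (s ℕ.* s)))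
      ≡ 4 ℕ.* ((2 ℕ.+ s) ℕ.* ((2 ℕ.+ s) ℕ.* (2 ℕ.+ s)))
    eq = ℕ-Solver.solve-∀

  base-mono : ∀ {s t} → s ℕ.≤ t → base s ℕ.≤ base t
  base-mono {s} {t} s≤t = subst₂ ℕ._≤_ (sym (base-def s)) (sym (base-def t))
    (ℕₚ.*-mono-≤ 2+s≤ (ℕₚ.*-mono-≤ 2+s≤ 2+s≤))
    where
    2+s≤ = ℕₚ.+-monoʳ-≤ 2 s≤t

  -- The frequency of each word of length k within a stage.
  weight : ℕ → ℕ → ℚ
  weight k s = recip (period s k)

  weight-nonNeg : ∀ k s → 0ℚ ≤ weight k s
  weight-nonNeg k s = recip-nonNeg (period s k)

  base≤[2base]² : ∀ s → base s ℕ.≤ 2 ℕ.* base s ℕ.* (2 ℕ.* base s)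
  base≤[2base]² s = ℕₚ.≤-trans (ℕₚ.m≤n*m (base s) 2)
    (ℕₚ.m≤m*n (2 ℕ.* base s) (2 ℕ.* base s) {{ℕₚ.m*n≢0 2 (base s)}})

  stage-weight : ∀ k s {a} → k ℕ.≤ s → a ℕ.≤ 2 ℕ.* base s ℕ.* (2 ℕ.* base s) →
    fromℕ a ≤ fromℕ (stageLength s) * weight k s
  stage-weight k s {a} k≤s a≤ = fromℕ≤-recip a (stageLength s) (period s k) (begin
    a ℕ.* period s k                                                       ≤⟨ ℕₚ.*-monoˡ-≤ (period s k) (ℕₚ.≤-trans a≤
                                                                                (ℕₚ.m≤m*n _ (period s (s ℕ.∸ k)))) ⟩
    2 ℕ.* base s ℕ.* (2 ℕ.* base s) ℕ.* period s (s ℕ.∸ k) ℕ.* period s k  ≡⟨ ℕₚ.*-assoc (2 ℕ.* base s ℕ.* (2 ℕ.* base s)) _ _ ⟩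
    2 ℕ.* base s ℕ.* (2 ℕ.* base s) ℕ.* (period s (s ℕ.∸ k) ℕ.* period s k) ≡⟨ cong (2 ℕ.* base s ℕ.* (2 ℕ.* base s) ℕ.*_)
                                                                                (trans (sym (period-+ s (s ℕ.∸ k) k)) (cong (period s) (ℕₚ.m∸n+n≡m k≤s))) ⟩
    2 ℕ.* base s ℕ.* (2 ℕ.* base s) ℕ.* period s s                         ≡⟨ ℕₚ.*-assoc (2 ℕ.* base s) (2 ℕ.* base s) (period s s) ⟩
    2 ℕ.* base s ℕ.* (2 ℕ.* base s ℕ.* period s s)                         ≡⟨ cong (2 ℕ.* base s ℕ.*_) (period-suc s s) ⟨
    2 ℕ.* base s ℕ.* period s (suc s)                                      ≡⟨ period-suc s (suc s) ⟨
    stageLength s                                                          ∎)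
    where open ℕₚ.≤-Reasoning

  expected : ℕ → ℕ → ℚ
  expected k = stagewise (weight k)

  expected⟶∞ : ∀ k → expected k ⟶∞
  expected⟶∞ k M = stageStart (k ℕ.+ i) , λ n K≤n → ℚₚ.<-≤-trans (archimedean M .proj₂)
      (ℚₚ.≤-trans (at-least i) (∑-mono-length (λ n → weight-nonNeg k (stage n)) K≤n))
    where
    i = archimedean M .proj₁
    at-least : ∀ i → fromℕ i ≤ expected k (stageStart (k ℕ.+ i))
    at-least zero    = ∑-nonNeg (stageStart (k ℕ.+ 0)) λ n → weight-nonNeg k (stage n)
    at-least (suc i) = subst₂ _≤_ (sym (fromℕ-suc i))
      (trans (sym (stagewise-start (weight k) s (stageLength s) ℕₚ.≤-refl)) (cong (λ t → expected k (stageStart t)) (sym (ℕₚ.+-suc k i))))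
      (ℚₚ.+-mono-≤ (at-least i) (stage-weight k s {1} (ℕₚ.m≤m+n k i)
        (ℕₚ.≤-trans (ℕₚ.≤-trans (ℕₚ.n≤1+n 1) (2≤base s)) (base≤[2base]² s))))
      where
      s = k ℕ.+ i

  narrow wide : BasicSequence
  narrow = record { q = λ n → base (stage n) ; q≥2 = λ n → 2≤base (stage n) }
  wide   = record { q = λ n → 2 ℕ.* base (stage n) ; q≥2 = λ n → ℕₚ.≤-trans (2≤base (stage n)) (ℕₚ.m≤n*m (base (stage n)) 2) }

  stage-+ : ∀ n i → stage n ℕ.≤ stage (n ℕ.+ i)
  stage-+ n i = start≤⇒≤stage (ℕₚ.≤-trans (ℕₚ.≤-trans
    (ℕₚ.m≤m+n (stageStart (stage n)) (offset n)) (ℕₚ.≤-reflexive (sym (start+offset n .proj₁)))) (ℕₚ.m≤m+n n i))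

  period≤∏ : ∀ n k → period (stage n) k ℕ.≤ ∏ wide n k
  period≤∏ n zero    = ℕₚ.≤-reflexive (period-zero (stage n))
  period≤∏ n (suc k) = subst (ℕ._≤ ∏ wide n (suc k))
    (trans (ℕₚ.*-comm (period (stage n) k) (2 ℕ.* base (stage n))) (sym (period-suc (stage n) k)))
    (ℕₚ.*-mono-≤ (period≤∏ n k) (ℕₚ.*-monoʳ-≤ 2 (base-mono (stage-+ n k))))

  ∏≡period : ∀ s j k → j ℕ.+ k ℕ.≤ stageLength s → ∏ wide (stageStart s ℕ.+ j) k ≡ period s k
  ∏≡period s j zero    _ = sym (period-zero s)
  ∏≡period s j (suc k) h = begin
    ∏ wide n k ℕ.* (2 ℕ.* base (stage (n ℕ.+ k)))   ≡⟨ cong₂ (λ p t → p ℕ.* (2 ℕ.* base t)) (∏≡period s j k (ℕₚ.<⇒≤ h′)) same ⟩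
    period s k ℕ.* (2 ℕ.* base s)                   ≡⟨ ℕₚ.*-comm (period s k) (2 ℕ.* base s) ⟩
    2 ℕ.* base s ℕ.* period s k                     ≡⟨ period-suc s k ⟨
    period s (suc k)                                ∎
    where
    open ≡-Reasoning
    n = stageStart s ℕ.+ j
    h′ : j ℕ.+ k ℕ.< stageLength s
    h′ = subst (ℕ._≤ stageLength s) (ℕₚ.+-suc j k) h
    same : stage (n ℕ.+ k) ≡ s
    same = trans (cong stage (ℕₚ.+-assoc (stageStart s) j k)) (stage-start s (j ℕ.+ k) h′)

  Qsum≤expected : ∀ k n → Qsum wide k n ≤ expected k n
  Qsum≤expected k n = ∑-mono-≤ n λ i _ →
    recip-anti {{period-NonZero}} {{∏-nonZero {wide} {i} {k}}} (period≤∏ i k)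

  expected-Qsum : ∀ k → Negligible (λ n → expected k n - Qsum wide k n) (expected k)
  expected-Qsum k m = let (C , ev) = conclusion in C , Eventually-map
      (λ n → subst (λ t → fromℕ m * t ≤ fromℕ 3 * expected k n + C)
        (∑-distrib-minus n (λ i → weight k (stage i)) (λ i → 1/∏ wide i k))) ev
    where
    s₀ = m ℕ.⊔ k
    δ : ℕ → ℕ → ℚ
    δ s j = indicator (stageLength s ℕₚ.<? j ℕ.+ k)
    weight≤1 : ∀ s → weight k s ≤ 1ℚ
    weight≤1 s = recip-anti {1} {period s k} (ℕ.>-nonZero⁻¹ (period s k))
    d≤δ : ∀ s → s₀ ℕ.≤ s → ∀ j → j ℕ.< stageLength s →
      weight k (stage (stageStart s ℕ.+ j)) - 1/∏ wide (stageStart s ℕ.+ j) k ≤ δ s j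
    d≤δ s _ j j<L with stageLength s ℕₚ.<? j ℕ.+ k
    ... | yes _   = p≡q+r⇒q≤p (cert (weight k (stage (stageStart s ℕ.+ j))) (1/∏ wide (stageStart s ℕ.+ j) k))
          (+-nonNeg (p≤q⇒0≤q-p (weight≤1 (stage (stageStart s ℕ.+ j)))) (ℚₚ.<⇒≤ (1/∏-pos wide (stageStart s ℕ.+ j) k)))
      where
      cert : ∀ w p → 1ℚ ≡ w - p + (1ℚ - w + p)
      cert = solve-∀ ℚ-ring
    ... | no  L≮ = ℚₚ.≤-reflexive (trans (cong₂ _-_ (cong (weight k) (stage-start s j j<L))
          (recip-cong {{∏-nonZero {wide} {stageStart s ℕ.+ j} {k}}} (∏≡period s j k (ℕₚ.≮⇒≥ L≮)))) (ℚₚ.+-inverseʳ (weight k s)))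
      where
      recip-cong : ∀ {a} .{{_ : ℕ.NonZero a}} → a ≡ period s k → recip a ≡ recip (period s k)
      recip-cong refl = refl
    ∑δ : ∀ s j → ∑ j (δ s) ≤ fromℕ (j ℕ.+ k ℕ.∸ stageLength s)
    ∑δ s zero    = fromℕ-nonNeg (k ℕ.∸ stageLength s)
    ∑δ s (suc j) with stageLength s ℕₚ.<? j ℕ.+ k
    ... | yes L< = ℚₚ.≤-trans (ℚₚ.+-monoˡ-≤ 1ℚ (∑δ s j)) (ℚₚ.≤-reflexive
          (trans (sym (fromℕ-suc (j ℕ.+ k ℕ.∸ stageLength s))) (cong fromℕ (sym (ℕₚ.+-∸-assoc 1 (ℕₚ.<⇒≤ L<))))))
    ... | no  _  = ℚₚ.≤-trans (ℚₚ.≤-reflexive (ℚₚ.+-identityʳ (∑ j (δ s))))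
          (ℚₚ.≤-trans (∑δ s j) (fromℕ-mono-≤ (ℕₚ.∸-monoˡ-≤ (stageLength s) (ℕₚ.n≤1+n (j ℕ.+ k)))))
    inside : ∀ s → s₀ ℕ.≤ s → ∀ j → j ℕ.≤ stageLength s →
      fromℕ m * ∑ j (δ s) ≤ fromℕ j * weight k s + fromℕ (m ℕ.* k)
    inside s _ j j≤L = begin
      fromℕ m * ∑ j (δ s)                        ≤⟨ *-monoˡ-≤ (fromℕ m) (fromℕ-nonNeg m) (∑δ s j) ⟩
      fromℕ m * fromℕ (j ℕ.+ k ℕ.∸ stageLength s) ≤⟨ *-monoˡ-≤ (fromℕ m) (fromℕ-nonNeg m) (fromℕ-mono-≤
                                                     (ℕₚ.m≤n+o⇒m∸n≤o (j ℕ.+ k) (stageLength s) (ℕₚ.+-monoˡ-≤ k j≤L))) ⟩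
      fromℕ m * fromℕ k                          ≡⟨ fromℕ-* m k ⟨
      fromℕ (m ℕ.* k)                            ≤⟨ p≡q+r⇒q≤p (ℚₚ.+-comm (fromℕ j * weight k s) (fromℕ (m ℕ.* k)))
                                                    (*-nonNeg (fromℕ-nonNeg j) (weight-nonNeg k s)) ⟩
      fromℕ j * weight k s + fromℕ (m ℕ.* k)     ∎
      where open ℚₚ.≤-Reasoning
    paid : ∀ s → s₀ ℕ.≤ s → fromℕ (m ℕ.* k) ≤ fromℕ (stageLength s) * weight k s
    paid s s₀≤s = stage-weight k s (ℕₚ.m⊔n≤o⇒n≤o m k s₀≤s) (ℕₚ.≤-trans
      (ℕₚ.*-mono-≤ (ℕₚ.m⊔n≤o⇒m≤o m k s₀≤s) (ℕₚ.m⊔n≤o⇒n≤o m k s₀≤s)) (ℕₚ.≤-trans (square≤base s) (base≤[2base]² s)))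
    open StageLemma m s₀ (λ n → weight k (stage n) - 1/∏ wide n k) δ (weight k) (λ _ → fromℕ (m ℕ.* k))
      (weight-nonNeg k) d≤δ inside paid paid

  expected≲Qsum : ∀ k → expected k ≲ Qsum wide k
  expected≲Qsum k = negligible⇒≳ (expected⟶∞ k) (expected-Qsum k)

  Qsum≲expected : ∀ k → Qsum wide k ≲ expected k
  Qsum≲expected k m = 0 , λ n _ → subst (λ c → fromℕ m * Qsum wide k n ≤ c * expected k n) (sym (fromℕ-suc m))
    (p≡q+r⇒q≤p (cert (fromℕ m) (Qsum wide k n) (expected k n))
      (+-nonNeg (*-nonNeg (fromℕ-nonNeg m) (p≤q⇒0≤q-p (Qsum≤expected k n)))
        (∑-nonNeg n λ i → weight-nonNeg k (stage i))))
    where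
    cert : ∀ M q e → (M + 1ℚ) * e ≡ M * q + (M * (e - q) + e)
    cert = solve-∀ ℚ-ring

  Qsum-wide⟶∞ : ∀ k → Qsum wide k ⟶∞
  Qsum-wide⟶∞ k M = Eventually-map step (Eventually-∩ (expected≲Qsum k 1) (expected⟶∞ k (fromℕ 2 * M)))
    where
    step : ∀ n → (fromℕ 1 * expected k n ≤ fromℕ 2 * Qsum wide k n) × fromℕ 2 * M < expected k n → M < Qsum wide k n
    step n (h₁ , h₂) = ℚₚ.*-cancelˡ-<-nonNeg (fromℕ 2) (ℚₚ.<-≤-trans h₂
      (subst (_≤ fromℕ 2 * Qsum wide k n) (ℚₚ.*-identityˡ (expected k n)) h₁))

  ∑-indicator-≡ : ∀ c n → ∑ n (λ r → indicator (r ℕₚ.≟ c)) ≡ indicator (c ℕₚ.<? n)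
  ∑-indicator-≡ c zero = refl
  ∑-indicator-≡ c (suc n) rewrite ∑-indicator-≡ c n with c ℕₚ.<? n | n ℕₚ.≟ c | c ℕₚ.<? suc n
  ... | yes c<n | yes n≡c | _        = contradiction c<n (ℕₚ.<-irrefl (sym n≡c))
  ... | yes c<n | no  _   | yes _    = refl
  ... | yes c<n | no  _   | no c≮1+n = contradiction (ℕₚ.m<n⇒m<1+n c<n) c≮1+n
  ... | no  _   | yes _   | yes _    = refl
  ... | no  _   | yes n≡c | no c≮1+n = contradiction (s≤s (ℕₚ.≤-reflexive (sym n≡c))) c≮1+n
  ... | no  c≮n | no  n≢c | yes c<1+n = contradiction (ℕₚ.≤∧≢⇒< (ℕₚ.≤-pred c<1+n) (n≢c ∘ sym)) c≮n
  ... | no  _   | no  _   | no  _    = refl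

  ∑-indicator-< : ∀ c n → ∑ n (λ r → indicator (r ℕₚ.<? c)) ≤ fromℕ c
  ∑-indicator-< c n = ℚₚ.≤-trans (go n) (fromℕ-mono-≤ (ℕₚ.m⊓n≤n n c))
    where
    go : ∀ n → ∑ n (λ r → indicator (r ℕₚ.<? c)) ≤ fromℕ (n ℕ.⊓ c)
    go zero    = ℚₚ.≤-refl
    go (suc n) with n ℕₚ.<? c
    ... | yes n<c = ℚₚ.≤-trans (ℚₚ.+-monoˡ-≤ 1ℚ (go n)) (ℚₚ.≤-reflexive (trans (sym (fromℕ-suc (n ℕ.⊓ c)))
          (cong fromℕ (trans (cong suc (ℕₚ.m≤n⇒m⊓n≡m (ℕₚ.<⇒≤ n<c))) (sym (ℕₚ.m≤n⇒m⊓n≡m n<c))))))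
    ... | no  _   = ℚₚ.≤-trans (ℚₚ.≤-reflexive (ℚₚ.+-identityʳ _))
          (ℚₚ.≤-trans (go n) (fromℕ-mono-≤ (ℕₚ.⊓-monoˡ-≤ c (ℕₚ.n≤1+n n))))

  module BlockCount {k′ : ℕ} (B : Block (suc k′)) where
    open Occurrences B

    private
      k = suc k′
      b = blockIndex
      w = weight k

      hits : ℕ → ℚ
      hits = count (occursAt? B digitAt)

      slot : ℕ → ℕ
      slot s = b ℕ.* suc s

      slot<period : ∀ s → b ℕ.< s → slot s ℕ.< period s k
      slot<period s b<s = ℕₚ.≤-<-trans (ℕₚ.*-monoˡ-≤ (suc s) (ℕₚ.<⇒≤ b<s))
        (ℕₚ.<-≤-trans (cutoff<base s) (base≤period-suc s k′))

      emission : ℕ → ℕ → ℚ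
      emission s r = indicator (r ℕₚ.≟ slot s)

      longer : ℕ → ℕ → ℚ
      longer s r = indicator (r ℕₚ.<? cutoff s)

      module Emission s = Periodic (period s k) (emission s) (λ r → indicator-nonNeg (r ℕₚ.≟ slot s))
      module Longer s = Periodic (period s (suc k)) (longer s) (λ r → indicator-nonNeg (r ℕₚ.<? cutoff s))

      ∑emission≡1 : ∀ s → b ℕ.< s → ∑ (period s k) (emission s) ≡ 1ℚ
      ∑emission≡1 s b<s = trans (∑-indicator-≡ (slot s) (period s k))
        (indicator-true (slot s ℕₚ.<? period s k) (slot<period s b<s))

      δ⁺ δ⁻ : ℕ → ℕ → ℚ
      δ⁺ s j = emission s (j % period s k) + longer s (j % period s (suc k)) - w s
      δ⁻ s j = w s - emission s (j % period s k)

      stage-weight≡ : ∀ s j → j ℕ.< stageLength s → w (stage (stageStart s ℕ.+ j)) ≡ w s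
      stage-weight≡ s j j<L = cong w (stage-start s j j<L)

      hit≤ : ∀ s j → j ℕ.< stageLength s → b ℕ.< s →
        indicator (occursAt? B digitAt (stageStart s ℕ.+ j)) ≤ emission s (j % period s k) + longer s (j % period s (suc k))
      hit≤ s j j<L b<s = indicator-⊎ (occursAt? B digitAt (stageStart s ℕ.+ j))
        (j % period s k ℕₚ.≟ slot s) (j % period s (suc k) ℕₚ.<? cutoff s) (occurs⇒ s j j<L b<s)

      hit≥ : ∀ s j → j ℕ.< stageLength s → b ℕ.< s →
        emission s (j % period s k) ≤ indicator (occursAt? B digitAt (stageStart s ℕ.+ j))
      hit≥ s j j<L b<s = indicator-mono (j % period s k ℕₚ.≟ slot s)
        (occursAt? B digitAt (stageStart s ℕ.+ j)) (emitted⇒occurs s j j<L b<s)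

      weight-suc : ∀ s → fromℕ (2 ℕ.* base s) * weight (suc k) s ≡ w s
      weight-suc s = *-cancelʳ-fromℕ (period s k) (begin
        fromℕ (2 ℕ.* base s) * weight (suc k) s * fromℕ (period s k)   ≡⟨ eq (fromℕ (2 ℕ.* base s)) (weight (suc k) s) (fromℕ (period s k)) ⟩
        weight (suc k) s * (fromℕ (2 ℕ.* base s) * fromℕ (period s k)) ≡⟨ cong (weight (suc k) s *_)
                                                                           (trans (sym (fromℕ-* (2 ℕ.* base s) (period s k))) (cong fromℕ (sym (period-suc s k)))) ⟩
        weight (suc k) s * fromℕ (period s (suc k))                    ≡⟨ recip-*-cancel (period s (suc k)) ⟩
        1ℚ                                                             ≡⟨ recip-*-cancel (period s k) ⟨
        w s * fromℕ (period s k)                                       ∎)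
        where
        open ≡-Reasoning
        eq : ∀ a b c → a * b * c ≡ b * (a * c)
        eq = solve-∀ ℚ-ring

    occurrences-expected : Negligible (λ n → hits n - expected k n) (expected k)
    occurrences-expected m = let (C , ev) = conclusion in C , Eventually-map
        (λ n → subst (λ t → fromℕ m * t ≤ fromℕ 3 * expected k n + C)
          (∑-distrib-minus n (λ i → indicator (occursAt? B digitAt i)) (λ i → w (stage i)))) ev
      where
      s₀ = m ℕ.⊔ (k ℕ.⊔ suc b)
      m≤ : ∀ {s} → s₀ ℕ.≤ s → m ℕ.≤ s
      m≤ = ℕₚ.m⊔n≤o⇒m≤o m (k ℕ.⊔ suc b)
      k≤ : ∀ {s} → s₀ ℕ.≤ s → k ℕ.≤ s
      k≤ s₀≤s = ℕₚ.m⊔n≤o⇒m≤o k (suc b) (ℕₚ.m⊔n≤o⇒n≤o m (k ℕ.⊔ suc b) s₀≤s)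
      b< : ∀ {s} → s₀ ℕ.≤ s → b ℕ.< s
      b< s₀≤s = ℕₚ.m⊔n≤o⇒n≤o k (suc b) (ℕₚ.m⊔n≤o⇒n≤o m (k ℕ.⊔ suc b) s₀≤s)
      d≤δ : ∀ s → s₀ ℕ.≤ s → ∀ j → j ℕ.< stageLength s →
        indicator (occursAt? B digitAt (stageStart s ℕ.+ j)) - w (stage (stageStart s ℕ.+ j)) ≤ δ⁺ s j
      d≤δ s s₀≤s j j<L = ℚₚ.+-mono-≤ (hit≤ s j j<L (b< s₀≤s)) (ℚₚ.≤-reflexive (cong -_ (stage-weight≡ s j j<L)))
      c : ℕ → ℚ
      c s = fromℕ (m ℕ.* suc (cutoff s))
      inside : ∀ s → s₀ ℕ.≤ s → ∀ j → j ℕ.≤ stageLength s → fromℕ m * ∑ j (δ⁺ s) ≤ fromℕ j * w s + c s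
      inside s s₀≤s j _ = subst₂ (λ t u → M * t ≤ fromℕ j * w s + u) (sym ∑δ) (sym c≡)
        (p≡q+r⇒q≤p
          (trans (cong (λ t → fromℕ j * t + M * (cut + 1ℚ)) (sym (weight-suc s)))
            (trans (cert M (fromℕ j) (fromℕ (2 ℕ.* base s)) (weight (suc k) s) S₁ S₂ cut T₂)
              (cong (λ t → M * (S₁ + S₂ - fromℕ j * t)
                + (M * (1ℚ * (fromℕ j * t) + 1ℚ - S₁)
                  + (M * (T₂ * (fromℕ j * weight (suc k) s) + T₂ - S₂)
                  + (M * ((fromℕ j * weight (suc k) s + 1ℚ) * (cut - T₂))
                  + fromℕ j * weight (suc k) s * (fromℕ (2 ℕ.* base s) - M * cut))))) (weight-suc s))))
          (+-nonNeg (*-nonNeg 0≤M (p≤q⇒0≤q-p (subst (λ T → S₁ ≤ T * (fromℕ j * w s) + T) (∑emission≡1 s (b< s₀≤s)) (Emission.upper s j))))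
            (+-nonNeg (*-nonNeg 0≤M (p≤q⇒0≤q-p (Longer.upper s j)))
              (+-nonNeg (*-nonNeg 0≤M (*-nonNeg (+-nonNeg 0≤jw 0≤1) (p≤q⇒0≤q-p (∑-indicator-< (cutoff s) (period s (suc k))))))
                (*-nonNeg 0≤jw (p≤q⇒0≤q-p (subst (_≤ fromℕ (2 ℕ.* base s)) (fromℕ-* m (cutoff s)) (fromℕ-mono-≤ m*cut≤))))))))
        where
        M = fromℕ m
        0≤M = fromℕ-nonNeg m
        cut = fromℕ (cutoff s)
        S₁ = ∑ j (λ i → emission s (i % period s k))
        S₂ = ∑ j (λ i → longer s (i % period s (suc k)))
        T₂ = ∑ (period s (suc k)) (longer s)
        0≤jw : 0ℚ ≤ fromℕ j * weight (suc k) s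
        0≤jw = *-nonNeg (fromℕ-nonNeg j) (weight-nonNeg (suc k) s)
        m*cut≤ : m ℕ.* cutoff s ℕ.≤ 2 ℕ.* base s
        m*cut≤ = ℕₚ.≤-trans (ℕₚ.*-mono-≤ (m≤ s₀≤s) (ℕₚ.m≤m+n (cutoff s) 2))
          (ℕₚ.≤-trans (s*[cutoff+2]≤base s) (ℕₚ.m≤n*m (base s) 2))
        ∑δ : ∑ j (δ⁺ s) ≡ S₁ + S₂ - fromℕ j * w s
        ∑δ = trans (∑-distrib-minus j (λ i → emission s (i % period s k) + longer s (i % period s (suc k))) (λ _ → w s))
          (cong₂ _-_ (∑-distrib-+ j (λ i → emission s (i % period s k)) (λ i → longer s (i % period s (suc k)))) (∑-const j (w s)))
        c≡ : c s ≡ M * (cut + 1ℚ)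
        c≡ = trans (fromℕ-* m (suc (cutoff s))) (cong (M *_) (fromℕ-suc (cutoff s)))
        cert : ∀ M j B v S₁ S₂ c T₂ → j * (B * v) + M * (c + 1ℚ) ≡ M * (S₁ + S₂ - j * (B * v))
          + (M * (1ℚ * (j * (B * v)) + 1ℚ - S₁) + (M * (T₂ * (j * v) + T₂ - S₂)
          + (M * ((j * v + 1ℚ) * (c - T₂)) + j * v * (B - M * c))))
        cert = solve-∀ ℚ-ring
      this : ∀ s → s₀ ℕ.≤ s → c s ≤ fromℕ (stageLength s) * w s
      this s s₀≤s = stage-weight k s (k≤ s₀≤s) (ℕₚ.≤-trans
        (ℕₚ.*-mono-≤ (m≤ s₀≤s) (ℕₚ.≤-trans (ℕₚ.n≤1+n (suc (cutoff s))) (ℕₚ.≤-reflexive (ℕₚ.+-comm 2 (cutoff s)))))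
        (ℕₚ.≤-trans (s*[cutoff+2]≤base s) (base≤[2base]² s)))
      following : ∀ s → s₀ ℕ.≤ s → c (suc s) ≤ fromℕ (stageLength s) * w s
      following s s₀≤s = stage-weight k s (k≤ s₀≤s) (ℕₚ.≤-trans
        (ℕₚ.*-monoˡ-≤ (suc (cutoff (suc s))) (m≤ s₀≤s)) (ℕₚ.≤-trans (s*[1+cutoff-suc]≤base s) (base≤[2base]² s)))
      open StageLemma m s₀ (λ n → indicator (occursAt? B digitAt n) - w (stage n)) δ⁺ w c
        (weight-nonNeg k) d≤δ inside this following

    expected-occurrences : Negligible (λ n → expected k n - hits n) (expected k)
    expected-occurrences m = let (C , ev) = conclusion in C , Eventually-map
        (λ n → subst (λ t → fromℕ m * t ≤ fromℕ 3 * expected k n + C)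
          (∑-distrib-minus n (λ i → w (stage i)) (λ i → indicator (occursAt? B digitAt i)))) ev
      where
      s₀ = m ℕ.⊔ (k ℕ.⊔ suc b)
      b< : ∀ {s} → s₀ ℕ.≤ s → b ℕ.< s
      b< s₀≤s = ℕₚ.m⊔n≤o⇒n≤o k (suc b) (ℕₚ.m⊔n≤o⇒n≤o m (k ℕ.⊔ suc b) s₀≤s)
      d≤δ : ∀ s → s₀ ℕ.≤ s → ∀ j → j ℕ.< stageLength s →
        w (stage (stageStart s ℕ.+ j)) - indicator (occursAt? B digitAt (stageStart s ℕ.+ j)) ≤ δ⁻ s j
      d≤δ s s₀≤s j j<L = ℚₚ.+-mono-≤ (ℚₚ.≤-reflexive (stage-weight≡ s j j<L)) (ℚₚ.neg-antimono-≤ (hit≥ s j j<L (b< s₀≤s)))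
      inside : ∀ s → s₀ ℕ.≤ s → ∀ j → j ℕ.≤ stageLength s → fromℕ m * ∑ j (δ⁻ s) ≤ fromℕ j * w s + fromℕ m
      inside s s₀≤s j _ = subst (λ t → M * t ≤ fromℕ j * w s + M) (sym ∑δ)
        (p≡q+r⇒q≤p (cert M (fromℕ j * w s) S)
          (+-nonNeg (*-nonNeg (fromℕ-nonNeg m) (p≤q⇒0≤q-p (subst (λ T → T * (fromℕ j * w s) - T ≤ S) (∑emission≡1 s (b< s₀≤s)) (Emission.lower s j))))
            (*-nonNeg (fromℕ-nonNeg j) (weight-nonNeg k s))))
        where
        M = fromℕ m
        S = ∑ j (λ i → emission s (i % period s k))
        ∑δ : ∑ j (δ⁻ s) ≡ fromℕ j * w s - S
        ∑δ = trans (∑-distrib-minus j (λ _ → w s) (λ i → emission s (i % period s k))) (cong (_- S) (∑-const j (w s)))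
        cert : ∀ M x S → x + M ≡ M * (x - S) + (M * (S - (1ℚ * x - 1ℚ)) + x)
        cert = solve-∀ ℚ-ring
      paid : ∀ s → s₀ ℕ.≤ s → fromℕ m ≤ fromℕ (stageLength s) * w s
      paid s s₀≤s = stage-weight k s (ℕₚ.m⊔n≤o⇒m≤o k (suc b) (ℕₚ.m⊔n≤o⇒n≤o m (k ℕ.⊔ suc b) s₀≤s))
        (ℕₚ.≤-trans (ℕₚ.m⊔n≤o⇒m≤o m (k ℕ.⊔ suc b) s₀≤s) (ℕₚ.≤-trans (s≤base s) (base≤[2base]² s)))
      open StageLemma m s₀ (λ n → w (stage n) - indicator (occursAt? B digitAt n)) δ⁻ w (λ _ → fromℕ m)
        (weight-nonNeg k) d≤δ inside paid paid

    occurrences≲expected : occurrences B digitAt ≲ expected k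
    occurrences≲expected m = Eventually-map
      (λ n → subst (λ t → fromℕ m * t ≤ fromℕ (suc m) * expected k n) (sym (occurrences≡count B digitAt n)))
      (negligible⇒≲ (expected⟶∞ k) occurrences-expected m)

    expected≲occurrences : expected k ≲ occurrences B digitAt
    expected≲occurrences m = Eventually-map
      (λ n → subst (λ t → fromℕ m * expected k n ≤ fromℕ (suc m) * t) (sym (occurrences≡count B digitAt n)))
      (negligible⇒≳ (expected⟶∞ k) expected-occurrences m)

open Counting

module UniformFiller where
  open import Data.Rational.Base using (_+_; _*_; _-_; -_; _≤_; _<_)
  open import Data.Nat.DivMod using (_%_)
  import Data.Nat.Tactic.RingSolver as ℕ-Solver
  open import Relation.Nullary.Decidable using (_×-dec_)

  module _ (u v : ℚ) (0≤u : 0ℚ ≤ u) (v≤1 : v ≤ 1ℚ) (s : ℕ) where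

    private
      b = fromℕ (base s)
      β = recip (base s)
      cut = fromℕ (cutoff s)
      loss = u * b + (cut + 1ℚ)

    Good : ℕ → Set
    Good r = cutoff s ℕ.≤ r × u ≤ fromℕ r * β × fromℕ (suc r) * β ≤ v

    good? : ∀ r → Dec (Good r)
    good? r = (cutoff s ℕₚ.≤? r) ×-dec (u ℚₚ.≤? fromℕ r * β) ×-dec (fromℕ (suc r) * β ℚₚ.≤? v)

    private
      *β*b : ∀ x → x * β * b ≡ x
      *β*b x = trans (ℚₚ.*-assoc x β b) (trans (cong (x *_) (recip-*-cancel (base s))) (ℚₚ.*-identityʳ x))

      0≤b : 0ℚ ≤ b
      0≤b = fromℕ-nonNeg (base s)

      0≤ub : 0ℚ ≤ u * b
      0≤ub = *-nonNeg 0≤u 0≤b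

      0≤cut : 0ℚ ≤ cut
      0≤cut = fromℕ-nonNeg (cutoff s)

      0≤loss : 0ℚ ≤ loss
      0≤loss = +-nonNeg 0≤ub (+-nonNeg 0≤cut 0≤1)

      0≤count : ∀ ρ → 0ℚ ≤ count good? ρ
      0≤count ρ = ∑-nonNeg ρ λ r → indicator-nonNeg (good? r)

      bad⇒≤loss : ∀ r → fromℕ (suc r) ≤ v * b → ¬ Good r → fromℕ (suc r) ≤ loss
      bad⇒≤loss r r<vb ¬good with cutoff s ℕₚ.≤? r
      ... | no  cut≰r = p≡q+r⇒q≤p (cert (u * b) cut (fromℕ (suc r)))
            (+-nonNeg (p≤q⇒0≤q-p (fromℕ-mono-≤ (ℕₚ.≰⇒> cut≰r))) (+-nonNeg 0≤ub 0≤1))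
            where
            cert : ∀ x c r → x + (c + 1ℚ) ≡ r + (c - r + (x + 1ℚ))
            cert = solve-∀ ℚ-ring
      ... | yes cut≤r = p≡q+r⇒q≤p (trans (cert (u * b) cut (fromℕ r)) (cong (_+ (u * b - fromℕ r + cut)) (sym (fromℕ-suc r))))
            (+-nonNeg (p≤q⇒0≤q-p r≤ub) 0≤cut)
            where
            cert : ∀ x c r → x + (c + 1ℚ) ≡ r + 1ℚ + (x - r + c)
            cert = solve-∀ ℚ-ring
            high≤v : fromℕ (suc r) * β ≤ v
            high≤v = *-cancelˡ-≤ b (fromℕ-nonZero⇒pos (base s)) (subst₂ _≤_
              (trans (sym (*β*b (fromℕ (suc r)))) (ℚₚ.*-comm (fromℕ (suc r) * β) b)) (ℚₚ.*-comm v b) r<vb)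
            r≤ub : fromℕ r ≤ u * b
            r≤ub = subst₂ _≤_ (trans (ℚₚ.*-comm b (fromℕ r * β)) (*β*b (fromℕ r))) (ℚₚ.*-comm b u)
              (*-monoˡ-≤ b 0≤b (ℚₚ.<⇒≤ (ℚₚ.≰⇒> λ u≤low → ¬good (cut≤r , u≤low , high≤v))))

      count-initial : ∀ ρ → fromℕ ρ ≤ v * b → fromℕ ρ - loss ≤ count good? ρ
      count-initial zero    _ = p≡q+r⇒q≤p (cert loss) 0≤loss
        where
        cert : ∀ l → 0ℚ ≡ 0ℚ - l + l
        cert = solve-∀ ℚ-ring
      count-initial (suc r) r<vb = step (good? r)
        where
        cert₁ : ∀ r l c → c + 1ℚ ≡ r + 1ℚ - l + (c - (r - l))
        cert₁ = solve-∀ ℚ-ring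
        cert₂ : ∀ r l c → c + 0ℚ ≡ r - l + (l - r + c)
        cert₂ = solve-∀ ℚ-ring
        step : (good-r? : Dec (Good r)) → fromℕ (suc r) - loss ≤ count good? r + indicator good-r?
        step (yes _) = subst (λ t → t - loss ≤ count good? r + 1ℚ) (sym (fromℕ-suc r))
          (p≡q+r⇒q≤p (cert₁ (fromℕ r) loss (count good? r)) (p≤q⇒0≤q-p (count-initial r
            (ℚₚ.≤-trans (fromℕ-mono-≤ (ℕₚ.n≤1+n r)) r<vb))))
        step (no ¬g) = p≡q+r⇒q≤p (cert₂ (fromℕ (suc r)) loss (count good? r))
          (+-nonNeg (p≤q⇒0≤q-p (bad⇒≤loss r r<vb ¬g)) (0≤count r))

      count-final : ∀ ρ → v * b - 1ℚ ≤ fromℕ ρ → v * b - 1ℚ - loss ≤ count good? ρ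
      count-final zero    h = p≡q+r⇒q≤p (cert (v * b) loss) (+-nonNeg (p≤q⇒0≤q-p h) 0≤loss)
        where
        cert : ∀ x l → 0ℚ ≡ x - 1ℚ - l + (0ℚ - (x - 1ℚ) + l)
        cert = solve-∀ ℚ-ring
      count-final (suc r) h = step (fromℕ (suc r) ℚₚ.≤? v * b)
        where
        cert : ∀ r x → r ≡ x - 1ℚ + (r + 1ℚ - x)
        cert = solve-∀ ℚ-ring
        step : Dec (fromℕ (suc r) ≤ v * b) → v * b - 1ℚ - loss ≤ count good? (suc r)
        step (yes r<vb) = ℚₚ.≤-trans (ℚₚ.+-monoˡ-≤ (- loss) h) (count-initial (suc r) r<vb)
        step (no  r≮vb) = ℚₚ.≤-trans
          (count-final r (p≡q+r⇒q≤p (cert (fromℕ r) (v * b))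
            (p≤q⇒0≤q-p (subst (v * b ≤_) (fromℕ-suc r) (ℚₚ.<⇒≤ (ℚₚ.≰⇒> r≮vb))))))
          (p≡q+r⇒q≤p refl (indicator-nonNeg (good? r)))

    count-good-≥ : (v - u) * b - (cut + (1ℚ + 1ℚ)) ≤ count good? (base s)
    count-good-≥ = subst (_≤ count good? (base s)) (cert u v b cut)
      (count-final (base s) (p≡q+r⇒q≤p (cert′ v b)
        (+-nonNeg (*-nonNeg (p≤q⇒0≤q-p v≤1) 0≤b) 0≤1)))
      where
      cert : ∀ u v b c → v * b - 1ℚ - (u * b + (c + 1ℚ)) ≡ (v - u) * b - (c + (1ℚ + 1ℚ))
      cert = solve-∀ ℚ-ring
      cert′ : ∀ v b → b ≡ v * b - 1ℚ + ((1ℚ - v) * b + 1ℚ)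
      cert′ = solve-∀ ℚ-ring

    count-good-≤ : count good? (base s) ≤ b
    count-good-≤ = ℚₚ.≤-trans (∑-mono-≤ (base s) λ r _ → indicator≤1 (good? r))
      (ℚₚ.≤-reflexive (trans (∑-const (base s) 1ℚ) (ℚₚ.*-identityʳ b)))

  equidistributed : (E : ℕ → ℕ) →
    (∀ s j → 1 ℕ.≤ s → j ℕ.< stageLength s → cutoff s ℕ.≤ j % base s → E (stageStart s ℕ.+ j) ≡ j % base s) →
    Equidistributed narrow E
  equidistributed E uniform u v 0≤u v≤1 m = let (C , ev) = conclusion in C , Eventually-map
      (λ n → subst₂ (λ t w → fromℕ m * t ≤ fromℕ 3 * w + C) (total n) (ones n)) ev
    where
    s₀ = m ℕ.⊔ 1
    total : ∀ n → ∑ n (λ i → (v - u) - indicator (fits? narrow E u v i)) ≡ fromℕ n * (v - u) - count (fits? narrow E u v) n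
    total n = trans (∑-distrib-minus n (λ _ → v - u) (λ i → indicator (fits? narrow E u v i)))
      (cong (_- count (fits? narrow E u v) n) (∑-const n (v - u)))
    ones : ∀ n → stagewise (λ _ → 1ℚ) n ≡ fromℕ n
    ones n = trans (∑-const n 1ℚ) (ℚₚ.*-identityʳ (fromℕ n))
    φ : ℕ → ℕ → ℚ
    φ s r = indicator (good? u v 0≤u v≤1 s r)
    δ : ℕ → ℕ → ℚ
    δ s j = (v - u) - φ s (j % base s)
    good⇒fits : ∀ {s r} n → stage n ≡ s → E n ≡ r → Good u v 0≤u v≤1 s r → Fits narrow E u v n
    good⇒fits n refl refl (_ , low , high) = low , high
    d≤δ : ∀ s → s₀ ℕ.≤ s → ∀ j → j ℕ.< stageLength s →
      (v - u) - indicator (fits? narrow E u v (stageStart s ℕ.+ j)) ≤ δ s j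
    d≤δ s s₀≤s j j<L = ℚₚ.+-monoʳ-≤ (v - u) (ℚₚ.neg-antimono-≤ (indicator-mono
      (good? u v 0≤u v≤1 s (j % base s)) (fits? narrow E u v (stageStart s ℕ.+ j))
      λ good → good⇒fits (stageStart s ℕ.+ j) (stage-start s j j<L)
        (uniform s j (ℕₚ.m⊔n≤o⇒n≤o m 1 s₀≤s) j<L (good .proj₁)) good))
    inside : ∀ s → s₀ ℕ.≤ s → ∀ j → j ℕ.≤ stageLength s → fromℕ m * ∑ j (δ s) ≤ fromℕ j * 1ℚ + fromℕ (m ℕ.* base s)
    inside s s₀≤s j _ = subst₂ (λ t w → M * t ≤ w) (sym ∑δ) total-weight
      (p≡q+r⇒q≤p (cert M (v - u) x b S T cut)
        (+-nonNeg (*-nonNeg 0≤M (p≤q⇒0≤q-p (Row.lower j)))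
          (+-nonNeg (*-nonNeg 0≤M (*-nonNeg 0≤x (p≤q⇒0≤q-p (count-good-≥ u v 0≤u v≤1 s))))
            (+-nonNeg (*-nonNeg 0≤M (p≤q⇒0≤q-p (count-good-≤ u v 0≤u v≤1 s)))
              (*-nonNeg 0≤x (p≤q⇒0≤q-p (subst (_≤ b) m*[cut+2] (fromℕ-mono-≤ m*[cut+2]≤))))))))
      where
      M = fromℕ m
      0≤M = fromℕ-nonNeg m
      b = fromℕ (base s)
      x = fromℕ j * recip (base s)
      0≤x : 0ℚ ≤ x
      0≤x = *-nonNeg (fromℕ-nonNeg j) (recip-nonNeg (base s))
      cut = fromℕ (cutoff s)
      module Row = Periodic (base s) (φ s) (λ r → indicator-nonNeg (good? u v 0≤u v≤1 s r))
      S = ∑ j (λ i → φ s (i % base s))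
      T = ∑ (base s) (φ s)
      xb≡j : x * b ≡ fromℕ j
      xb≡j = trans (ℚₚ.*-assoc (fromℕ j) (recip (base s)) b)
        (trans (cong (fromℕ j *_) (recip-*-cancel (base s))) (ℚₚ.*-identityʳ (fromℕ j)))
      ∑δ : ∑ j (δ s) ≡ (v - u) * (x * b) - S
      ∑δ = trans (∑-distrib-minus j (λ _ → v - u) (λ i → φ s (i % base s)))
        (cong (_- S) (trans (∑-const j (v - u)) (trans (ℚₚ.*-comm (fromℕ j) (v - u)) (cong ((v - u) *_) (sym xb≡j)))))
      total-weight : x * b + M * b ≡ fromℕ j * 1ℚ + fromℕ (m ℕ.* base s)
      total-weight = cong₂ _+_ (trans xb≡j (sym (ℚₚ.*-identityʳ (fromℕ j)))) (sym (fromℕ-* m (base s)))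
      m*[cut+2]≤ : m ℕ.* (cutoff s ℕ.+ 2) ℕ.≤ base s
      m*[cut+2]≤ = ℕₚ.≤-trans (ℕₚ.*-monoˡ-≤ (cutoff s ℕ.+ 2) (ℕₚ.m⊔n≤o⇒m≤o m 1 s₀≤s)) (s*[cutoff+2]≤base s)
      m*[cut+2] : fromℕ (m ℕ.* (cutoff s ℕ.+ 2)) ≡ M * (cut + (1ℚ + 1ℚ))
      m*[cut+2] = trans (fromℕ-* m (cutoff s ℕ.+ 2)) (cong (M *_) (fromℕ-+ (cutoff s) 2))
      cert : ∀ M d x b S T c → x * b + M * b ≡ M * (d * (x * b) - S) + (M * (S - (T * x - T))
        + (M * (x * (T - (d * b - (c + (1ℚ + 1ℚ))))) + (M * (b - T) + x * (b - M * (c + (1ℚ + 1ℚ))))))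
      cert = solve-∀ ℚ-ring
    paid : ∀ s a → a ℕ.≤ 2 ℕ.* base s ℕ.* (2 ℕ.* base s) → fromℕ a ≤ fromℕ (stageLength s) * 1ℚ
    paid s a a≤ = subst (λ w → fromℕ a ≤ fromℕ (stageLength s) * w) (weight-zero s) (stage-weight 0 s z≤n a≤)
      where
      weight-zero : ∀ s → weight 0 s ≡ 1ℚ
      weight-zero s = *-cancelʳ-fromℕ (period s 0) (trans (recip-*-cancel (period s 0))
        (trans (cong fromℕ (sym (period-zero s))) (sym (ℚₚ.*-identityˡ (fromℕ (period s 0))))))
    m≤base : ∀ s → s₀ ℕ.≤ s → m ℕ.≤ base s
    m≤base s s₀≤s = ℕₚ.≤-trans (ℕₚ.m⊔n≤o⇒m≤o m 1 s₀≤s) (s≤base s)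
    four-squares : ∀ b → b ℕ.* (4 ℕ.* b) ≡ 2 ℕ.* b ℕ.* (2 ℕ.* b)
    four-squares = ℕ-Solver.solve-∀
    open StageLemma m s₀ (λ n → (v - u) - indicator (fits? narrow E u v n)) δ (λ _ → 1ℚ) (λ s → fromℕ (m ℕ.* base s))
      (λ _ → 0≤1) d≤δ inside
      (λ s s₀≤s → paid s _ (ℕₚ.≤-trans (ℕₚ.*-monoˡ-≤ (base s) (m≤base s s₀≤s))
        (ℕₚ.*-mono-≤ (ℕₚ.m≤n*m (base s) 2) (ℕₚ.m≤n*m (base s) 2))))
      (λ s s₀≤s → paid s _ (ℕₚ.≤-trans (ℕₚ.*-mono-≤ (m≤base s s₀≤s) (base-suc≤ s)) (ℕₚ.≤-reflexive (four-squares (base s)))))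

open UniformFiller

module Examples where
  open import Data.Rational.Base using (_+_; _*_; _-_; -_; _≤_; _<_)
  open import Data.Nat.DivMod using (_%_; m<n⇒m%n≡m)
  import Data.Nat.Tactic.RingSolver as ℕ-Solver
  open import Data.Vec.Base using ([]; _∷_)

  occurrences-nonNeg : ∀ {k} (B : Block k) E n → 0ℚ ≤ occurrences B E n
  occurrences-nonNeg B E n = subst (0ℚ ≤_) (sym (occurrences≡count B E n))
    (∑-nonNeg n λ i → indicator-nonNeg (occursAt? B E i))

  occurrences-cong : ∀ {k} (B : Block k) {E E′} → (∀ n → E n ≡ E′ n) →
    ∀ n → occurrences B E n ≡ occurrences B E′ n
  occurrences-cong B {E} {E′} E≡E′ n = trans (occurrences≡count B E n)
    (trans (∑-cong n same) (sym (occurrences≡count B E′ n)))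
    where
    transport : ∀ {F G : ℕ → ℕ} → (∀ n → F n ≡ G n) → ∀ i → OccursAt B F i → OccursAt B G i
    transport {F} {G} F≡G i occ = nth⇒occursAt B G i λ t t<k → trans (sym (F≡G (i ℕ.+ t))) (occursAt⇒nth B F i occ t t<k)
    same : ∀ i → indicator (occursAt? B E i) ≡ indicator (occursAt? B E′ i)
    same i = ℚₚ.≤-antisym
      (indicator-mono (occursAt? B E i) (occursAt? B E′ i) (transport E≡E′ i))
      (indicator-mono (occursAt? B E′ i) (occursAt? B E i) (transport (λ n → sym (E≡E′ n)) i))

  equivalent⇒ratio⟶1 : ∀ {f g h} → (∀ n → 0ℚ ≤ f n) → (∀ n → 0ℚ ≤ g n) →
    Eventually (λ n → 0ℚ < h n) → f ≲ h → h ≲ f → g ≲ h → h ≲ g → (λ n → f n /₀ g n) ⟶ fromℚ 1ℚ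
  equivalent⇒ratio⟶1 {f} {g} {h} 0≤f 0≤g 0<h f≲h h≲f g≲h h≲g =
    ≲⇒⟶1 (Eventually-map positive (Eventually-∩ 0<h (h≲g 1))) (≲-trans 0≤g f≲h h≲g) (≲-trans 0≤f g≲h h≲f)
    where
    positive : ∀ n → 0ℚ < h n × fromℕ 1 * h n ≤ fromℕ 2 * g n → 0ℚ < g n
    positive n (0<hn , h≤2g) = ℚₚ.*-cancelˡ-<-nonNeg (fromℕ 2) (ℚₚ.<-≤-trans
      (subst (_< h n) (sym (ℚₚ.*-zeroʳ (fromℕ 2))) 0<hn) (subst (_≤ fromℕ 2 * g n) (ℚₚ.*-identityˡ (h n)) h≤2g))

  normal⇒ratioNormal : ∀ Q → FullyDivergent Q → ∀ {x} → Normal Q x → RatioNormal Q x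
  normal⇒ratioNormal Q divergent (E₀ , E , expansion , normal) = E₀ , E , expansion , λ k 1≤k B₁ B₂ →
    let pos = ⟶∞⇒pos (divergent k 1≤k)
        (f≲ , ≲f) = ⟶1⇒≲ pos (normal k 1≤k B₁)
        (g≲ , ≲g) = ⟶1⇒≲ pos (normal k 1≤k B₂)
    in equivalent⇒ratio⟶1 (occurrences-nonNeg B₁ E) (occurrences-nonNeg B₂ E) pos f≲ ≲f g≲ ≲g

  infiniteInLimit : ∀ Q → (∀ n → stage n ℕ.≤ q Q n) → InfiniteInLimit Q
  infiniteInLimit Q stage≤q M = stageStart s , λ n K≤n → ℚₚ.<-≤-trans (archimedean M .proj₂)
      (fromℕ-mono-≤ (ℕₚ.≤-trans (start≤⇒≤stage {s} K≤n) (stage≤q n)))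
    where
    s = archimedean M .proj₁

  narrow-infiniteInLimit : InfiniteInLimit narrow
  narrow-infiniteInLimit = infiniteInLimit narrow λ n → s≤base (stage n)

  wide-infiniteInLimit : InfiniteInLimit wide
  wide-infiniteInLimit = infiniteInLimit wide λ n →
    ℕₚ.≤-trans (s≤base (stage n)) (ℕₚ.m≤n*m (base (stage n)) 2)

  wide-fullyDivergent : FullyDivergent wide
  wide-fullyDivergent k _ = Qsum-wide⟶∞ k

  narrow-fullyDivergent : FullyDivergent narrow
  narrow-fullyDivergent k _ M = Eventually-map
    (λ n M< → ℚₚ.<-≤-trans M< (∑-mono-≤ n λ i _ →
      recip-anti {{∏-nonZero {narrow} {i} {k}}} {{∏-nonZero {wide} {i} {k}}} (∏-narrow≤wide i k)))
    (Qsum-wide⟶∞ k M)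
    where
    ∏-narrow≤wide : ∀ i k → ∏ narrow i k ℕ.≤ ∏ wide i k
    ∏-narrow≤wide i zero    = ℕₚ.≤-refl
    ∏-narrow≤wide i (suc k) = ℕₚ.*-mono-≤ (∏-narrow≤wide i k) (ℕₚ.m≤n*m (base (stage (i ℕ.+ k))) 2)

  digitAt<narrow : ∀ n → digitAt n ℕ.< q narrow n
  digitAt<narrow n = digit<base (stage n) (offset n)

  digitAt<wide : ∀ n → digitAt n ℕ.< q wide n
  digitAt<wide n = ℕₚ.<-≤-trans (digitAt<narrow n) (ℕₚ.m≤n*m (base (stage n)) 2)

  wide-nonTrivial : NonTrivial wide digitAt
  wide-nonTrivial m = m , ℕₚ.≤-refl , λ eq → ℕₚ.<-irrefl eq (begin-strict
      suc (digitAt m)      ≤⟨ digitAt<narrow m ⟩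
      base (stage m)       <⟨ ℕₚ.m<m+n (base (stage m)) (ℕₚ.≤-trans (ℕₚ.n≤1+n 1) (2≤base (stage m))) ⟩
      base (stage m) ℕ.+ base (stage m) ≡⟨ double (base (stage m)) ⟩
      2 ℕ.* base (stage m) ∎)
    where
    open ℕₚ.≤-Reasoning
    double : ∀ b → b ℕ.+ b ≡ 2 ℕ.* b
    double = ℕ-Solver.solve-∀

  module _ (m : ℕ) where
    private
      s = suc m
      j = cutoff s

    firstFiller : ℕ
    firstFiller = stageStart s ℕ.+ j

    j<stageLength : j ℕ.< stageLength s
    j<stageLength = ℕₚ.<-≤-trans (cutoff<base s) (base≤period-suc s (suc s))

    digitAt-firstFiller : digitAt firstFiller ≡ cutoff s
    digitAt-firstFiller = trans (digitAt-start s j j<stageLength)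
      (trans (filler s j (ℕₚ.≤-reflexive (sym column))) column)
      where
      column : j % base s ≡ j
      column = m<n⇒m%n≡m (cutoff<base s)

    m≤firstFiller : m ℕ.≤ firstFiller
    m≤firstFiller = ℕₚ.≤-trans (ℕₚ.≤-trans (ℕₚ.n≤1+n m) (ℕₚ.m≤m*n s (suc s))) (ℕₚ.m≤n+m j (stageStart s))

    firstFiller-notMaximal : suc (cutoff s) ≢ q narrow firstFiller
    firstFiller-notMaximal eq = ℕₚ.<-irrefl (trans eq (cong base (stage-start s j j<stageLength)))
      (ℕₚ.≤-trans (ℕₚ.≤-reflexive (ℕₚ.+-comm 2 (cutoff s)))
        (ℕₚ.≤-trans (ℕₚ.m≤n*m (cutoff s ℕ.+ 2) s) (s*[cutoff+2]≤base s)))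

  narrow-nonTrivial : NonTrivial narrow digitAt
  narrow-nonTrivial m = firstFiller m , m≤firstFiller m ,
    λ eq → firstFiller-notMaximal m (trans (cong suc (sym (digitAt-firstFiller m))) eq)

  module Narrow = Digits narrow digitAt digitAt<narrow
  module Wide   = Digits wide digitAt digitAt<wide

  ratios⟶1 : ∀ k → 1 ℕ.≤ k → (B₁ B₂ : Block k) →
    (λ n → occurrences B₁ digitAt n /₀ occurrences B₂ digitAt n) ⟶ fromℚ 1ℚ
  ratios⟶1 (suc k) _ B₁ B₂ = equivalent⇒ratio⟶1 (occurrences-nonNeg B₁ digitAt) (occurrences-nonNeg B₂ digitAt)
    (⟶∞⇒pos (expected⟶∞ (suc k)))
    (occurrences≲expected B₁) (expected≲occurrences B₁) (occurrences≲expected B₂) (expected≲occurrences B₂)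
    where
    open BlockCount

  occurrences≲Qsum : ∀ {k} (B : Block (suc k)) → occurrences B digitAt ≲ Qsum wide (suc k)
  occurrences≲Qsum {k} B = ≲-trans (λ n → ∑-nonNeg n λ i → ℚₚ.<⇒≤ (1/∏-pos wide i (suc k)))
    (BlockCount.occurrences≲expected B) (expected≲Qsum (suc k))

  Qsum≲occurrences : ∀ {k} (B : Block (suc k)) → Qsum wide (suc k) ≲ occurrences B digitAt
  Qsum≲occurrences {k} B = ≲-trans (occurrences-nonNeg B digitAt)
    (Qsum≲expected (suc k)) (BlockCount.expected≲occurrences B)

  wide-normal : Normal wide Wide.value
  wide-normal = + 0 , digitAt , Wide.value-expansion wide-nonTrivial , normal
    where
    normal : ∀ k → 1 ℕ.≤ k → (B : Block k) → (λ n → occurrences B digitAt n /₀ Qsum wide k n) ⟶ fromℚ 1ℚ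
    normal (suc k) _ B = ≲⇒⟶1 (⟶∞⇒pos (Qsum-wide⟶∞ (suc k))) (occurrences≲Qsum B) (Qsum≲occurrences B)

  wide-¬distributionNormal : ¬ DistributionNormal wide Wide.value
  wide-¬distributionNormal = all-fit⇒¬distributionNormal wide digitAt digitAt<wide {½} ½<1 λ n →
      *-nonNeg (fromℕ-nonNeg (digitAt n)) (recip-nonNeg (q wide n) {{q-nonZero wide n}})
    , *-cancelˡ-≤ (fromℕ (q wide n)) (fromℕ-nonZero⇒pos (q wide n) {{q-nonZero wide n}})
        (subst₂ _≤_ (sym (scaled (fromℕ (suc (digitAt n))) n)) (half (base (stage n)))
          (fromℕ-mono-≤ (digitAt<narrow n)))
    where
    ½<1 : ½ < 1ℚ
    ½<1 = p≡q+r⇒q<p {1ℚ} {½} {½} refl (ℚₚ.positive⁻¹ ½)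
    scaled : ∀ d n → fromℕ (q wide n) * (d * 1/q wide n) ≡ d
    scaled d n = trans (eq (fromℕ (q wide n)) d (1/q wide n))
      (trans (cong (d *_) (1/q-cancel wide n)) (ℚₚ.*-identityʳ d))
      where
      eq : ∀ a b c → a * (b * c) ≡ b * (c * a)
      eq = solve-∀ ℚ-ring
    half : ∀ b → fromℕ b ≡ fromℕ (2 ℕ.* b) * ½
    half b = trans (sym (half+half (fromℕ b)))
      (trans (eq (fromℕ b)) (cong (_* ½) (sym (fromℕ-* 2 b))))
      where
      eq : ∀ b → ½ * b + ½ * b ≡ (1ℚ + 1ℚ) * b * ½
      eq = solve-∀ ℚ-ring

  narrow-ratioNormal : RatioNormal narrow Narrow.value
  narrow-ratioNormal = + 0 , digitAt , Narrow.value-expansion narrow-nonTrivial , ratios⟶1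

  narrow-distributionNormal : DistributionNormal narrow Narrow.value
  narrow-distributionNormal = equidistributed⇒distributionNormal narrow digitAt digitAt<narrow
    (equidistributed digitAt λ s j _ j<L h → trans (digitAt-start s j j<L) (filler s j h))

  Qsum-narrow : ∀ n → Qsum narrow 1 n ≡ fromℕ 2 * Qsum wide 1 n
  Qsum-narrow n = trans (∑-cong n term) (∑-*ˡ n (fromℕ 2) (λ i → 1/∏ wide i 1))
    where
    term : ∀ i → 1/∏ narrow i 1 ≡ fromℕ 2 * 1/∏ wide i 1
    term i = *-cancelʳ-fromℕ (∏ wide i 1) {{∏-nonZero {wide} {i} {1}}} (begin
      1/∏ narrow i 1 * fromℕ (∏ wide i 1)               ≡⟨ cong (λ p → 1/∏ narrow i 1 * fromℕ p) (double (base (stage (i ℕ.+ 0)))) ⟩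
      1/∏ narrow i 1 * fromℕ (2 ℕ.* ∏ narrow i 1)       ≡⟨ cong (1/∏ narrow i 1 *_) (fromℕ-* 2 (∏ narrow i 1)) ⟩
      1/∏ narrow i 1 * (fromℕ 2 * fromℕ (∏ narrow i 1)) ≡⟨ eq (1/∏ narrow i 1) (fromℕ 2) (fromℕ (∏ narrow i 1)) ⟩
      fromℕ 2 * (1/∏ narrow i 1 * fromℕ (∏ narrow i 1)) ≡⟨ cong (fromℕ 2 *_) (recip-*-cancel (∏ narrow i 1) {{∏-nonZero {narrow} {i} {1}}}) ⟩
      fromℕ 2 * 1ℚ                                      ≡⟨ cong (fromℕ 2 *_) (recip-*-cancel (∏ wide i 1) {{∏-nonZero {wide} {i} {1}}}) ⟨
      fromℕ 2 * (1/∏ wide i 1 * fromℕ (∏ wide i 1))     ≡⟨ ℚₚ.*-assoc (fromℕ 2) (1/∏ wide i 1) (fromℕ (∏ wide i 1)) ⟨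
      fromℕ 2 * 1/∏ wide i 1 * fromℕ (∏ wide i 1)       ∎)
      where
      open ≡-Reasoning
      double : ∀ b → 1 ℕ.* (2 ℕ.* b) ≡ 2 ℕ.* (1 ℕ.* b)
      double = ℕ-Solver.solve-∀
      eq : ∀ a b c → a * (b * c) ≡ b * (a * c)
      eq = solve-∀ ℚ-ring

  narrow-¬normal : ¬ Normal narrow Narrow.value
  narrow-¬normal (E₀ , E , expansion , normal) = ℚₚ.<-irrefl refl (ℚₚ.<-≤-trans
      (at .proj₁) (*-cancelˡ-≤ seven (ℚₚ.positive⁻¹ seven) (p≡q+r⇒q≤p (cert (occurrences zeroBlock digitAt n) q₂)
        (+-nonNeg (*-nonNeg (ℚₚ.nonNegative⁻¹ four) (p≤q⇒0≤q-p lower))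
          (*-nonNeg (ℚₚ.nonNegative⁻¹ five) (p≤q⇒0≤q-p (at .proj₂ .proj₁)))))))
    where
    zeroBlock : Block 1
    zeroBlock = 0 ∷ []
    four  = 1ℚ + 1ℚ + 1ℚ + 1ℚ
    five  = four + 1ℚ
    seven = five + 1ℚ + 1ℚ
    same : ∀ n → E n ≡ digitAt n
    same = digits-unique {narrow} {Narrow.value} expansion (Narrow.value-expansion narrow-nonTrivial)
    found = Eventually-∃ (Eventually-∩ (⟶∞⇒pos (Qsum-wide⟶∞ 1)) (Eventually-∩ (occurrences≲Qsum zeroBlock 4)
      (⟶1⇒≲ (⟶∞⇒pos (narrow-fullyDivergent 1 ℕₚ.≤-refl)) (normal 1 ℕₚ.≤-refl zeroBlock) .proj₂ 4)))
    n = found .proj₁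
    at = found .proj₂
    q₂ = Qsum wide 1 n
    lower : four * ((1ℚ + 1ℚ) * q₂) ≤ five * occurrences zeroBlock digitAt n
    lower = subst₂ (λ a b → four * a ≤ five * b) (Qsum-narrow n) (occurrences-cong zeroBlock same n) (at .proj₂ .proj₂)
    cert : ∀ f q → (1ℚ + 1ℚ + 1ℚ + 1ℚ + 1ℚ + 1ℚ + 1ℚ) * 0ℚ ≡ (1ℚ + 1ℚ + 1ℚ + 1ℚ + 1ℚ + 1ℚ + 1ℚ) * q
      + ((1ℚ + 1ℚ + 1ℚ + 1ℚ) * ((1ℚ + 1ℚ + 1ℚ + 1ℚ + 1ℚ) * f - (1ℚ + 1ℚ + 1ℚ + 1ℚ) * ((1ℚ + 1ℚ) * q))
      + (1ℚ + 1ℚ + 1ℚ + 1ℚ + 1ℚ) * ((1ℚ + 1ℚ + 1ℚ + 1ℚ + 1ℚ) * q - (1ℚ + 1ℚ + 1ℚ + 1ℚ) * f))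
    cert = solve-∀ ℚ-ring

  zeroFree : ℕ → ℕ
  zeroFree n = 1 ℕ.⊔ digitAt n

  zeroFree<narrow : ∀ n → zeroFree n ℕ.< q narrow n
  zeroFree<narrow n = ℕₚ.⊔-lub (2≤base (stage n)) (digitAt<narrow n)

  module ZeroFree = Digits narrow zeroFree zeroFree<narrow

  zeroFree-nonTrivial : NonTrivial narrow zeroFree
  zeroFree-nonTrivial m = firstFiller m , m≤firstFiller m , λ eq →
    firstFiller-notMaximal m (trans (cong (λ d → suc (1 ℕ.⊔ d)) (sym (digitAt-firstFiller m))) eq)

  zeroFree-distributionNormal : DistributionNormal narrow ZeroFree.value
  zeroFree-distributionNormal = equidistributed⇒distributionNormal narrow zeroFree zeroFree<narrow
    (equidistributed zeroFree λ s j 1≤s j<L h →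
      trans (cong (1 ℕ.⊔_) (trans (digitAt-start s j j<L) (filler s j h)))
        (ℕₚ.m≤n⇒m⊔n≡n (ℕₚ.≤-trans (ℕₚ.≤-trans 1≤s (ℕₚ.m≤m*n s (suc s))) h)))

  -- The block 0 never occurs, and 0 /₀ 0 = 0 does not tend to 1.
  zeroFree-¬ratioNormal : ¬ RatioNormal narrow ZeroFree.value
  zeroFree-¬ratioNormal (E₀ , E , expansion , ratios) = ℚₚ.<-irrefl refl (ℚₚ.<-≤-trans ½<1
      (subst (λ t → 1ℚ - (t /₀ t) ≤ ½) (none n) (found .proj₂ .proj₂)))
    where
    ½<1 : ½ < 1ℚ
    ½<1 = p≡q+r⇒q<p {1ℚ} {½} {½} refl (ℚₚ.positive⁻¹ ½)
    zeroBlock : Block 1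
    zeroBlock = 0 ∷ []
    same : ∀ n → E n ≡ zeroFree n
    same = digits-unique {narrow} {ZeroFree.value} expansion (ZeroFree.value-expansion zeroFree-nonTrivial)
    found = Eventually-∃ (⟶-fromℚ⁻ (λ n → occurrences zeroBlock E n /₀ occurrences zeroBlock E n) 1ℚ
      (ratios 1 ℕₚ.≤-refl zeroBlock zeroBlock) ½ (ℚₚ.positive⁻¹ ½))
    n = found .proj₁
    E≢0 : ∀ j → E j ≢ 0
    E≢0 j eq = ℕₚ.1+n≰n (ℕₚ.≤-trans (ℕₚ.m≤m⊔n 1 (digitAt j)) (ℕₚ.≤-reflexive (trans (sym (same j)) eq)))
    none : ∀ n → occurrences zeroBlock E n ≡ 0ℚ
    none n = trans (occurrences≡count zeroBlock E n) (trans (∑-cong n never) (trans (∑-const n 0ℚ) (ℚₚ.*-zeroʳ (fromℕ n))))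
      where
      never : ∀ j → indicator (occursAt? zeroBlock E j) ≡ 0ℚ
      never j = indicator-false (occursAt? zeroBlock E j) λ occ →
        E≢0 (j ℕ.+ 0) (occursAt⇒nth zeroBlock E j occ 0 (s≤s z≤n))

open Examples

module Containments where

  Separated : Vertex → Vertex → Set
  Separated A B = ∃ λ Q → InfiniteInLimit Q × FullyDivergent Q × ∃ λ x → ⟦ A ⟧ Q x × ¬ ⟦ B ⟧ Q x

  separatedByN : ∀ A B → ⟦ A ⟧ narrow Narrow.value →
    (⟦ B ⟧ narrow Narrow.value → Normal narrow Narrow.value) → Separated A B
  separatedByN A B a B⊆N =
    narrow , narrow-infiniteInLimit , narrow-fullyDivergent , Narrow.value , a , narrow-¬normal ∘ B⊆N

  separatedByDN : ∀ A B → ⟦ A ⟧ wide Wide.value →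
    (⟦ B ⟧ wide Wide.value → DistributionNormal wide Wide.value) → Separated A B
  separatedByDN A B a B⊆DN =
    wide , wide-infiniteInLimit , wide-fullyDivergent , Wide.value , a , wide-¬distributionNormal ∘ B⊆DN

  separatedByRN : ∀ B → (⟦ B ⟧ narrow ZeroFree.value → RatioNormal narrow ZeroFree.value) → Separated DN B
  separatedByRN B B⊆RN =
    narrow , narrow-infiniteInLimit , narrow-fullyDivergent , ZeroFree.value ,
    zeroFree-distributionNormal , zeroFree-¬ratioNormal ∘ B⊆RN

  wide-ratioNormal : RatioNormal wide Wide.value
  wide-ratioNormal = normal⇒ratioNormal wide wide-fullyDivergent {Wide.value} wide-normal

  reachable-from-N∩DN : ∀ B → Star Edge N∩DN B
  reachable-from-N∩DN N       = N∩DN→N ◅ nil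
  reachable-from-N∩DN RN      = N∩DN→N ◅ N→RN ◅ nil
  reachable-from-N∩DN DN      = N∩DN→RN∩DN ◅ RN∩DN→DN ◅ nil
  reachable-from-N∩DN N∩RN    = N∩DN→N ◅ N→N∩RN ◅ nil
  reachable-from-N∩DN RN∩DN   = N∩DN→RN∩DN ◅ nil
  reachable-from-N∩DN N∩DN    = nil
  reachable-from-N∩DN N∩RN∩DN = N∩DN→N∩RN∩DN ◅ nil

  reachable-or-separated : ∀ A B → Star Edge A B ⊎ Separated A B
  reachable-or-separated N N       = inj₁ nil
  reachable-or-separated N RN      = inj₁ (N→RN ◅ nil)
  reachable-or-separated N N∩RN    = inj₁ (N→N∩RN ◅ nil)
  reachable-or-separated N DN      = inj₂ (separatedByDN N DN wide-normal (λ d → d))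
  reachable-or-separated N RN∩DN   = inj₂ (separatedByDN N RN∩DN wide-normal proj₂)
  reachable-or-separated N N∩DN    = inj₂ (separatedByDN N N∩DN wide-normal proj₂)
  reachable-or-separated N N∩RN∩DN = inj₂ (separatedByDN N N∩RN∩DN wide-normal (proj₂ ∘ proj₂))
  reachable-or-separated RN RN      = inj₁ nil
  reachable-or-separated RN N       = inj₂ (separatedByN RN N narrow-ratioNormal (λ n → n))
  reachable-or-separated RN N∩RN    = inj₂ (separatedByN RN N∩RN narrow-ratioNormal proj₁)
  reachable-or-separated RN N∩DN    = inj₂ (separatedByN RN N∩DN narrow-ratioNormal proj₁)
  reachable-or-separated RN N∩RN∩DN = inj₂ (separatedByN RN N∩RN∩DN narrow-ratioNormal proj₁)
  reachable-or-separated RN DN      = inj₂ (separatedByDN RN DN wide-ratioNormal (λ d → d))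
  reachable-or-separated RN RN∩DN   = inj₂ (separatedByDN RN RN∩DN wide-ratioNormal proj₂)
  reachable-or-separated DN DN      = inj₁ nil
  reachable-or-separated DN RN      = inj₂ (separatedByRN RN (λ r → r))
  reachable-or-separated DN N∩RN    = inj₂ (separatedByRN N∩RN proj₂)
  reachable-or-separated DN RN∩DN   = inj₂ (separatedByRN RN∩DN proj₁)
  reachable-or-separated DN N∩RN∩DN = inj₂ (separatedByRN N∩RN∩DN (proj₁ ∘ proj₂))
  reachable-or-separated DN N       = inj₂ (separatedByRN N
    (normal⇒ratioNormal narrow narrow-fullyDivergent {ZeroFree.value}))
  reachable-or-separated DN N∩DN    = inj₂ (separatedByRN N∩DN
    (normal⇒ratioNormal narrow narrow-fullyDivergent {ZeroFree.value} ∘ proj₁))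
  reachable-or-separated N∩RN N∩RN    = inj₁ nil
  reachable-or-separated N∩RN N       = inj₁ (N∩RN→N ◅ nil)
  reachable-or-separated N∩RN RN      = inj₁ (N∩RN→N ◅ N→RN ◅ nil)
  reachable-or-separated N∩RN DN      = inj₂ (separatedByDN N∩RN DN (wide-normal , wide-ratioNormal) (λ d → d))
  reachable-or-separated N∩RN RN∩DN   = inj₂ (separatedByDN N∩RN RN∩DN (wide-normal , wide-ratioNormal) proj₂)
  reachable-or-separated N∩RN N∩DN    = inj₂ (separatedByDN N∩RN N∩DN (wide-normal , wide-ratioNormal) proj₂)
  reachable-or-separated N∩RN N∩RN∩DN = inj₂ (separatedByDN N∩RN N∩RN∩DN (wide-normal , wide-ratioNormal) (proj₂ ∘ proj₂))
  reachable-or-separated RN∩DN RN∩DN   = inj₁ nil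
  reachable-or-separated RN∩DN RN      = inj₁ (RN∩DN→RN ◅ nil)
  reachable-or-separated RN∩DN DN      = inj₁ (RN∩DN→DN ◅ nil)
  reachable-or-separated RN∩DN N       = inj₂ (separatedByN RN∩DN N (narrow-ratioNormal , narrow-distributionNormal) (λ n → n))
  reachable-or-separated RN∩DN N∩RN    = inj₂ (separatedByN RN∩DN N∩RN (narrow-ratioNormal , narrow-distributionNormal) proj₁)
  reachable-or-separated RN∩DN N∩DN    = inj₂ (separatedByN RN∩DN N∩DN (narrow-ratioNormal , narrow-distributionNormal) proj₁)
  reachable-or-separated RN∩DN N∩RN∩DN = inj₂ (separatedByN RN∩DN N∩RN∩DN (narrow-ratioNormal , narrow-distributionNormal) proj₁)
  reachable-or-separated N∩DN    B = inj₁ (reachable-from-N∩DN B)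
  reachable-or-separated N∩RN∩DN B = inj₁ (N∩RN∩DN→N∩DN ◅ reachable-from-N∩DN B)

  edge-sound : ∀ {A B} → Edge A B → ∀ Q → FullyDivergent Q → ⟦ A ⟧ Q ⊆ ⟦ B ⟧ Q
  edge-sound RN∩DN→RN     Q fd (r , d)     = r
  edge-sound RN∩DN→DN     Q fd (r , d)     = d
  edge-sound N→RN         Q fd {x} n       = normal⇒ratioNormal Q fd {x} n
  edge-sound N∩DN→RN∩DN   Q fd {x} (n , d) = normal⇒ratioNormal Q fd {x} n , d
  edge-sound N∩DN→N       Q fd (n , d)     = n
  edge-sound N∩RN∩DN→N∩DN Q fd (n , r , d) = n , d
  edge-sound N∩DN→N∩RN∩DN Q fd {x} (n , d) = n , normal⇒ratioNormal Q fd {x} n , d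
  edge-sound N→N∩RN       Q fd {x} n       = n , normal⇒ratioNormal Q fd {x} n
  edge-sound N∩RN→N       Q fd (n , r)     = n

  path-sound : ∀ {A B} → Star Edge A B → ∀ Q → FullyDivergent Q → ⟦ A ⟧ Q ⊆ ⟦ B ⟧ Q
  path-sound nil        Q fd     a = a
  path-sound (e ◅ es) Q fd {x} a = path-sound es Q fd {x} (edge-sound e Q fd {x} a)

open Containments

theorem1p2 : ∀ (A B : Vertex) →
    (∀ (Q : BasicSequence) → InfiniteInLimit Q → FullyDivergent Q → ⟦ A ⟧ Q ⊆ ⟦ B ⟧ Q) ⇔ Star Edge A B
theorem1p2 A B = mk⇔ complete (λ path Q _ divergent {x} → path-sound path Q divergent {x})
  where
  complete : (∀ (Q : BasicSequence) → InfiniteInLimit Q → FullyDivergent Q → ⟦ A ⟧ Q ⊆ ⟦ B ⟧ Q) → Star Edge A B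
  complete A⊆B with reachable-or-separated A B
  ... | inj₁ path                          = path
  ... | inj₂ (Q , inf , div , x , a , ¬b) = contradiction (A⊆B Q inf div {x} a) ¬b
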